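{- For all $n\geq6$, the second largest eigenvalue of $A_{[4,1^{n-4}]}$ is $$\phi^{[n-1,1]}_{[4,1^{n-4}]}=2n^4-20n^3+66n^2-80n+24,$$ i.e. $\phi^\lambda_{[4,1^{n-4}]}\leq\phi^{[n-1,1]}_{[4,1^{n-4}]}$ for all $\lambda\vdash n$, $\lambda\neq[n]$. The spectral gap of the corresponding graph is $\phi^{[n]}_{[4,1^{n-4}]}-\phi^{[n-1,1]}_{[4,1^{n-4}]}=8n^3-44n^2+68n-24$.
   Context: For $n\geq1$ let $\mathcal{M}_{2n}$ be the set of perfect matchings of $K_{2n}$ on $\{1,\dots,2n\}$. For $P,Q\in\mathcal{M}_{2n}$, $P\cup Q$ is a disjoint union of even cycles (a common edge counts as a $2$-cycle); if their lengths are $2\mu_1\geq\dots\geq 2\mu_k$, $P,Q$ are $\mu$-related, $\mu=[\mu_1,\dots,\mu_k]\vdash n$. $A_\mu$ is the $0/1$ matrix on $\mathcal{M}_{2n}$ with $(P,Q)$-entry $1$ iff $P,Q$ are $\mu$-related. The $A_\mu$ commute; their common eigenspaces are indexed by $\lambda\vdash n$, the $\lambda$-eigenspace being the isotypic component of the permutation representation of $S_{2n}$ on $\mathcal{M}_{2n}$ affording the Specht module $S^{2\lambda}$, $2\lambda=[2\lambda_1,2\lambda_2,\dots]$. $\phi^\lambda_\mu$ is the eigenvalue of $A_\mu$ on the $\lambda$-eigenspace; the largest eigenvalue is the valency $\phi^{[n]}_\mu$. $1^a$ denotes $a$ parts equal to $1$. -}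

module Defs where

open import Data.Nat as ℕ using (ℕ; zero; suc; _≡ᵇ_; _<ᵇ_; _<_; _≥_; ⌊_/2⌋)
open import Data.Integer as ℤ using (ℤ; +_)
open import Data.Rational using (ℚ; 0ℚ; 1ℚ; _+_; _*_; -_; _/_)
open import Data.Bool using (Bool; true; false; if_then_else_; _∨_; _∧_; not)
open import Data.List using (List; []; _∷_; [_]; map; concatMap; foldr; upTo; length; _++_; replicate)
open import Data.Nat.ListAction using (sum)
open import Data.Bool.ListAction using (any)
open import Data.List.Relation.Unary.All using (All)
open import Data.List.Relation.Unary.Any using (Any)
open import Data.List.Relation.Unary.Linked using (Linked)
open import Data.List.Membership.Propositional using (_∈_)
open import Data.Product using (_×_; _,_; Σ; ∃; proj₁; proj₂)
open import Relation.Binary.PropositionalEquality using (_≡_; _≢_)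
open import Function using (_∘_; id)

IsPartition : ℕ → List ℕ → Set
IsPartition n la = Linked _≥_ la × All (λ k → 0 < k) la × sum la ≡ n

insertEverywhere : ℕ → List ℕ → List (List ℕ)
insertEverywhere x [] = [ x ∷ [] ]
insertEverywhere x (y ∷ ys) = (x ∷ y ∷ ys) ∷ map (y ∷_) (insertEverywhere x ys)

orderings : List ℕ → List (List ℕ)
orderings [] = [ [] ]
orderings (x ∷ xs) = concatMap (insertEverywhere x) (orderings xs)

assoc : List ℕ → List ℕ → ℕ → ℕ
assoc (b ∷ bs) (o ∷ os) x = if x ≡ᵇ b then o else assoc bs os x
assoc _ _ x = x

-- all permutations preserving each of a list of disjoint blocks
blockGroup : List (List ℕ) → List (ℕ → ℕ)
blockGroup [] = [ id ]
blockGroup (b ∷ bs) =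
  concatMap (λ o → map (λ g → assoc b o ∘ g) (blockGroup bs)) (orderings b)

Sym : ℕ → List (ℕ → ℕ)
Sym k = blockGroup [ upTo k ]

inversions : ℕ → (ℕ → ℕ) → ℕ
inversions k f =
  sum (concatMap (λ i → map (λ j → if (i <ᵇ j) ∧ (f j <ᵇ f i) then 1 else 0) (upTo k)) (upTo k))

sgn : ℕ → (ℕ → ℕ) → ℚ
sgn k f = if isEven (inversions k f) then 1ℚ else - 1ℚ
  where
  isEven : ℕ → Bool
  isEven zero = true
  isEven (suc m) = not (isEven m)

-- Perfect matchings of {0,…,2n-1}, as canonical lists of edges (a , b), a < b,
-- sorted by first component

Matching : Set
Matching = List (ℕ × ℕ)

removeElem : ℕ → List ℕ → List ℕ
removeElem y [] = []
removeElem y (z ∷ zs) = if y ≡ᵇ z then zs else z ∷ removeElem y zs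

-- all perfect matchings of the points of a list (fuel = length)
matchingsOf : ℕ → List ℕ → List Matching
matchingsOf _ [] = [ [] ]
matchingsOf zero (_ ∷ _) = []
matchingsOf (suc f) (x ∷ xs) =
  concatMap (λ y → map ((x , y) ∷_) (matchingsOf f (removeElem y xs))) xs

Ms : ℕ → List Matching
Ms n = matchingsOf (2 ℕ.* n) (upTo (2 ℕ.* n))

orient : ℕ × ℕ → ℕ × ℕ
orient (a , b) = if b <ᵇ a then (b , a) else (a , b)

insertEdge : ℕ × ℕ → Matching → Matching
insertEdge e [] = [ e ]
insertEdge e (e' ∷ es) = if proj₁ e' <ᵇ proj₁ e then e' ∷ insertEdge e es else e ∷ e' ∷ es

canon : Matching → Matching
canon m = foldr insertEdge [] (map orient m)

act : (ℕ → ℕ) → Matching → Matching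
act σ P = canon (map (λ { (a , b) → (σ a , σ b) }) P)

partner : Matching → ℕ → ℕ
partner [] x = x
partner ((a , b) ∷ es) x = if x ≡ᵇ a then b else if x ≡ᵇ b then a else partner es x

-- points of the cycle of P ∪ Q through s, starting at x (fuel bounded)
orbit : ℕ → (ℕ → ℕ) → (ℕ → ℕ) → ℕ → ℕ → List ℕ
orbit zero p q s x = []
orbit (suc f) p q s x =
  x ∷ p x ∷ (if q (p x) ≡ᵇ s then [] else orbit f p q s (q (p x)))

memb : ℕ → List ℕ → Bool
memb x = any (_≡ᵇ x)

cycleHalfLengths : ℕ → Matching → Matching → List ℕ → List ℕ → List ℕ
cycleHalfLengths n P Q vis [] = []
cycleHalfLengths n P Q vis (x ∷ xs) =
  if memb x vis then cycleHalfLengths n P Q vis xs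
  else (let o = orbit (2 ℕ.* n) (partner P) (partner Q) x x
        in ⌊ length o /2⌋ ∷ cycleHalfLengths n P Q (o ++ vis) xs)

insertDesc : ℕ → List ℕ → List ℕ
insertDesc x [] = [ x ]
insertDesc x (y ∷ ys) = if y <ᵇ x then x ∷ y ∷ ys else y ∷ insertDesc x ys

sortDesc : List ℕ → List ℕ
sortDesc = foldr insertDesc []

cycleType : ℕ → Matching → Matching → List ℕ
cycleType n P Q = sortDesc (cycleHalfLengths n P Q [] (upTo (2 ℕ.* n)))

listEqᵇ : List ℕ → List ℕ → Bool
listEqᵇ [] [] = true
listEqᵇ (x ∷ xs) (y ∷ ys) = (x ≡ᵇ y) ∧ listEqᵇ xs ys
listEqᵇ _ _ = false

Aμ : ℕ → List ℕ → Matching → Matching → ℚ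
Aμ n μ P Q = if listEqᵇ (cycleType n P Q) μ then 1ℚ else 0ℚ

-- Vectors in ℚ^{𝓜_{2n}} (only their values on Ms n matter)

Vector : Set
Vector = Matching → ℚ

sumOver : {A : Set} → List A → (A → ℚ) → ℚ
sumOver xs f = foldr (λ x r → f x + r) 0ℚ xs

applyA : ℕ → List ℕ → Vector → Vector
applyA n μ v P = sumOver (Ms n) (λ Q → Aμ n μ P Q * v Q)

_≐[_]_ : Vector → ℕ → Vector → Set
v ≐[ n ] u = All (λ P → v P ≡ u P) (Ms n)

NonZero : ℕ → Vector → Set
NonZero n v = Any (λ P → v P ≢ 0ℚ) (Ms n)

-- permutation action (pull-back form; σ ranges over a group so this is harmless)
pull : (ℕ → ℕ) → Vector → Vector
pull σ v P = v (act σ P)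

-- Young symmetrizer for the row-reading tableau T of shape 2λ

range : ℕ → ℕ → List ℕ
range s k = map (s ℕ.+_) (upTo k)

tabRows : ℕ → List ℕ → List (List ℕ)
tabRows s [] = []
tabRows s (l ∷ ls) = range s (2 ℕ.* l) ∷ tabRows (s ℕ.+ 2 ℕ.* l) ls

nth : List ℕ → ℕ → List ℕ
nth [] _ = []
nth (x ∷ xs) zero = [ x ]
nth (x ∷ xs) (suc j) = nth xs j

headLength : List (List ℕ) → ℕ
headLength [] = 0
headLength (r ∷ _) = length r

tabCols : List (List ℕ) → List (List ℕ)
tabCols rows = map (λ j → concatMap (λ r → nth r j) rows) (upTo (headLength rows))

rowGroup : List ℕ → List (ℕ → ℕ)
rowGroup la = blockGroup (tabRows 0 la)

colGroup : List ℕ → List (ℕ → ℕ)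
colGroup la = blockGroup (tabCols (tabRows 0 la))

young : ℕ → List ℕ → Vector → Vector
young n la w P =
  sumOver (colGroup la) (λ q → sgn (2 ℕ.* n) q *
    sumOver (rowGroup la) (λ p → w (act p (act q P))))

-- the isotypic component of S^{2λ}: span of the S_{2n}-translates of Y_T(ℚ^𝓜)
InIsotypic : ℕ → List ℕ → Vector → Set
InIsotypic n la v =
  Σ (List ((ℕ → ℕ) × Vector)) λ terms →
    All (λ t → proj₁ t ∈ Sym (2 ℕ.* n)) terms ×
    v ≐[ n ] (λ P → sumOver terms (λ t → pull (proj₁ t) (young n la (proj₂ t)) P))

IsEigenvalue : ℕ → List ℕ → List ℕ → ℚ → Set
IsEigenvalue n la μ a =
  ∃ λ v → InIsotypic n la v × NonZero n v × applyA n μ v ≐[ n ] (λ P → a * v P)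

hook4 : ℕ → List ℕ
hook4 n = 4 ∷ replicate (n ℕ.∸ 4) 1

toℚ : ℤ → ℚ
toℚ z = z / 1

phi1 : ℕ → ℚ
phi1 n = toℚ ((+ 2) ℤ.* m ℤ.^ 4 ℤ.- (+ 20) ℤ.* m ℤ.^ 3 ℤ.+ (+ 66) ℤ.* m ℤ.^ 2 ℤ.- (+ 80) ℤ.* m ℤ.+ (+ 24))
  where m = + n

gap : ℕ → ℚ
gap n = toℚ ((+ 8) ℤ.* m ℤ.^ 3 ℤ.- (+ 44) ℤ.* m ℤ.^ 2 ℤ.+ (+ 68) ℤ.* m ℤ.- (+ 24))
  where m = + n

{-# OPTIONS --safe #-}
-- The neighbours of a perfect matching P in the graph of [4,1ⁿ⁻⁴] are obtained by choosing a cyclic sequence of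
-- four oriented edges aᵢbᵢ of P and replacing them by the edges bᵢaᵢ₊₁; each neighbour arises from eight
-- directed starting points.  A function that is a sum over the edges of the matching of symmetric weights Y with
-- zero row sums is therefore an eigenvector with eigenvalue 2(n−2)(n−3)(n²−5n+2) = phi1 n: each of the four new
-- edges contributes through a row sum.  The Young symmetrizer of [n−1,1] produces such a function.
--
-- Conversely, a function in a component of shape ≠ [n] has sum zero, as the signs over a column group of a
-- tableau with at least two rows cancel.  A sum-zero function splits orthogonally into one of the above
-- eigenvectors and a function U whose sum over the matchings through any given edge vanishes.  The quadratic form of
-- the graph at U is 1/(n−4) times the sum, over all edges e, of the form for n − 1 at the restriction of U to the
-- matchings through e, which is again sum-zero; so the bound follows by induction.  Starting from
-- the bound 64/5 at n = 4, which is not sharp, this gives 64 at n = 5, then exactly phi1 6 = 192 at n = 6, and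
-- phi1 n from there on.  The case n = 4 is an explicit sum of squares.
--
-- Sums over matchings are replaced by sums over flags, that is, matchings with an ordering of their edges and an
-- orientation of each edge, since these admit the action of all permutations of positions.

module Submission where

open import Defs
open import Data.Nat as ℕ using (ℕ; zero; suc; _≤_; _<_; _∸_; _≡ᵇ_; _<ᵇ_; ⌊_/2⌋)
import Data.Nat.Properties as ℕ
open import Data.Integer as ℤ using (ℤ)
import Data.Integer.Properties as ℤ
open import Data.Rational as ℚ using (ℚ; 0ℚ; 1ℚ; _+_; _*_; -_; _-_) renaming (_≤_ to _≤ℚ_)
import Data.Rational.Properties as ℚ
import Data.Rational.Unnormalised as ℚᵘ
import Data.Rational.Unnormalised.Properties as ℚᵘ
open import Data.Rational.Solver using (module +-*-Solver)
import Data.Bool as Bool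
import Data.Bool.Properties as Bool
open import Data.Bool using (Bool; true; false; if_then_else_; _∨_; _∧_; not)
open import Data.List using (List; []; _∷_; [_]; _++_; map; concatMap; length; upTo; _∷ʳ_; concat; foldr; replicate; applyUpTo)
import Data.List.Properties as List
open import Data.List.Membership.Propositional using (_∈_; _∉_; find; lose)
open import Data.List.Membership.Propositional.Properties using (∈-map⁻; ∈-++⁻; ∈-++⁺ˡ; ∈-++⁺ʳ; ∈-concatMap⁻; ∈-concatMap⁺; ∈-map⁺; ∈-upTo⁺; ∈-upTo⁻)
open import Data.List.Relation.Unary.Any using (Any; here; there)
open import Data.List.Relation.Unary.All as All using (All; []; _∷_)
import Data.List.Relation.Unary.All.Properties as All
open import Data.List.Relation.Unary.AllPairs using (AllPairs; []; _∷_)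
import Data.List.Relation.Unary.AllPairs.Properties as AllPairs
open import Data.List.Relation.Unary.Unique.Propositional using (Unique)
import Data.List.Relation.Unary.Unique.Propositional.Properties as Unique
open import Data.List.Relation.Binary.Permutation.Propositional
  using (_↭_; ↭-sym; ↭-trans; prep; swap; refl)
import Data.List.Relation.Binary.Permutation.Propositional as ↭
import Data.List.Relation.Binary.Permutation.Propositional.Properties as Perm
open import Data.Product using (_×_; _,_; proj₁; proj₂; ∃; ∃₂; uncurry; map₂)
import Data.Product.Properties as ×
open import Data.Sum using (_⊎_; inj₁; inj₂)
open import Data.Empty using (⊥; ⊥-elim)
open import Function using (_∘_; id; case_of_)
open import Relation.Nullary using (yes; no; does)
open import Relation.Nullary.Decidable using (True; toWitness; from-yes)
open import Relation.Binary.Definitions using (tri<; tri≈; tri>)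
open import Data.Nat.ListAction using (sum)
open import Relation.Binary.PropositionalEquality hiding ([_])
open +-*-Solver using (Polynomial; solve; _:=_; _:+_; _:*_; :-_; _:-_; con)
open ≡-Reasoning

-- The restriction to matchings through an edge is possible because a neighbour of a matching keeps
-- n - 4 of its edges: an adjacent pair can be exposed through a common edge, and deleting that edge
-- leaves an adjacent pair for n - 1. Sum zero alone is not inherited by these restrictions; the
-- sums over the matchings through an edge are exactly what the [n-1,1] part carries, so this part
-- has to be split off before every step. A step turns a bound c into n c/(n - 4). The constant 64/5
-- is the largest that the factors 5 and 6/2 carry to phi1 6. The true maximum at n = 4 is 4, and
-- this slack lets a few squares suffice. From n = 7 on, n phi1 (n-1) ≤ (n-4) phi1 n, so the bound
-- reproduces itself. A separate obstacle is the distance to the definitions: eigenvectors are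
-- functions on canonical lists, and adjacency is read off a fuelled traversal of cycles. Functions
-- are therefore extended to all presentations of a matching, and the traversal is shown to report
-- the hook type exactly when the two matchings differ by one octagon.

private variable
  A B : Set

-- Finite sums

opaque
  ∑ : List A → (A → ℚ) → ℚ
  ∑ = sumOver

  ∑-def : (xs : List A) (f : A → ℚ) → sumOver xs f ≡ ∑ xs f
  ∑-def xs f = refl

  ∑-[] : (f : A → ℚ) → ∑ [] f ≡ 0ℚ
  ∑-[] f = refl

  ∑-∷ : (x : A) (xs : List A) (f : A → ℚ) → ∑ (x ∷ xs) f ≡ f x + ∑ xs f
  ∑-∷ x xs f = refl

  ∑-cong∈ : (xs : List A) {f g : A → ℚ} → (∀ {x} → x ∈ xs → f x ≡ g x) → ∑ xs f ≡ ∑ xs g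
  ∑-cong∈ []       h = refl
  ∑-cong∈ (x ∷ xs) h = cong₂ _+_ (h (here refl)) (∑-cong∈ xs (h ∘ there))

  ∑-cong : (xs : List A) {f g : A → ℚ} → (∀ x → f x ≡ g x) → ∑ xs f ≡ ∑ xs g
  ∑-cong xs h = ∑-cong∈ xs (λ {x} _ → h x)

  ∑-0 : (xs : List A) → ∑ xs (λ _ → 0ℚ) ≡ 0ℚ
  ∑-0 []       = refl
  ∑-0 (x ∷ xs) = trans (ℚ.+-identityˡ _) (∑-0 xs)

  ∑-zero : (xs : List A) {f : A → ℚ} → (∀ {x} → x ∈ xs → f x ≡ 0ℚ) → ∑ xs f ≡ 0ℚ
  ∑-zero xs h = trans (∑-cong∈ xs h) (∑-0 xs)

  ∑-+ : (xs : List A) (f g : A → ℚ) → ∑ xs (λ x → f x + g x) ≡ ∑ xs f + ∑ xs g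
  ∑-+ []       f g = refl
  ∑-+ (x ∷ xs) f g = begin
    f x + g x + ∑ xs (λ x → f x + g x)    ≡⟨ cong (f x + g x +_) (∑-+ xs f g) ⟩
    f x + g x + (∑ xs f + ∑ xs g)   ≡⟨ solve 4 (λ a b c d → a :+ b :+ (c :+ d) := a :+ c :+ (b :+ d)) refl (f x) (g x) _ _ ⟩
    f x + ∑ xs f + (g x + ∑ xs g)   ∎

  ∑-*ˡ : (c : ℚ) (xs : List A) (f : A → ℚ) → ∑ xs (λ x → c * f x) ≡ c * ∑ xs f
  ∑-*ˡ c []       f = sym (ℚ.*-zeroʳ c)
  ∑-*ˡ c (x ∷ xs) f = trans (cong (c * f x +_) (∑-*ˡ c xs f)) (sym (ℚ.*-distribˡ-+ c (f x) _))

  ∑-*ʳ : (c : ℚ) (xs : List A) (f : A → ℚ) → ∑ xs (λ x → f x * c) ≡ ∑ xs f * c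
  ∑-*ʳ c xs f = trans (∑-cong xs (λ x → ℚ.*-comm (f x) c)) (trans (∑-*ˡ c xs f) (ℚ.*-comm c _))

  ∑-neg : (xs : List A) (f : A → ℚ) → ∑ xs (λ x → - f x) ≡ - ∑ xs f
  ∑-neg []       f = refl
  ∑-neg (x ∷ xs) f = trans (cong (- f x +_) (∑-neg xs f)) (sym (ℚ.neg-distrib-+ (f x) _))

  ∑-++ : (xs ys : List A) (f : A → ℚ) → ∑ (xs ++ ys) f ≡ ∑ xs f + ∑ ys f
  ∑-++ []       ys f = sym (ℚ.+-identityˡ _)
  ∑-++ (x ∷ xs) ys f = trans (cong (f x +_) (∑-++ xs ys f)) (sym (ℚ.+-assoc (f x) _ _))

  ∑-map : (h : A → B) (xs : List A) (f : B → ℚ) → ∑ (map h xs) f ≡ ∑ xs (f ∘ h)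
  ∑-map h []       f = refl
  ∑-map h (x ∷ xs) f = cong (f (h x) +_) (∑-map h xs f)

  ∑-concatMap : (h : A → List B) (xs : List A) (f : B → ℚ) →
                ∑ (concatMap h xs) f ≡ ∑ xs (λ x → ∑ (h x) f)
  ∑-concatMap h []       f = refl
  ∑-concatMap h (x ∷ xs) f = trans (∑-++ (h x) _ f) (cong (∑ (h x) f +_) (∑-concatMap h xs f))

  ∑-exchange : (xs : List A) (ys : List B) (f : A → B → ℚ) →
               ∑ xs (λ x → ∑ ys (f x)) ≡ ∑ ys (λ y → ∑ xs (λ x → f x y))
  ∑-exchange []       ys f = sym (∑-0 ys)
  ∑-exchange (x ∷ xs) ys f = trans (cong (∑ ys (f x) +_) (∑-exchange xs ys f)) (sym (∑-+ ys (f x) _))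

  ∑-↭ : {xs ys : List A} (f : A → ℚ) → xs ↭ ys → ∑ xs f ≡ ∑ ys f
  ∑-↭ f refl = refl
  ∑-↭ f (prep x p) = cong (f x +_) (∑-↭ f p)
  ∑-↭ f (swap {xs} {ys} x y p) = begin
    f x + (f y + ∑ xs f)   ≡⟨ cong (λ s → f x + (f y + s)) (∑-↭ f p) ⟩
    f x + (f y + ∑ ys f)   ≡⟨ solve 3 (λ a b c → a :+ (b :+ c) := b :+ (a :+ c)) refl (f x) (f y) _ ⟩
    f y + (f x + ∑ ys f)   ∎
  ∑-↭ f (↭.trans p q) = trans (∑-↭ f p) (∑-↭ f q)

  ∑-mono : (xs : List A) {f g : A → ℚ} → (∀ {x} → x ∈ xs → f x ≤ℚ g x) → ∑ xs f ≤ℚ ∑ xs g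
  ∑-mono []       h = ℚ.≤-refl
  ∑-mono (x ∷ xs) h = ℚ.+-mono-≤ (h (here refl)) (∑-mono xs (h ∘ there))

  ∑-nonneg : (xs : List A) {f : A → ℚ} → (∀ x → 0ℚ ≤ℚ f x) → 0ℚ ≤ℚ ∑ xs f
  ∑-nonneg xs {f} h = subst (_≤ℚ ∑ xs f) (∑-0 xs) (∑-mono xs (λ {x} _ → h x))

-- The successor recursion lets `fromℕ (4 + j)` reduce to a polynomial in `fromℕ j`, so that
-- identities in n are ring identities.
fromℕ : ℕ → ℚ
fromℕ zero    = 0ℚ
fromℕ (suc n) = 1ℚ + fromℕ n

∑-const : (xs : List A) (c : ℚ) → ∑ xs (λ _ → c) ≡ fromℕ (length xs) * c
∑-const []       c = trans (∑-[] _) (sym (ℚ.*-zeroˡ c))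
∑-const (x ∷ xs) c = trans (trans (∑-∷ x xs _) (cong (c +_) (∑-const xs c)))
  (solve 2 (λ c k → c :+ k :* c := (con 1ℚ :+ k) :* c) refl c (fromℕ (length xs)))

-- Sums over the ways of removing one entry from a list

picks : List A → List (A × List A)
picks []       = []
picks (x ∷ xs) = (x , xs) ∷ map (map₂ (x ∷_)) (picks xs)

opaque
  -- Each entry comes with the other entries, so nested sums run over distinct positions without any
  -- test for equality.
  ∑pick : List A → (A → List A → ℚ) → ℚ
  ∑pick xs G = ∑ (picks xs) (uncurry G)

  ∑pick-def : (xs : List A) (G : A → List A → ℚ) → ∑pick xs G ≡ ∑ (picks xs) (uncurry G)
  ∑pick-def xs G = refl

  ∑pick-[] : (G : A → List A → ℚ) → ∑pick [] G ≡ 0ℚ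
  ∑pick-[] G = ∑-[] (uncurry G)

  ∑pick-+ : (xs : List A) (G H : A → List A → ℚ) → ∑pick xs (λ x r → G x r + H x r) ≡ ∑pick xs G + ∑pick xs H
  ∑pick-+ xs G H = ∑-+ (picks xs) (uncurry G) (uncurry H)

  ∑pick-*ˡ : (c : ℚ) (xs : List A) (G : A → List A → ℚ) → ∑pick xs (λ x r → c * G x r) ≡ c * ∑pick xs G
  ∑pick-*ˡ c xs G = ∑-*ˡ c (picks xs) (uncurry G)

opaque
  unfolding ∑pick

  ∑pick-∷ : (x : A) (xs : List A) (G : A → List A → ℚ) →
            ∑pick (x ∷ xs) G ≡ G x xs + ∑pick xs (λ y r → G y (x ∷ r))
  ∑pick-∷ x xs G = trans (∑-∷ _ _ _) (cong (G x xs +_) (∑-map (map₂ (x ∷_)) (picks xs) (uncurry G)))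

∈-picks : {xs : List A} {x : A} {r : List A} → (x , r) ∈ picks xs → x ∷ r ↭ xs
∈-picks {xs = y ∷ ys} (here refl) = refl
∈-picks {xs = y ∷ ys} (there p) with ∈-map⁻ (map₂ (y ∷_)) p
... | (x , r) , q , refl = ↭-trans (swap x y refl) (prep y (∈-picks q))

opaque
  unfolding ∑pick

  ∑pick-cong : (xs : List A) {G H : A → List A → ℚ} → (∀ x r → x ∷ r ↭ xs → G x r ≡ H x r) →
               ∑pick xs G ≡ ∑pick xs H
  ∑pick-cong xs h = ∑-cong∈ (picks xs) (λ {p} i → h (proj₁ p) (proj₂ p) (∈-picks i))

∑pick-zero : (xs : List A) {G : A → List A → ℚ} → (∀ x r → x ∷ r ↭ xs → G x r ≡ 0ℚ) → ∑pick xs G ≡ 0ℚ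
∑pick-zero xs h = trans (∑pick-cong xs h) (trans (∑pick-def xs _) (∑-0 (picks xs)))

∑pick-fst : (xs : List A) (f : A → ℚ) → ∑pick xs (λ x _ → f x) ≡ ∑ xs f
∑pick-fst []       f = trans (∑pick-[] _) (sym (∑-[] f))
∑pick-fst (x ∷ xs) f = trans (∑pick-∷ x xs _) (trans (cong (f x +_) (∑pick-fst xs f)) (sym (∑-∷ x xs f)))

-- Two arrangements of a list leave remainders that agree only up to order, hence the condition on
-- `G`.
∑pick-↭ : {xs ys : List A} {G : A → List A → ℚ} → (∀ x {r r'} → r ↭ r' → G x r ≡ G x r') →
          xs ↭ ys → ∑pick xs G ≡ ∑pick ys G
∑pick-↭ inv refl = refl
∑pick-↭ {G = G} inv (prep {xs} {ys} x p) = trans (∑pick-∷ x xs G) (trans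
  (cong₂ _+_ (inv x p) (∑pick-↭ (λ y q → inv y (prep x q)) p)) (sym (∑pick-∷ x ys G)))
∑pick-↭ {G = G} inv (swap {xs} {ys} x y p) = begin
  ∑pick (x ∷ y ∷ xs) G
    ≡⟨ trans (∑pick-∷ x _ G) (cong (G x (y ∷ xs) +_) (∑pick-∷ y xs _)) ⟩
  G x (y ∷ xs) + (G y (x ∷ xs) + ∑pick xs (λ z r → G z (x ∷ y ∷ r)))
    ≡⟨ cong₂ (λ a b → a + b) (inv x (prep y p)) (cong₂ _+_ (inv y (prep x p))
         (trans (∑pick-↭ (λ z q → inv z (prep x (prep y q))) p) (∑pick-cong ys (λ z r _ → inv z (swap x y refl))))) ⟩
  G x (y ∷ ys) + (G y (x ∷ ys) + ∑pick ys (λ z r → G z (y ∷ x ∷ r)))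
    ≡⟨ solve 3 (λ a b c → a :+ (b :+ c) := b :+ (a :+ c)) refl (G x (y ∷ ys)) (G y (x ∷ ys)) _ ⟩
  G y (x ∷ ys) + (G x (y ∷ ys) + ∑pick ys (λ z r → G z (y ∷ x ∷ r)))
    ≡⟨ trans (∑pick-∷ y _ G) (cong (G y (x ∷ ys) +_) (∑pick-∷ x ys _)) ⟨
  ∑pick (y ∷ x ∷ ys) G ∎

∑pick-↭ inv (↭.trans p q) = trans (∑pick-↭ inv p) (∑pick-↭ inv q)

-- Two picks involve the head as the first, as the second, or not at all; the exchange swaps the
-- first two kinds and the third is the induction hypothesis.
∑pick-exchange : (xs : List A) (F : A → A → List A → ℚ) → (∀ x y {r r'} → r ↭ r' → F x y r ≡ F x y r') →
                 ∑pick xs (λ x r → ∑pick r (λ y → F x y)) ≡ ∑pick xs (λ x r → ∑pick r (λ y → F y x))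
∑pick-exchange []       F inv = trans (∑pick-[] _) (sym (∑pick-[] _))
∑pick-exchange (a ∷ xs) F inv = begin
  ∑pick (a ∷ xs) (λ x r → ∑pick r (F x))
    ≡⟨ expand F ⟩
  ∑pick xs (F a) + (∑pick xs (λ x → F x a) + ∑pick xs (λ x r → ∑pick r (λ y s → F x y (a ∷ s))))
    ≡⟨ cong (λ t → ∑pick xs (F a) + (∑pick xs (λ x → F x a) + t))
         (∑pick-exchange xs (λ x y s → F x y (a ∷ s)) (λ x y q → inv x y (prep a q))) ⟩
  ∑pick xs (F a) + (∑pick xs (λ x → F x a) + ∑pick xs (λ x r → ∑pick r (λ y s → F y x (a ∷ s))))
    ≡⟨ solve 3 (λ a b c → a :+ (b :+ c) := b :+ (a :+ c)) refl (∑pick xs (F a)) (∑pick xs (λ x → F x a)) _ ⟩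
  ∑pick xs (λ x → F x a) + (∑pick xs (F a) + ∑pick xs (λ x r → ∑pick r (λ y s → F y x (a ∷ s))))
    ≡⟨ expand (λ x y → F y x) ⟨
  ∑pick (a ∷ xs) (λ x r → ∑pick r (λ y → F y x)) ∎
  where

  expand : (H : _ → _ → List _ → ℚ) → ∑pick (a ∷ xs) (λ x r → ∑pick r (H x)) ≡
    ∑pick xs (H a) + (∑pick xs (λ x → H x a) + ∑pick xs (λ x r → ∑pick r (λ y s → H x y (a ∷ s))))
  expand H = trans (∑pick-∷ a xs _) (cong (∑pick xs (H a) +_)
    (trans (∑pick-cong xs (λ x r _ → ∑pick-∷ a r (H x))) (∑pick-+ xs _ _)))

∑pick-map : (h : A → B) (xs : List A) (G : B → List B → ℚ) →
            ∑pick (map h xs) G ≡ ∑pick xs (λ x r → G (h x) (map h r))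
∑pick-map h []       G = trans (∑pick-[] G) (sym (∑pick-[] _))
∑pick-map h (x ∷ xs) G = trans (∑pick-∷ (h x) (map h xs) G)
  (trans (cong (G (h x) (map h xs) +_) (∑pick-map h xs _)) (sym (∑pick-∷ x xs _)))

length-pick : {xs : List A} {x : A} {r : List A} {n : ℕ} → x ∷ r ↭ xs → length xs ≡ suc n → length r ≡ n
length-pick p e = cong ℕ.pred (trans (Perm.↭-length p) e)

opaque
  unfolding ∑pick

  ∑pick-mono : (xs : List A) {G H : A → List A → ℚ} → (∀ x r → x ∷ r ↭ xs → G x r ≤ℚ H x r) →
               ∑pick xs G ≤ℚ ∑pick xs H
  ∑pick-mono xs h = ∑-mono (picks xs) (λ {p} i → h (proj₁ p) (proj₂ p) (∈-picks i))

-- Flags: ordered and oriented perfect matchings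

double : ℕ → ℕ
double zero    = zero
double (suc n) = suc (suc (double n))

flat : List (A × A) → List A
flat []            = []
flat ((a , b) ∷ m) = a ∷ b ∷ flat m

infix 4 _≈_
-- The orbits of the hyperoctahedral group, which reorders edges and flips them: related lists
-- present the same matching. Accordingly `HInv` singles out the functions of the matching alone.
data _≈_ {A : Set} : List (A × A) → List (A × A) → Set where
  ≈-refl  : ∀ {m} → m ≈ m
  ≈-prep  : ∀ e {m m'} → m ≈ m' → e ∷ m ≈ e ∷ m'
  ≈-swap  : ∀ e f {m} → e ∷ f ∷ m ≈ f ∷ e ∷ m
  ≈-flip  : ∀ a b {m} → (a , b) ∷ m ≈ (b , a) ∷ m
  ≈-trans : ∀ {m m' m''} → m ≈ m' → m' ≈ m'' → m ≈ m''

≈-sym : {m m' : List (A × A)} → m ≈ m' → m' ≈ m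
≈-sym ≈-refl        = ≈-refl
≈-sym (≈-prep e p)  = ≈-prep e (≈-sym p)
≈-sym (≈-swap e f)  = ≈-swap f e
≈-sym (≈-flip a b)  = ≈-flip b a
≈-sym (≈-trans p q) = ≈-trans (≈-sym q) (≈-sym p)

↭⇒≈ : {m m' : List (A × A)} → m ↭ m' → m ≈ m'
↭⇒≈ refl          = ≈-refl
↭⇒≈ (prep e p)    = ≈-prep e (↭⇒≈ p)
↭⇒≈ (swap e f p)  = ≈-trans (≈-swap e f) (≈-prep f (≈-prep e (↭⇒≈ p)))
↭⇒≈ (↭.trans p q) = ≈-trans (↭⇒≈ p) (↭⇒≈ q)

flat-≈ : {m m' : List (A × A)} → m ≈ m' → flat m ↭ flat m'
flat-≈ ≈-refl                      = refl
flat-≈ (≈-prep (a , b) p)          = prep a (prep b (flat-≈ p))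
flat-≈ (≈-swap (a , b) (c , d) {m}) = Perm.shifts (a ∷ b ∷ []) (c ∷ d ∷ []) {flat m}
flat-≈ (≈-flip a b)                = swap a b refl
flat-≈ (≈-trans p q)               = ↭-trans (flat-≈ p) (flat-≈ q)

HInv : (List (A × A) → ℚ) → Set
HInv V = ∀ {m m'} → m ≈ m' → V m ≡ V m'

HInv-∷ : {V : List (A × A) → ℚ} → HInv V → ∀ e → HInv (V ∘ (e ∷_))
HInv-∷ inv e p = inv (≈-prep e p)

-- Both orientations of an edge occur, so every unordered pair is counted twice.
∑edge : List A → (A × A → List A → ℚ) → ℚ
∑edge xs G = ∑pick xs (λ x r → ∑pick r (λ y → G (x , y)))

module _ (xs : List A) where

  ∑edge-cong : {G H : A × A → List A → ℚ} → (∀ x y r → x ∷ y ∷ r ↭ xs → G (x , y) r ≡ H (x , y) r) →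
               ∑edge xs G ≡ ∑edge xs H
  ∑edge-cong h = ∑pick-cong xs (λ x r p → ∑pick-cong r (λ y s q → h x y s (↭-trans (prep x q) p)))

  ∑edge-mono : {G H : A × A → List A → ℚ} → (∀ x y r → x ∷ y ∷ r ↭ xs → G (x , y) r ≤ℚ H (x , y) r) →
               ∑edge xs G ≤ℚ ∑edge xs H
  ∑edge-mono h = ∑pick-mono xs (λ x r p → ∑pick-mono r (λ y s q → h x y s (↭-trans (prep x q) p)))

  ∑edge-+ : (G H : A × A → List A → ℚ) → ∑edge xs (λ e r → G e r + H e r) ≡ ∑edge xs G + ∑edge xs H
  ∑edge-+ G H = trans (∑pick-cong xs (λ x r _ → ∑pick-+ r _ _)) (∑pick-+ xs _ _)

  ∑edge-*ˡ : (c : ℚ) (G : A × A → List A → ℚ) → ∑edge xs (λ e r → c * G e r) ≡ c * ∑edge xs G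
  ∑edge-*ˡ c G = trans (∑pick-cong xs (λ x r _ → ∑pick-*ˡ c r _)) (∑pick-*ˡ c xs _)

  ∑edge-zero : {G : A × A → List A → ℚ} → (∀ x y r → x ∷ y ∷ r ↭ xs → G (x , y) r ≡ 0ℚ) → ∑edge xs G ≡ 0ℚ
  ∑edge-zero h = ∑pick-zero xs (λ x r p → ∑pick-zero r (λ y s q → h x y s (↭-trans (prep x q) p)))

RInv : {I : Set} → (I → List A → ℚ) → Set
RInv G = ∀ i {r r'} → r ↭ r' → G i r ≡ G i r'

∑edge-↭ : {xs ys : List A} {G : A × A → List A → ℚ} → RInv G → xs ↭ ys → ∑edge xs G ≡ ∑edge ys G
∑edge-↭ inv p = ∑pick-↭ (λ x q → ∑pick-↭ (λ y → inv (x , y)) q) p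

∑edge-flip : (xs : List A) (G : A × A → List A → ℚ) → RInv G →
             ∑edge xs G ≡ ∑edge xs (λ e → G (proj₂ e , proj₁ e))
∑edge-flip xs G inv = ∑pick-exchange xs (λ x y → G (x , y)) (λ x y → inv (x , y))

∑pick-∑edge : (xs : List A) (F : A → A × A → List A → ℚ) → (∀ x → RInv (F x)) →
              ∑pick xs (λ x r → ∑edge r (F x)) ≡ ∑edge xs (λ e r → ∑pick r (λ x → F x e))
∑pick-∑edge xs F inv = trans
  (∑pick-exchange xs (λ x y r → ∑pick r (λ z → F x (y , z))) (λ x y p → ∑pick-↭ (λ z → inv x (y , z)) p))
  (∑pick-cong xs (λ y r _ → ∑pick-exchange r (λ x z → F x (y , z)) (λ x z → inv x (y , z))))

∑edge-exchange : (xs : List A) (F : A × A → A × A → List A → ℚ) → (∀ e → RInv (F e)) →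
                 ∑edge xs (λ e r → ∑edge r (F e)) ≡ ∑edge xs (λ e r → ∑edge r (λ f → F f e))
∑edge-exchange xs F inv = trans
  (∑pick-cong xs (λ x r _ → ∑pick-∑edge r (λ y → F (x , y)) (λ y → inv (x , y))))
  (∑pick-∑edge xs (λ x e r → ∑pick r (λ y → F (x , y) e)) (λ x e p → ∑pick-↭ (λ y → inv (x , y) e) p))

∑flag : ℕ → List A → (List (A × A) → ℚ) → ℚ
∑flag zero    xs V = V []
∑flag (suc n) xs V = ∑edge xs (λ e r → ∑flag n r (λ m → V (e ∷ m)))

length-edge : {xs : List A} {x y : A} {r : List A} {n : ℕ} →
              x ∷ y ∷ r ↭ xs → length xs ≡ double (suc n) → length r ≡ double n
length-edge p e = cong (ℕ.pred ∘ ℕ.pred) (trans (Perm.↭-length p) e)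

∑flag-cong : ∀ n {xs : List A} → length xs ≡ double n → {V V' : List (A × A) → ℚ} →
             (∀ m → length m ≡ n → flat m ↭ xs → V m ≡ V' m) → ∑flag n xs V ≡ ∑flag n xs V'
∑flag-cong zero    {[]} len h = h [] refl refl
∑flag-cong (suc n) {xs} len h = ∑edge-cong xs (λ x y r p →
  ∑flag-cong n (length-edge p len) (λ m l q → h _ (cong suc l) (↭-trans (prep x (prep y q)) p)))

∑flag-mono : ∀ n {xs : List A} {V V' : List (A × A) → ℚ} → (∀ m → V m ≤ℚ V' m) → ∑flag n xs V ≤ℚ ∑flag n xs V'
∑flag-mono zero    h = h []
∑flag-mono (suc n) {xs} h = ∑edge-mono xs (λ x y r _ → ∑flag-mono n (λ m → h _))

∑flag-ext : ∀ n {xs : List A} {V V' : List (A × A) → ℚ} → (∀ m → V m ≡ V' m) → ∑flag n xs V ≡ ∑flag n xs V'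
∑flag-ext zero    h = h []
∑flag-ext (suc n) {xs} h = ∑edge-cong xs (λ x y r _ → ∑flag-ext n (λ m → h _))

∑flag-+ : ∀ n (xs : List A) (V V' : List (A × A) → ℚ) →
          ∑flag n xs (λ m → V m + V' m) ≡ ∑flag n xs V + ∑flag n xs V'
∑flag-+ zero    xs V V' = refl
∑flag-+ (suc n) xs V V' = trans (∑edge-cong xs (λ x y r _ → ∑flag-+ n r _ _)) (∑edge-+ xs _ _)

∑flag-*ˡ : ∀ n (c : ℚ) (xs : List A) (V : List (A × A) → ℚ) → ∑flag n xs (λ m → c * V m) ≡ c * ∑flag n xs V
∑flag-*ˡ zero    c xs V = refl
∑flag-*ˡ (suc n) c xs V = trans (∑edge-cong xs (λ x y r _ → ∑flag-*ˡ n c r _)) (∑edge-*ˡ xs c _)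

∑flag-0 : ∀ n (xs : List A) → ∑flag n xs (λ _ → 0ℚ) ≡ 0ℚ
∑flag-0 zero    xs = refl
∑flag-0 (suc n) xs = ∑edge-zero xs (λ x y r _ → ∑flag-0 n r)

∑flag-nonneg : ∀ n {xs : List A} {V : List (A × A) → ℚ} → (∀ m → 0ℚ ≤ℚ V m) → 0ℚ ≤ℚ ∑flag n xs V
∑flag-nonneg n {xs} h = subst (_≤ℚ ∑flag n xs _) (∑flag-0 n xs) (∑flag-mono n h)

∑flag-↭ : ∀ n {xs ys : List A} (V : List (A × A) → ℚ) → xs ↭ ys → ∑flag n xs V ≡ ∑flag n ys V
∑flag-↭ zero    V p = refl
∑flag-↭ (suc n) V p = ∑edge-↭ (λ e → ∑flag-↭ n (V ∘ (e ∷_))) p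

∑flag-map : ∀ n (h : A → B) (xs : List A) (V : List (B × B) → ℚ) →
            ∑flag n (map h xs) V ≡ ∑flag n xs (V ∘ map (λ e → h (proj₁ e) , h (proj₂ e)))
∑flag-map zero    h xs V = refl
∑flag-map (suc n) h xs V = trans (∑pick-map h xs _) (∑pick-cong xs (λ x r _ →
  trans (∑pick-map h r _) (∑pick-cong r (λ y s _ → ∑flag-map n h s _))))

-- Exposes an edge that `rot` does not touch.
∑flag-snoc : ∀ n (xs : List A) (V : List (A × A) → ℚ) →
             ∑flag (suc n) xs V ≡ ∑edge xs (λ e r → ∑flag n r (λ m → V (m ∷ʳ e)))
∑flag-snoc zero    xs V = refl
∑flag-snoc (suc n) xs V = trans
  (∑edge-cong xs (λ x y r _ → ∑flag-snoc n r (λ m → V ((x , y) ∷ m))))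
  (∑edge-exchange xs (λ e f r → ∑flag n r (λ m → V (e ∷ m ∷ʳ f))) (λ e f → ∑flag-↭ n _))

-- Every point is matched, so each flag reaches x: its edge may be moved to the front and oriented away from x.
∑flag-head : ∀ n (x : A) (xs : List A) {V : List (A × A) → ℚ} → HInv V → length xs ≡ suc (double n) →
             ∑flag (suc n) (x ∷ xs) V ≡
             fromℕ (double (suc n)) * ∑pick xs (λ y r → ∑flag n r (λ m → V ((x , y) ∷ m)))
∑flag-head n x xs {V} inv len = begin
  ∑flag (suc n) (x ∷ xs) V
    ≡⟨ ∑pick-∷ x xs _ ⟩
  h + ∑pick xs (λ a r → ∑pick (x ∷ r) (λ b s → ∑flag n s (λ m → V ((a , b) ∷ m))))
    ≡⟨ cong (h +_) (trans (∑pick-cong xs (λ a r _ → ∑pick-∷ x r _)) (∑pick-+ xs _ _)) ⟩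
  h + (∑pick xs (λ a r → ∑flag n r (λ m → V ((a , x) ∷ m)))
       + ∑edge xs (λ e s → ∑flag n (x ∷ s) (λ m → V (e ∷ m))))
    ≡⟨ cong₂ (λ s t → h + (s + t)) (∑pick-cong xs (λ a r _ → ∑flag-ext n (λ m → inv (≈-flip a x)))) (deeper n len inv) ⟩
  h + (h + fromℕ (double n) * h)
    ≡⟨ solve 2 (λ h k → h :+ (h :+ k :* h) := (con 1ℚ :+ (con 1ℚ :+ k)) :* h) refl h (fromℕ (double n)) ⟩
  fromℕ (double (suc n)) * h ∎
  where
  h = ∑pick xs (λ y r → ∑flag n r (λ m → V ((x , y) ∷ m)))

  -- The first edge avoids `x` here. The rest of the flag is shorter and falls under `∑flag-head`,
  -- after which an exchange of the two leading edges puts the edge of `x` in front.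
  deeper : ∀ n → length xs ≡ suc (double n) → {V : List _ → ℚ} → HInv V →
           ∑edge xs (λ e s → ∑flag n (x ∷ s) (λ m → V (e ∷ m))) ≡
           fromℕ (double n) * ∑pick xs (λ y r → ∑flag n r (λ m → V ((x , y) ∷ m)))
  deeper zero    len {V} inv = trans
    (∑pick-zero xs (λ a r p → empty r (length-pick p len)))
    (sym (ℚ.*-zeroˡ (∑pick xs (λ y r → ∑flag zero r (λ m → V ((x , y) ∷ m))))))
    where
    empty : ∀ r → length r ≡ 0 → {G : _ → List _ → ℚ} → ∑pick r G ≡ 0ℚ
    empty [] _ = ∑pick-[] _
  deeper (suc k) len {V} inv = begin
    ∑edge xs (λ e s → ∑flag (suc k) (x ∷ s) (λ m → V (e ∷ m)))
      ≡⟨ ∑edge-cong xs (λ a b s p → ∑flag-head k x s (HInv-∷ inv (a , b)) (cong (ℕ.pred ∘ ℕ.pred) (trans (Perm.↭-length p) len))) ⟩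
    ∑edge xs (λ e s → fromℕ (double (suc k)) * ∑pick s (λ y r → ∑flag k r (λ m → V (e ∷ (x , y) ∷ m))))
      ≡⟨ ∑edge-*ˡ xs (fromℕ (double (suc k))) (λ e s → ∑pick s (λ y r → ∑flag k r (λ m → V (e ∷ (x , y) ∷ m)))) ⟩
    fromℕ (double (suc k)) * ∑edge xs (λ e s → ∑pick s (λ y r → ∑flag k r (λ m → V (e ∷ (x , y) ∷ m))))
      ≡⟨ cong (fromℕ (double (suc k)) *_) (trans (sym (∑pick-∑edge xs _ (λ y e → ∑flag-↭ k _)))
           (∑pick-cong xs (λ y r _ → ∑edge-cong r (λ a b s _ → ∑flag-ext k (λ m → inv (≈-swap (a , b) (x , y))))))) ⟩
    fromℕ (double (suc k)) * ∑pick xs (λ y r → ∑flag (suc k) r (λ m → V ((x , y) ∷ m))) ∎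

-- Double counting of flags with a marked edge: moving the marked edge to the front shows that all
-- `suc n` positions contribute equally.
∑flag-pick : ∀ n (xs : List A) {V : List (A × A) → ℚ} → (∀ {e f m} → V (e ∷ f ∷ m) ≡ V (f ∷ e ∷ m)) →
             (∀ {e m m'} → m ↭ m' → V (e ∷ m) ≡ V (e ∷ m')) → (G : A × A → List (A × A) → ℚ) →
             ∑flag (suc n) xs (λ m → V m * ∑pick m G) ≡
             fromℕ (suc n) * ∑edge xs (λ e r → ∑flag n r (λ m → V (e ∷ m) * G e m))
∑flag-pick n xs {V} sw pm G = begin
  ∑flag (suc n) xs (λ m → V m * ∑pick m G)
    ≡⟨ ∑edge-cong xs (λ x y r _ → trans
         (∑flag-ext n (λ m → trans (cong (V ((x , y) ∷ m) *_) (∑pick-∷ (x , y) m G)) (ℚ.*-distribˡ-+ (V ((x , y) ∷ m)) _ _)))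
         (∑flag-+ n r _ _)) ⟩
  ∑edge xs (λ e r → ∑flag n r (λ m → V (e ∷ m) * G e m)
                    + ∑flag n r (λ m → V (e ∷ m) * ∑pick m (λ f s → G f (e ∷ s))))
    ≡⟨ ∑edge-+ xs _ _ ⟩
  T + ∑edge xs (λ e r → ∑flag n r (λ m → V (e ∷ m) * ∑pick m (λ f s → G f (e ∷ s))))
    ≡⟨ cong (T +_) (later n G) ⟩
  T + fromℕ n * T
    ≡⟨ solve 2 (λ t k → t :+ k :* t := (con 1ℚ :+ k) :* t) refl T (fromℕ n) ⟩
  fromℕ (suc n) * T ∎
  where
  T = ∑edge xs (λ e r → ∑flag n r (λ m → V (e ∷ m) * G e m))

  later : ∀ n G → ∑edge xs (λ e r → ∑flag n r (λ m → V (e ∷ m) * ∑pick m (λ f s → G f (e ∷ s)))) ≡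
                  fromℕ n * ∑edge xs (λ e r → ∑flag n r (λ m → V (e ∷ m) * G e m))
  later zero    G = trans (∑edge-zero xs (λ x y r _ → trans (cong (V _ *_) (∑pick-[] _)) (ℚ.*-zeroʳ (V ((x , y) ∷ [])))))
                          (sym (ℚ.*-zeroˡ (∑edge xs (λ e r → ∑flag zero r (λ m → V (e ∷ m) * G e m)))))
  later (suc k) G = begin
    ∑edge xs (λ e r → ∑flag (suc k) r (λ m → V (e ∷ m) * ∑pick m (λ f s → G f (e ∷ s))))
      ≡⟨ ∑edge-cong xs (λ x y r _ → ∑flag-pick k r {λ m → V ((x , y) ∷ m)} (λ {e} {f} → pm (swap e f refl)) (λ {e} q → pm (prep e q)) (λ f s → G f ((x , y) ∷ s))) ⟩
    ∑edge xs (λ e r → fromℕ (suc k) * ∑edge r (λ f s → ∑flag k s (λ m → V (e ∷ f ∷ m) * G f (e ∷ m))))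
      ≡⟨ ∑edge-*ˡ xs (fromℕ (suc k)) (λ e r → ∑edge r (λ f s → ∑flag k s (λ m → V (e ∷ f ∷ m) * G f (e ∷ m)))) ⟩
    fromℕ (suc k) * ∑edge xs (λ e r → ∑edge r (λ f s → ∑flag k s (λ m → V (e ∷ f ∷ m) * G f (e ∷ m))))
      ≡⟨ cong (fromℕ (suc k) *_) (trans (∑edge-exchange xs _ (λ e f → ∑flag-↭ k _))
           (∑edge-cong xs (λ x y r _ → ∑edge-cong r (λ z w s _ → ∑flag-ext k (λ m → cong (_* G (x , y) ((z , w) ∷ m)) sw))))) ⟩
    fromℕ (suc k) * ∑edge xs (λ e r → ∑flag (suc k) r (λ m → V (e ∷ m) * G e m)) ∎

-- (2n)!, the number of flags on 2n points.
cnt : ℕ → ℚ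
cnt zero    = 1ℚ
cnt (suc n) = fromℕ (double (suc n)) * (fromℕ (suc (double n)) * cnt n)

∑pick-const : (xs : List A) (c : ℚ) → ∑pick xs (λ _ _ → c) ≡ fromℕ (length xs) * c
∑pick-const xs c = trans (∑pick-fst xs (λ _ → c)) (∑-const xs c)

∑flag-const : ∀ n (xs : List A) (c : ℚ) → length xs ≡ double n → ∑flag n xs (λ _ → c) ≡ cnt n * c
∑flag-const zero    xs c len = sym (ℚ.*-identityˡ c)
∑flag-const (suc n) xs c len = begin
  ∑flag (suc n) xs (λ _ → c)
    ≡⟨ ∑edge-cong xs (λ x y r p → ∑flag-const n r c (length-edge p len)) ⟩
  ∑edge xs (λ _ _ → cnt n * c)
    ≡⟨ ∑pick-cong xs (λ x r p → trans (∑pick-const r _) (cong (λ k → fromℕ k * (cnt n * c)) (length-pick p len))) ⟩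
  ∑pick xs (λ _ _ → fromℕ (suc (double n)) * (cnt n * c))
    ≡⟨ trans (∑pick-const xs _) (cong (λ k → fromℕ k * (fromℕ (suc (double n)) * (cnt n * c))) len) ⟩
  fromℕ (double (suc n)) * (fromℕ (suc (double n)) * (cnt n * c))
    ≡⟨ solve 4 (λ a b d c → a :* (b :* (d :* c)) := a :* (b :* d) :* c) refl (fromℕ (double (suc n))) (fromℕ (suc (double n))) (cnt n) c ⟩
  cnt (suc n) * c ∎

-- Sums over ordered tuples of points

∑tuple : ℕ → List A → (List A → List A → ℚ) → ℚ
∑tuple zero    xs F = F [] xs
∑tuple (suc k) xs F = ∑pick xs (λ x r → ∑tuple k r (λ l → F (x ∷ l)))

∑tuple-cong : ∀ k {xs : List A} {F F' : List A → List A → ℚ} →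
              (∀ l r → length l ≡ k → l ++ r ↭ xs → F l r ≡ F' l r) → ∑tuple k xs F ≡ ∑tuple k xs F'
∑tuple-cong zero    h = h [] _ refl refl
∑tuple-cong (suc k) {xs} h = ∑pick-cong xs (λ x r p →
  ∑tuple-cong k (λ l s e q → h _ s (cong suc e) (↭-trans (prep x q) p)))

∑tuple-↭ : ∀ k {xs ys : List A} {F : List A → List A → ℚ} → RInv F → xs ↭ ys → ∑tuple k xs F ≡ ∑tuple k ys F
∑tuple-↭ zero    inv p = inv [] p
∑tuple-↭ (suc k) inv p = ∑pick-↭ (λ x q → ∑tuple-↭ k (λ l → inv (x ∷ l)) q) p

swapAt : ℕ → List A → List A
swapAt zero    (a ∷ b ∷ l) = b ∷ a ∷ l
swapAt (suc i) (a ∷ l)     = a ∷ swapAt i l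
swapAt _       l           = l

∑tuple-swapAt : ∀ i k {xs : List A} {F : List A → List A → ℚ} → RInv F →
                ∑tuple k xs F ≡ ∑tuple k xs (λ l → F (swapAt i l))
∑tuple-swapAt zero    zero          inv = refl
∑tuple-swapAt zero    (suc zero)    inv = refl
∑tuple-swapAt zero    (suc (suc k)) {xs} inv =
  ∑pick-exchange xs _ (λ x y → ∑tuple-↭ k (λ l → inv (x ∷ y ∷ l)))
∑tuple-swapAt (suc i) zero          inv = refl
∑tuple-swapAt (suc i) (suc k) {xs}  inv = ∑pick-cong xs (λ x r _ → ∑tuple-swapAt i k (λ l → inv (x ∷ l)))

-- Adjacent transpositions generate all permutations of the positions, so a word in them encodes any
-- such permutation.
swapsAt : List ℕ → List A → List A
swapsAt []       l = l
swapsAt (i ∷ is) l = swapAt i (swapsAt is l)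

-- A flag is the tuple of its endpoints, and `∑flag 4` unfolds to `∑tuple 8`. In this form endpoints
-- of different edges can be interchanged, which no symmetry of flags allows.
∑tuple-swapsAt : ∀ is k {xs : List A} {F : List A → List A → ℚ} → RInv F →
                 ∑tuple k xs F ≡ ∑tuple k xs (λ l → F (swapsAt is l))
∑tuple-swapsAt []       k inv = refl
∑tuple-swapsAt (i ∷ is) k inv = trans (∑tuple-swapAt i k inv) (∑tuple-swapsAt is k (λ l → inv (swapAt i l)))

-- Enumerated matchings and their canonical forms

Unique-↭ : {xs ys : List A} → xs ↭ ys → Unique xs → Unique ys
Unique-↭ refl u = u
Unique-↭ (prep x p) (q ∷ u) = Perm.All-resp-↭ p q ∷ Unique-↭ p u
Unique-↭ (swap x y p) ((x≢y ∷ qx) ∷ (qy ∷ u)) =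
  ((x≢y ∘ sym) ∷ Perm.All-resp-↭ p qy) ∷ (Perm.All-resp-↭ p qx ∷ Unique-↭ p u)
Unique-↭ (↭.trans p q) u = Unique-↭ q (Unique-↭ p u)

≡ᵇ-refl : ∀ n → (n ≡ᵇ n) ≡ true
≡ᵇ-refl zero    = refl
≡ᵇ-refl (suc n) = ≡ᵇ-refl n

≡ᵇ-≢ : ∀ {m n} → m ≢ n → (m ≡ᵇ n) ≡ false
≡ᵇ-≢ {zero}  {zero}  h = ⊥-elim (h refl)
≡ᵇ-≢ {zero}  {suc n} h = refl
≡ᵇ-≢ {suc m} {zero}  h = refl
≡ᵇ-≢ {suc m} {suc n} h = ≡ᵇ-≢ (h ∘ cong suc)

≡ᵇ-true : ∀ {m n} → (m ≡ᵇ n) ≡ true → m ≡ n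
≡ᵇ-true {m} {n} e = ℕ.≡ᵇ⇒≡ m n (subst Data.Bool.T (sym e) _)
  where import Data.Bool

removeElem-head : ∀ x xs → removeElem x (x ∷ xs) ≡ xs
removeElem-head x xs rewrite ≡ᵇ-refl x = refl

removeElem-≢ : ∀ {x y} xs → y ≢ x → removeElem y (x ∷ xs) ≡ x ∷ removeElem y xs
removeElem-≢ xs h rewrite ≡ᵇ-≢ h = refl

removeElem-↭ : ∀ {y xs} → y ∈ xs → y ∷ removeElem y xs ↭ xs
removeElem-↭ {y} {x ∷ xs} i with y ℕ.≟ x
... | yes refl = subst (λ l → y ∷ l ↭ y ∷ xs) (sym (removeElem-head y xs)) refl
removeElem-↭ {y} {x ∷ xs} (here y≡x) | no y≢x = ⊥-elim (y≢x y≡x)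
removeElem-↭ {y} {x ∷ xs} (there i)  | no y≢x =
  subst (λ l → y ∷ l ↭ x ∷ xs) (sym (removeElem-≢ xs y≢x)) (↭-trans (swap y x refl) (prep x (removeElem-↭ i)))

∑-removeElem : ∀ {xs} → Unique xs → (G : ℕ → List ℕ → ℚ) → ∑ xs (λ y → G y (removeElem y xs)) ≡ ∑pick xs G
∑-removeElem {[]}     u G = trans (∑-[] _) (sym (∑pick-[] G))
∑-removeElem {x ∷ xs} (x∉ ∷ u) G = begin
  ∑ (x ∷ xs) (λ y → G y (removeElem y (x ∷ xs)))
    ≡⟨ ∑-∷ x xs _ ⟩
  G x (removeElem x (x ∷ xs)) + ∑ xs (λ y → G y (removeElem y (x ∷ xs)))
    ≡⟨ cong₂ _+_ (cong (G x) (removeElem-head x xs))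
         (∑-cong∈ xs (λ i → cong (G _) (removeElem-≢ xs (λ e → All.lookup x∉ i (sym e))))) ⟩
  G x xs + ∑ xs (λ y → G y (x ∷ removeElem y xs))
    ≡⟨ cong (G x xs +_) (∑-removeElem u (λ y r → G y (x ∷ r))) ⟩
  G x xs + ∑pick xs (λ y r → G y (x ∷ r))
    ≡⟨ ∑pick-∷ x xs G ⟨
  ∑pick (x ∷ xs) G ∎

-- 2ⁿ n!, the number of orderings and orientations of a perfect matching.
hyper : ℕ → ℚ
hyper zero    = 1ℚ
hyper (suc n) = fromℕ (double (suc n)) * hyper n

-- `matchingsOf` always spends its next edge on the first remaining point, whereas a flag may have
-- that edge anywhere and in either orientation; `∑flag-head` supplies the corresponding factor of
-- `hyper`.
∑-matchingsOf : ∀ n f {xs} → n ℕ.≤ f → length xs ≡ double n → Unique xs → {V : Matching → ℚ} → HInv V →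
                hyper n * ∑ (matchingsOf f xs) V ≡ ∑flag n xs V
∑-matchingsOf zero f {[]} _ len u {V} inv = trans (ℚ.*-identityˡ _) (empty f)
  where
  empty : ∀ f → ∑ (matchingsOf f []) V ≡ V []
  empty zero    = trans (∑-∷ _ _ _) (trans (cong (V [] +_) (∑-[] _)) (ℚ.+-identityʳ _))
  empty (suc f) = empty zero
∑-matchingsOf (suc n) (suc f) {x ∷ xs} (ℕ.s≤s n≤f) len (x∉ ∷ u) {V} inv = begin
  k * h * ∑ (concatMap (λ y → map ((x , y) ∷_) (matchingsOf f (removeElem y xs))) xs) V
    ≡⟨ cong (k * h *_) (trans (∑-concatMap _ xs V) (∑-cong xs (λ y → ∑-map _ (matchingsOf f (removeElem y xs)) V))) ⟩
  k * h * ∑ xs (λ y → ∑ (matchingsOf f (removeElem y xs)) (λ m → V ((x , y) ∷ m)))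
    ≡⟨ cong (k * h *_) (∑-removeElem u (λ y r → ∑ (matchingsOf f r) (λ m → V ((x , y) ∷ m)))) ⟩
  k * h * ∑pick xs (λ y r → ∑ (matchingsOf f r) (λ m → V ((x , y) ∷ m)))
    ≡⟨ trans (ℚ.*-assoc k h _) (cong (k *_) (sym (∑pick-*ˡ h xs _))) ⟩
  k * ∑pick xs (λ y r → h * ∑ (matchingsOf f r) (λ m → V ((x , y) ∷ m)))
    ≡⟨ cong (k *_) (∑pick-cong xs (λ y r p → ∑-matchingsOf n f n≤f (length-pick p (cong ℕ.pred len))
         (tail (Unique-↭ (↭-sym p) u)) (HInv-∷ inv (x , y)))) ⟩
  k * ∑pick xs (λ y r → ∑flag n r (λ m → V ((x , y) ∷ m)))
    ≡⟨ ∑flag-head n x xs inv (cong ℕ.pred len) ⟨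
  ∑flag (suc n) (x ∷ xs) V ∎
  where
  k = fromℕ (double (suc n))
  h = hyper n
  tail : ∀ {y r} → Unique (y ∷ r) → Unique r
  tail (_ ∷ u) = u

orient-≈ : ∀ e {m} → e ∷ m ≈ orient e ∷ m
orient-≈ (a , b) with b <ᵇ a
... | true  = ≈-flip a b
... | false = ≈-refl

insertEdge-↭ : ∀ e m → e ∷ m ↭ insertEdge e m
insertEdge-↭ e []       = refl
insertEdge-↭ e (f ∷ m) with proj₁ f <ᵇ proj₁ e
... | true  = ↭-trans (swap e f refl) (prep f (insertEdge-↭ e m))
... | false = refl

canon-≈ : ∀ m → m ≈ canon m
canon-≈ []      = ≈-refl
canon-≈ (e ∷ m) = ≈-trans (≈-prep e (canon-≈ m)) (≈-trans (orient-≈ e) (↭⇒≈ (insertEdge-↭ (orient e) (canon m))))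

relabel : (A → B) → List (A × A) → List (B × B)
relabel h = map (λ e → h (proj₁ e) , h (proj₂ e))

relabel-≈ : (h : A → B) {m m' : List (A × A)} → m ≈ m' → relabel h m ≈ relabel h m'
relabel-≈ h ≈-refl        = ≈-refl
relabel-≈ h (≈-prep e p)  = ≈-prep _ (relabel-≈ h p)
relabel-≈ h (≈-swap e f)  = ≈-swap _ _
relabel-≈ h (≈-flip a b)  = ≈-flip _ _
relabel-≈ h (≈-trans p q) = ≈-trans (relabel-≈ h p) (relabel-≈ h q)

-- The case n = 4

∑pick-∑ : (xs : List A) (ys : List B) (F : B → A → List A → ℚ) →
          ∑pick xs (λ x r → ∑ ys (λ y → F y x r)) ≡ ∑ ys (λ y → ∑pick xs (F y))
∑pick-∑ xs ys F = trans (∑pick-def xs _) (trans (∑-exchange (picks xs) ys (λ p y → F y (proj₁ p) (proj₂ p)))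
  (∑-cong ys (λ y → sym (∑pick-def xs (F y)))))

∑tuple-∑ : ∀ k (xs : List A) (ys : List B) (F : B → List A → List A → ℚ) →
           ∑tuple k xs (λ l r → ∑ ys (λ y → F y l r)) ≡ ∑ ys (λ y → ∑tuple k xs (F y))
∑tuple-∑ zero    xs ys F = refl
∑tuple-∑ (suc k) xs ys F = trans (∑pick-cong xs (λ x r _ → ∑tuple-∑ k r ys _)) (∑pick-∑ xs ys _)

∑-product : (xs : List A) (ys : List B) (f : A → ℚ) (g : B → ℚ) →
            ∑ xs f * ∑ ys g ≡ ∑ xs (λ x → ∑ ys (λ y → f x * g y))
∑-product xs ys f g = trans (sym (∑-*ʳ (∑ ys g) xs f)) (∑-cong xs (λ x → sym (∑-*ˡ (f x) ys g)))

-- Out of range positions yield 0.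
at : List ℕ → ℕ → ℕ
at []      _       = 0
at (x ∷ l) zero    = x
at (x ∷ l) (suc i) = at l i

at-map : ∀ (h : ℕ → ℕ) l {i} → i < length l → at (map h l) i ≡ h (at l i)
at-map h (x ∷ l) {zero}  _           = refl
at-map h (x ∷ l) {suc i} (ℕ.s≤s i<n) = at-map h l i<n

at-upTo : ∀ l → length l ≡ 8 → map (at l) (upTo 8) ≡ l
at-upTo (_ ∷ _ ∷ _ ∷ _ ∷ _ ∷ _ ∷ _ ∷ _ ∷ []) refl = refl

swapAt-map : (h : A → B) → ∀ i l → swapAt i (map h l) ≡ map h (swapAt i l)
swapAt-map h zero    []          = refl
swapAt-map h zero    (a ∷ [])    = refl
swapAt-map h zero    (a ∷ b ∷ l) = refl
swapAt-map h (suc i) []          = refl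
swapAt-map h (suc i) (a ∷ l)     = cong (h a ∷_) (swapAt-map h i l)

swapsAt-map : (h : A → B) → ∀ is l → swapsAt is (map h l) ≡ map h (swapsAt is l)
swapsAt-map h []       l = refl
swapsAt-map h (i ∷ is) l = trans (cong (swapAt i) (swapsAt-map h is l)) (swapAt-map h i (swapsAt is l))

length-swapAt : ∀ i (l : List A) → length (swapAt i l) ≡ length l
length-swapAt zero    []          = refl
length-swapAt zero    (a ∷ [])    = refl
length-swapAt zero    (a ∷ b ∷ l) = refl
length-swapAt (suc i) []          = refl
length-swapAt (suc i) (a ∷ l)     = cong suc (length-swapAt i l)

length-swapsAt : ∀ is (l : List A) → length (swapsAt is l) ≡ length l
length-swapsAt []       l = refl
length-swapsAt (i ∷ is) l = trans (length-swapAt i (swapsAt is l)) (length-swapsAt is l)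

opaque
  ∑tuple₈ : List ℕ → (List ℕ → ℚ) → ℚ
  ∑tuple₈ xs f = ∑tuple 8 xs (λ l _ → f l)

  ∑tuple₈-def : ∀ xs f → ∑tuple₈ xs f ≡ ∑tuple 8 xs (λ l _ → f l)
  ∑tuple₈-def xs f = refl

∑tuple₈-cong : ∀ xs {f g} → length xs ≡ 8 → (∀ l → length l ≡ 8 → l ↭ xs → f l ≡ g l) → ∑tuple₈ xs f ≡ ∑tuple₈ xs g
∑tuple₈-cong xs {f} {g} len h = trans (∑tuple₈-def xs f) (trans
  (∑tuple-cong 8 {F = λ l _ → f l} {F' = λ l _ → g l} (λ l r e p → h l e (full l r e p))) (sym (∑tuple₈-def xs g)))
  where
  full : ∀ l r → length l ≡ 8 → l ++ r ↭ xs → l ↭ xs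
  full l []      e p = subst (_↭ xs) (List.++-identityʳ l) p
  full l (x ∷ r) e p = ⊥-elim (ℕ.m+1+n≢m 8 (trans (sym (cong (ℕ._+ suc (length r)) e))
    (trans (sym (List.length-++ l)) (trans (Perm.↭-length p) len))))

∑tuple₈-∑ : ∀ xs (ys : List B) (F : B → List ℕ → ℚ) → ∑tuple₈ xs (λ l → ∑ ys (λ y → F y l)) ≡ ∑ ys (λ y → ∑tuple₈ xs (F y))
∑tuple₈-∑ xs ys F = trans (∑tuple₈-def xs _) (trans (∑tuple-∑ 8 xs ys (λ y l _ → F y l))
  (∑-cong ys (λ y → sym (∑tuple₈-def xs (F y)))))

∑tuple₈-swapsAt : ∀ is xs f → ∑tuple₈ xs f ≡ ∑tuple₈ xs (λ l → f (swapsAt is l))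
∑tuple₈-swapsAt is xs f = trans (∑tuple₈-def xs f) (trans (∑tuple-swapsAt is 8 {F = λ l _ → f l} (λ _ _ → refl))
  (sym (∑tuple₈-def xs _)))

-- The orbits of the symmetric group on pairs of matchings of eight points, named by the parts of
-- the cycle type other than 1; `c1` is equality.
data Class : Set where
  c1 c2 c22 c3 c4 : Class

M₀ : Matching
M₀ = (0 , 1) ∷ (2 , 3) ∷ (4 , 5) ∷ (6 , 7) ∷ []

-- Representatives of the orbits with first member `M₀`, longest cycles on the smallest points. The
-- one for `c4` is `rot M₀`, which links it to `rotForm`.
std : Class → Matching
std c1  = M₀
std c2  = (1 , 2) ∷ (3 , 0) ∷ (4 , 5) ∷ (6 , 7) ∷ []
std c22 = (1 , 2) ∷ (3 , 0) ∷ (5 , 6) ∷ (7 , 4) ∷ []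
std c3  = (1 , 2) ∷ (3 , 4) ∷ (5 , 0) ∷ (6 , 7) ∷ []
std c4  = (1 , 2) ∷ (3 , 4) ∷ (5 , 6) ∷ (7 , 0) ∷ []

bounded : Matching → Set
bounded M = All (_< 8) (flat M)

std-bounded : ∀ c → bounded (std c)
std-bounded c1  = from-yes (All.all? (λ i → i ℕ.<? 8) (flat (std c1)))
std-bounded c2  = from-yes (All.all? (λ i → i ℕ.<? 8) (flat (std c2)))
std-bounded c22 = from-yes (All.all? (λ i → i ℕ.<? 8) (flat (std c22)))
std-bounded c3  = from-yes (All.all? (λ i → i ℕ.<? 8) (flat (std c3)))
std-bounded c4  = from-yes (All.all? (λ i → i ℕ.<? 8) (flat (std c4)))

relabel-at : (h : ℕ → ℕ) (s : List ℕ) → length s ≡ 8 → ∀ M → bounded M →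
             relabel (at (map h s)) M ≡ relabel h (relabel (at s) M)
relabel-at h s len []            []            = refl
relabel-at h s len ((a , b) ∷ M) (p ∷ (q ∷ ps)) = cong₂ _∷_
  (cong₂ _,_ (at-map h s (subst (a <_) (sym len) p)) (at-map h s (subst (b <_) (sym len) q)))
  (relabel-at h s len M ps)

sameMatching : Matching → Matching → Bool
sameMatching M N = does (List.≡-dec (×.≡-dec ℕ._≟_ ℕ._≟_) (canon M) (canon N))

sameMatching-≈ : ∀ M N → sameMatching M N ≡ true → M ≈ N
sameMatching-≈ M N e with List.≡-dec (×.≡-dec ℕ._≟_ ℕ._≟_) (canon M) (canon N)
... | yes p = ≈-trans (canon-≈ M) (subst (_≈ N) (sym p) (≈-sym (canon-≈ N)))

-- Walking alternately along `M` and `N`, and putting long cycles in front, lists the points in the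
-- places that `M₀` and `std c` give to them.
cycleList : Matching → Matching → List ℕ → List ℕ → List (List ℕ)
cycleList M N vis []       = []
cycleList M N vis (x ∷ xs) = if memb x vis then cycleList M N vis xs
  else (let o = orbit 8 (partner M) (partner N) x x in longer o (cycleList M N (o ++ vis) xs))
  where
  longer : List ℕ → List (List ℕ) → List (List ℕ)
  longer o []       = o ∷ []
  longer o (c ∷ cs) = if length o <ᵇ length c then c ∷ longer o cs else o ∷ c ∷ cs

-- Read from the left the word sorts `l`; `swapsAt` applies words from the right and hence rebuilds
-- `l` from the sorted list. Nothing is proved about it, since each result is tested by `certifies`.
bubbleSwaps : ℕ → List ℕ → List ℕ
bubbleSwaps zero    l = []
bubbleSwaps (suc f) l = go 0 l
  where
  go : ℕ → List ℕ → List ℕ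
  go i (a ∷ b ∷ r) = if b <ᵇ a then i ∷ bubbleSwaps f (swapAt i l) else go (suc i) (b ∷ r)
  go i _           = []

swapsFor : Matching → Matching → List ℕ
-- 28 is the largest number of inversions of eight entries.
swapsFor M N = bubbleSwaps 28 (concat (cycleList M N [] (upTo 8)))

classOf : Matching → Matching → Class
classOf M N = go (cycleType 4 M N)
  where
  go : List ℕ → Class
  go (4 ∷ _)     = c4
  go (3 ∷ _)     = c3
  go (2 ∷ 2 ∷ _) = c22
  go (2 ∷ _)     = c2
  go _           = c1

-- The permutation s of the positions has to carry the standard pair (M₀ , std c) to (M , N).
certifies : List ℕ → Class → Matching → Matching → Bool
certifies s c M N = sameMatching (relabel (at s) M₀) M ∧ sameMatching (relabel (at s) (std c)) N

check : Matching → Matching → Bool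
check M N = certifies (swapsAt (swapsFor M N) (upTo 8)) (classOf M N) M N

∧-true : ∀ {a b} → a ∧ b ≡ true → a ≡ true × b ≡ true
∧-true {true} e = refl , e

allPairs : (Matching → Matching → Bool) → List Matching → List Matching → Bool
allPairs f []      Ns = true
allPairs f (M ∷ Ms) Ns = foldr (λ N b → f M N ∧ b) true Ns ∧ allPairs f Ms Ns

allPairs-sound : ∀ f Ms Ns → allPairs f Ms Ns ≡ true → ∀ {M N} → M ∈ Ms → N ∈ Ns → f M N ≡ true
allPairs-sound f (M ∷ Ms) Ns e (here refl) j = row Ns (proj₁ (∧-true e)) j
  where
  row : ∀ Ns → foldr (λ N b → f M N ∧ b) true Ns ≡ true → ∀ {N} → N ∈ Ns → f M N ≡ true
  row (N ∷ Ns) e (here refl) = proj₁ (∧-true e)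
  row (N ∷ Ns) e (there j)   = row Ns (proj₂ (∧-true {f M N} e)) j
allPairs-sound f (M ∷ Ms) Ns e (there i) j =
  allPairs-sound f Ms Ns (proj₂ (∧-true {foldr (λ N b → f M N ∧ b) true Ns} e)) i j

record Tally : Set where
  constructor tally
  field n1 n2 n22 n3 n4 : ℕ

addClass : Class → Tally → Tally
addClass c1  (tally a b c d e) = tally (suc a) b c d e
addClass c2  (tally a b c d e) = tally a (suc b) c d e
addClass c22 (tally a b c d e) = tally a b (suc c) d e
addClass c3  (tally a b c d e) = tally a b c (suc d) e
addClass c4  (tally a b c d e) = tally a b c d (suc e)

tallyOf : List Class → Tally
tallyOf = foldr addClass (tally 0 0 0 0 0)

-- Turns a double sum over matchings into a linear form in five unknowns whose coefficients are
-- found by evaluation.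
weigh : (Class → ℚ) → Tally → ℚ
weigh f (tally a b c d e) = fromℕ a * f c1 + (fromℕ b * f c2 + (fromℕ c * f c22 + (fromℕ d * f c3 + fromℕ e * f c4)))

weigh-addClass : ∀ f k t → f k + weigh f t ≡ weigh f (addClass k t)
weigh-addClass f k (tally a b c d e) = go k
  where
  x₁ = fromℕ a * f c1
  x₂ = fromℕ b * f c2
  x₃ = fromℕ c * f c22
  x₄ = fromℕ d * f c3
  x₅ = fromℕ e * f c4
  here₊ : ∀ x p r → p + (x * p + r) ≡ (1ℚ + x) * p + r
  here₊ = solve 3 (λ x p r → p :+ (x :* p :+ r) := (con 1ℚ :+ x) :* p :+ r) refl
  there₊ : ∀ p y r r' → p + r ≡ r' → p + (y + r) ≡ y + r'
  there₊ p y r r' e = trans (solve 3 (λ p y r → p :+ (y :+ r) := y :+ (p :+ r)) refl p y r) (cong (y +_) e)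
  last₊ : ∀ x p → p + x * p ≡ (1ℚ + x) * p
  last₊ = solve 2 (λ x p → p :+ x :* p := (con 1ℚ :+ x) :* p) refl
  go : ∀ k → f k + weigh f (tally a b c d e) ≡ weigh f (addClass k (tally a b c d e))
  go c1  = here₊ (fromℕ a) (f c1) (x₂ + (x₃ + (x₄ + x₅)))
  go c2  = there₊ (f c2) x₁ _ _ (here₊ (fromℕ b) (f c2) (x₃ + (x₄ + x₅)))
  go c22 = there₊ (f c22) x₁ _ _ (there₊ (f c22) x₂ _ _ (here₊ (fromℕ c) (f c22) (x₄ + x₅)))
  go c3  = there₊ (f c3) x₁ _ _ (there₊ (f c3) x₂ _ _ (there₊ (f c3) x₃ _ _ (here₊ (fromℕ d) (f c3) x₅)))
  go c4  = there₊ (f c4) x₁ _ _ (there₊ (f c4) x₂ _ _ (there₊ (f c4) x₃ _ _ (there₊ (f c4) x₄ _ _ (last₊ (fromℕ e) (f c4)))))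

∑-tally : ∀ (f : Class → ℚ) L → ∑ L f ≡ weigh f (tallyOf L)
∑-tally f []      = trans (∑-[] f) (solve 5 (λ a b c d e → con 0ℚ := con 0ℚ :* a :+ (con 0ℚ :* b :+ (con 0ℚ :* c :+ (con 0ℚ :* d :+ con 0ℚ :* e)))) refl (f c1) (f c2) (f c22) (f c3) (f c4))
∑-tally f (k ∷ L) = trans (∑-∷ k L f) (trans (cong (f k +_) (∑-tally f L)) (weigh-addClass f k (tallyOf L)))

module Base {xs : List ℕ} (len : length xs ≡ 8) {V : Matching → ℚ} (inv : HInv V) where

  -- Summing over all orderings of the eight points makes this invariant under simultaneous
  -- relabelling of both matchings, so it depends only on their `Class`.
  Ψ : Matching → Matching → ℚ
  Ψ M N = ∑tuple₈ xs (λ l → V (relabel (at l) M) * V (relabel (at l) N))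

  Φ : Class → ℚ
  Φ c = Ψ M₀ (std c)

  Ψ-reindex : ∀ is M N → bounded M → bounded N →
              let s = swapsAt is (upTo 8) in Ψ M N ≡ Ψ (relabel (at s) M) (relabel (at s) N)
  Ψ-reindex is M N bM bN = trans (∑tuple₈-swapsAt is xs _) (∑tuple₈-cong xs len (λ l e _ →
    cong₂ (λ a b → V a * V b) (moved l e M bM) (moved l e N bN)))
    where
    s = swapsAt is (upTo 8)
    moved : ∀ l → length l ≡ 8 → ∀ M → bounded M → relabel (at (swapsAt is l)) M ≡ relabel (at l) (relabel (at s) M)
    moved l e M bM = begin
      relabel (at (swapsAt is l)) M                        ≡⟨ cong (λ l → relabel (at (swapsAt is l)) M) (at-upTo l e) ⟨
      relabel (at (swapsAt is (map (at l) (upTo 8)))) M    ≡⟨ cong (λ t → relabel (at t) M) (swapsAt-map (at l) is (upTo 8)) ⟩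
      relabel (at (map (at l) s)) M                        ≡⟨ relabel-at (at l) s (length-swapsAt is (upTo 8)) M bM ⟩
      relabel (at l) (relabel (at s) M)                    ∎

  Ψ-≈ : ∀ {M M' N N'} → M ≈ M' → N ≈ N' → Ψ M N ≡ Ψ M' N'
  Ψ-≈ p q = ∑tuple₈-cong xs len (λ l _ _ → cong₂ _*_ (inv (relabel-≈ (at l) p)) (inv (relabel-≈ (at l) q)))

  Ψ-class : ∀ is c M N → certifies (swapsAt is (upTo 8)) c M N ≡ true → Ψ M N ≡ Φ c
  Ψ-class is c M N e = sym (trans
    (Ψ-reindex is M₀ (std c) (std-bounded c1) (std-bounded c))
    (Ψ-≈ (sameMatching-≈ _ M (proj₁ both)) (sameMatching-≈ _ N (proj₂ both))))
    where both = ∧-true {sameMatching (relabel (at (swapsAt is (upTo 8))) M₀) M} e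

  form : List Matching → List Matching → ℚ
  form Ms Ns = ∑tuple₈ xs (λ l → ∑ Ms (λ M → V (relabel (at l) M)) * ∑ Ns (λ N → V (relabel (at l) N)))

  form-tally : ∀ (cls : Matching → Matching → Class) (sw : Matching → Matching → List ℕ) Ms Ns →
               allPairs (λ M N → certifies (swapsAt (sw M N) (upTo 8)) (cls M N) M N) Ms Ns ≡ true →
               form Ms Ns ≡ weigh Φ (tallyOf (concatMap (λ M → map (cls M) Ns) Ms))
  form-tally cls sw Ms Ns e = begin
    form Ms Ns
      ≡⟨ ∑tuple₈-cong xs len (λ l _ _ → ∑-product Ms Ns _ _) ⟩
    ∑tuple₈ xs (λ l → ∑ Ms (λ M → ∑ Ns (λ N → V (relabel (at l) M) * V (relabel (at l) N))))
      ≡⟨ trans (∑tuple₈-∑ xs Ms _) (∑-cong Ms (λ M → ∑tuple₈-∑ xs Ns _)) ⟩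
    ∑ Ms (λ M → ∑ Ns (λ N → Ψ M N))
      ≡⟨ ∑-cong∈ Ms (λ {M} i → ∑-cong∈ Ns (λ {N} j → Ψ-class (sw M N) (cls M N) M N
           (allPairs-sound (λ M N → certifies (swapsAt (sw M N) (upTo 8)) (cls M N) M N) Ms Ns e i j))) ⟩
    ∑ Ms (λ M → ∑ Ns (λ N → Φ (cls M N)))
      ≡⟨ trans (∑-concatMap _ Ms Φ) (∑-cong Ms (λ M → ∑-map (cls M) Ns Φ)) ⟨
    ∑ (concatMap (λ M → map (cls M) Ns) Ms) Φ
      ≡⟨ ∑-tally Φ (concatMap (λ M → map (cls M) Ns) Ms) ⟩
    weigh Φ (tallyOf (concatMap (λ M → map (cls M) Ns) Ms)) ∎

-- The matchings that keep the edge {6,7} of `M₀` and one more of its edges, and re-pair the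
-- endpoints of the other two.
neighbours : List Matching
neighbours = map (_++ (6 , 7) ∷ [])
  (((0 , 2) ∷ (1 , 3) ∷ (4 , 5) ∷ []) ∷ ((0 , 3) ∷ (1 , 2) ∷ (4 , 5) ∷ []) ∷
   ((0 , 4) ∷ (1 , 5) ∷ (2 , 3) ∷ []) ∷ ((0 , 5) ∷ (1 , 4) ∷ (2 , 3) ∷ []) ∷
   ((2 , 4) ∷ (3 , 5) ∷ (0 , 1) ∷ []) ∷ ((2 , 5) ∷ (3 , 4) ∷ (0 , 1) ∷ []) ∷ [])

-- The nine matchings without an edge between {0,1,2,3} and {4,5,6,7}.
split : List Matching
split = concatMap (λ M → map (M ++_) (matchingsOf 4 (4 ∷ 5 ∷ 6 ∷ 7 ∷ []))) (matchingsOf 4 (upTo 4))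

check-all : allPairs check [ M₀ ] (Ms 4) ≡ true
check-all = refl

check-split : allPairs check split split ≡ true
check-split = refl

check-neighbours : allPairs check neighbours neighbours ≡ true
check-neighbours = refl

check-M₀ : allPairs check [ M₀ ] neighbours ≡ true
check-M₀ = refl

∑tuple-lin : ∀ k (a b : ℚ) (xs : List A) (F G : List A → List A → ℚ) →
             ∑tuple k xs (λ l r → a * F l r + b * G l r) ≡ a * ∑tuple k xs F + b * ∑tuple k xs G
∑tuple-lin zero    a b xs F G = refl
∑tuple-lin (suc k) a b xs F G = trans (∑pick-cong xs (λ x r _ → ∑tuple-lin k a b r (λ l → F (x ∷ l)) (λ l → G (x ∷ l))))
  (trans (∑pick-+ xs (λ x r → a * ∑tuple k r (λ l → F (x ∷ l))) (λ x r → b * ∑tuple k r (λ l → G (x ∷ l))))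
    (cong₂ _+_ (∑pick-*ˡ a xs _) (∑pick-*ˡ b xs _)))

∑tuple₈-lin : ∀ (a b : ℚ) xs (f g : List ℕ → ℚ) → ∑tuple₈ xs (λ l → a * f l + b * g l) ≡ a * ∑tuple₈ xs f + b * ∑tuple₈ xs g
∑tuple₈-lin a b xs f g = trans (∑tuple₈-def xs (λ l → a * f l + b * g l)) (trans (∑tuple-lin 8 a b xs (λ l _ → f l) (λ l _ → g l))
  (sym (cong₂ (λ s t → a * s + b * t) (∑tuple₈-def xs f) (∑tuple₈-def xs g))))

+-nonneg : ∀ {a b} → 0ℚ ≤ℚ a → 0ℚ ≤ℚ b → 0ℚ ≤ℚ a + b
+-nonneg = ℚ.+-mono-≤

*-nonneg : ∀ {a b} → 0ℚ ≤ℚ a → 0ℚ ≤ℚ b → 0ℚ ≤ℚ a * b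
*-nonneg {a} {b} p q = subst (_≤ℚ a * b) (ℚ.*-zeroʳ a) (ℚ.*-monoˡ-≤-nonNeg a ⦃ ℚ.nonNegative p ⦄ q)

square-nonneg : ∀ a → 0ℚ ≤ℚ a * a
square-nonneg a with ℚ.≤-total 0ℚ a
... | inj₁ p = *-nonneg p p
... | inj₂ p = subst (0ℚ ≤ℚ_) (solve 1 (λ a → (:- a) :* (:- a) := a :* a) refl a)
                 (*-nonneg (ℚ.neg-antimono-≤ p) (ℚ.neg-antimono-≤ p))

≤-from-diff : ∀ {a b} d → 0ℚ ≤ℚ d → b ≡ a + d → a ≤ℚ b
≤-from-diff {a} d p refl = subst (_≤ℚ a + d) (ℚ.+-identityʳ a) (ℚ.+-monoʳ-≤ a p)

∑pick-nonneg : (xs : List A) {G : A → List A → ℚ} → (∀ x r → 0ℚ ≤ℚ G x r) → 0ℚ ≤ℚ ∑pick xs G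
∑pick-nonneg xs {G} h = subst (_≤ℚ ∑pick xs G) (∑pick-zero xs (λ _ _ _ → refl)) (∑pick-mono xs (λ x r _ → h x r))

∑tuple-nonneg : ∀ k (xs : List A) {F : List A → List A → ℚ} → (∀ l r → 0ℚ ≤ℚ F l r) → 0ℚ ≤ℚ ∑tuple k xs F
∑tuple-nonneg zero    xs h = h [] xs
∑tuple-nonneg (suc k) xs h = ∑pick-nonneg xs (λ x r → ∑tuple-nonneg k r (λ l → h (x ∷ l)))

∑tuple₈-square : ∀ xs (f : List ℕ → ℚ) → 0ℚ ≤ℚ ∑tuple₈ xs (λ l → f l * f l)
∑tuple₈-square xs f = subst (0ℚ ≤ℚ_) (sym (∑tuple₈-def xs (λ l → f l * f l))) (∑tuple-nonneg 8 xs (λ l _ → square-nonneg (f l)))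

∑-single : (x : A) (f : A → ℚ) → ∑ (x ∷ []) f ≡ f x
∑-single x f = trans (∑-∷ x [] f) (trans (cong (f x +_) (∑-[] f)) (ℚ.+-identityʳ _))

-- `m` and `rot m` form one 8-cycle through the first eight endpoints and share all further edges.
rot : Matching → Matching
rot ((a₁ , b₁) ∷ (a₂ , b₂) ∷ (a₃ , b₃) ∷ (a₄ , b₄) ∷ m) = (b₁ , a₂) ∷ (b₂ , a₃) ∷ (b₃ , a₄) ∷ (b₄ , a₁) ∷ m
rot m = m

-- For functions of the matching alone, `rotForm` is the form of the adjacency matrix divided by its
-- valency: as the flag varies over the presentations of a matching, `rot` reaches every neighbour
-- equally often.
inner rotForm : ℕ → List ℕ → (V W : Matching → ℚ) → ℚ
inner   n xs V W = ∑flag n xs (λ m → V m * W m)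
rotForm n xs V W = ∑flag n xs (λ m → V m * W (rot m))

module _ {xs : List ℕ} (len : length xs ≡ 8) {V : Matching → ℚ} (inv : HInv V) (sum0 : ∑flag 4 xs V ≡ 0ℚ) where
  open Base {xs} len {V} inv

  private
    f1 = Φ c1 ; f2 = Φ c2 ; f22 = Φ c22 ; f3 = Φ c3 ; f4 = Φ c4
    v : List ℕ → ℚ
    v l = V (relabel (at l) M₀)
    v₁ : List ℕ → ℚ
    v₁ l = ∑ [ M₀ ] (λ M → V (relabel (at l) M))
    S : List ℕ → ℚ
    S l = ∑ neighbours (λ N → V (relabel (at l) N))

    vanish : ∀ l → length l ≡ 8 → l ↭ xs → ∑ (Ms 4) (λ M → V (relabel (at l) M)) ≡ 0ℚ
    vanish l e p = begin
      -- 384 = 2⁴ · 4! is `hyper 4`.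
      ∑ (Ms 4) W                           ≡⟨ solve 1 (λ s → s := con ((ℤ.+ 1) ℚ./ 384) :* (con (hyper 4) :* s)) refl (∑ (Ms 4) W) ⟩
      ((ℤ.+ 1) ℚ./ 384) * (hyper 4 * ∑ (Ms 4) W)
        ≡⟨ cong (((ℤ.+ 1) ℚ./ 384) *_) (begin
             hyper 4 * ∑ (Ms 4) W          ≡⟨ ∑-matchingsOf 4 8 (ℕ.m≤m+n 4 4) refl (Unique.upTo⁺ 8) (λ q → inv (relabel-≈ (at l) q)) ⟩
             ∑flag 4 (upTo 8) W            ≡⟨ ∑flag-map 4 (at l) (upTo 8) V ⟨
             ∑flag 4 (map (at l) (upTo 8)) V ≡⟨ cong (λ l → ∑flag 4 l V) (at-upTo l e) ⟩
             ∑flag 4 l V                   ≡⟨ ∑flag-↭ 4 V p ⟩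
             ∑flag 4 xs V                  ≡⟨ sum0 ⟩
             0ℚ ∎) ⟩
      ((ℤ.+ 1) ℚ./ 384) * 0ℚ               ≡⟨ ℚ.*-zeroʳ ((ℤ.+ 1) ℚ./ 384) ⟩
      0ℚ ∎
      where W = λ M → V (relabel (at l) M)

    form-zero : form [ M₀ ] (Ms 4) ≡ 0ℚ
    form-zero = trans (∑tuple₈-cong xs {g = λ l → 0ℚ * 0ℚ + 0ℚ * 0ℚ} len (λ l e p →
        trans (cong (∑ [ M₀ ] (λ M → V (relabel (at l) M)) *_) (vanish l e p)) (ℚ.*-zeroʳ (∑ [ M₀ ] (λ M → V (relabel (at l) M))))))
      (trans (∑tuple₈-lin 0ℚ 0ℚ xs (λ _ → 0ℚ) (λ _ → 0ℚ))
        (solve 1 (λ t → con 0ℚ :* t :+ con 0ℚ :* t := con 0ℚ) refl (∑tuple₈ xs (λ _ → 0ℚ))))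

    -- The coefficients are the sizes of the five classes of the 105 matchings, as seen from `M₀`.
    Jz : weigh Φ (tally 1 12 12 32 48) ≡ 0ℚ
    Jz = trans (sym (form-tally classOf swapsFor [ M₀ ] (Ms 4) check-all)) form-zero

    -- Of the 81 pairs of split matchings 36 differ in one half and 36 in both.
    Q₁ : 0ℚ ≤ℚ weigh Φ (tally 9 36 36 0 0)
    Q₁ = subst (0ℚ ≤ℚ_) (form-tally classOf swapsFor split split check-split) (∑tuple₈-square xs (λ l → ∑ split (λ M → V (relabel (at l) M))))

    -- In the square of 2S - v the terms in Φ₂ from S² and from v S cancel, leaving 25 Φ₁ + 96 Φ₃.
    -- Together with `Q₁` this is 34 Φ₁ + 3 (12 Φ₂ + 12 Φ₂₂ + 32 Φ₃), in proportion to `Jz`.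
    Q₂ : 0ℚ ≤ℚ fromℕ 4 * weigh Φ (tally 6 6 0 24 0) + 1ℚ * (- fromℕ 4 * weigh Φ (tally 0 6 0 0 0) + 1ℚ * f1)
    Q₂ = subst (0ℚ ≤ℚ_) (begin
      ∑tuple₈ xs (λ l → (fromℕ 2 * S l - v l) * (fromℕ 2 * S l - v l))
        ≡⟨ ∑tuple₈-cong xs len (λ l _ _ → trans
             (solve 2 (λ s v → (con (fromℕ 2) :* s :- v) :* (con (fromℕ 2) :* s :- v)
                := con (fromℕ 4) :* (s :* s) :+ con 1ℚ :* (:- con (fromℕ 4) :* (v :* s) :+ con 1ℚ :* (v :* v))) refl (S l) (v l))
             (cong (λ w → fromℕ 4 * (S l * S l) + 1ℚ * (- fromℕ 4 * (w * S l) + 1ℚ * (v l * v l)))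
               (sym (∑-single M₀ (λ M → V (relabel (at l) M)))))) ⟩
      ∑tuple₈ xs (λ l → fromℕ 4 * (S l * S l) + 1ℚ * (- fromℕ 4 * (∑ [ M₀ ] (λ M → V (relabel (at l) M)) * S l) + 1ℚ * (v l * v l)))
        ≡⟨ trans (∑tuple₈-lin (fromℕ 4) 1ℚ xs (λ l → S l * S l) (λ l → - fromℕ 4 * (v₁ l * S l) + 1ℚ * (v l * v l))) (cong (λ t → fromℕ 4 * form neighbours neighbours + 1ℚ * t) (∑tuple₈-lin (- fromℕ 4) 1ℚ xs (λ l → v₁ l * S l) (λ l → v l * v l))) ⟩
      fromℕ 4 * form neighbours neighbours + 1ℚ * (- fromℕ 4 * form [ M₀ ] neighbours + 1ℚ * f1)
        ≡⟨ cong₂ (λ s t → fromℕ 4 * s + 1ℚ * (- fromℕ 4 * t + 1ℚ * f1))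
             (form-tally classOf swapsFor neighbours neighbours check-neighbours)
             (form-tally classOf swapsFor [ M₀ ] neighbours check-M₀) ⟩
      fromℕ 4 * weigh Φ (tally 6 6 0 24 0) + 1ℚ * (- fromℕ 4 * weigh Φ (tally 0 6 0 0 0) + 1ℚ * f1) ∎)
      (∑tuple₈-square xs (λ l → fromℕ 2 * S l - v l))

    Q₃ : 0ℚ ≤ℚ f1
    Q₃ = ∑tuple₈-square xs v

    lit : ∀ {c} → True (0ℚ ℚ.≤? c) → 0ℚ ≤ℚ c
    lit = toWitness

    -- The first two squares bound −(12 Φ₂ + 12 Φ₂₂ + 32 Φ₃), which is Φ₁ + 48 Φ₄ as the sum vanishes.
    combine : fromℕ 15 * f4 ≤ℚ fromℕ 4 * f1
    combine = ≤-from-diff _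
      (+-nonneg (*-nonneg (lit {(ℤ.+ 5) ℚ./ 48} _) (+-nonneg Q₁ Q₂)) (*-nonneg (lit {(ℤ.+ 37) ℚ./ 48} _) Q₃))
      (trans (trans (sym (ℚ.+-identityʳ _)) (cong (λ z → fromℕ 4 * f1 + (ℤ.+ 15 ℚ./ 48) * z) (sym Jz)))
        (solve 5 (λ a b c d e →
          let w = λ p q r s t → con (fromℕ p) :* a :+ (con (fromℕ q) :* b :+ (con (fromℕ r) :* c :+ (con (fromℕ s) :* d :+ con (fromℕ t) :* e)))
          in con (fromℕ 4) :* a :+ con (ℤ.+ 15 ℚ./ 48) :* w 1 12 12 32 48 :=
             con (fromℕ 15) :* e :+ (con (ℤ.+ 5 ℚ./ 48) :* (w 9 36 36 0 0 :+ (con (fromℕ 4) :* w 6 6 0 24 0 :+ con 1ℚ :* (:- con (fromℕ 4) :* w 0 6 0 0 0 :+ con 1ℚ :* a)))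
               :+ con (ℤ.+ 37 ℚ./ 48) :* a)) refl f1 f2 f22 f3 f4))

  -- 4/15 is 64/5 divided by the valency 48. The passage from tuples to flags is by unfolding.
  rotForm-base : fromℕ 15 * rotForm 4 xs V V ≤ℚ fromℕ 4 * inner 4 xs V V
  rotForm-base = subst₂ (λ s t → fromℕ 15 * s ≤ℚ fromℕ 4 * t) (∑tuple₈-def xs (λ l → v l * V (relabel (at l) (std c4)))) (∑tuple₈-def xs (λ l → v l * v l)) combine

-- The neighbour sum

fromℕ-double : ∀ n → fromℕ (double n) ≡ fromℕ n + fromℕ n
fromℕ-double zero    = refl
fromℕ-double (suc n) = trans (cong (λ t → 1ℚ + (1ℚ + t)) (fromℕ-double n))
  (solve 1 (λ n → con 1ℚ :+ (con 1ℚ :+ (n :+ n)) := con 1ℚ :+ n :+ (con 1ℚ :+ n)) refl (fromℕ n))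

opaque
  ∑opick : {A : Set} → List (A × A) → (A × A → List (A × A) → ℚ) → ℚ
  ∑opick m G = ∑pick m (λ e r → G e r + G (proj₂ e , proj₁ e) r)

  ∑opick-def : {A : Set} (m : List (A × A)) (G : A × A → List (A × A) → ℚ) →
               ∑opick m G ≡ ∑pick m (λ e r → G e r + G (proj₂ e , proj₁ e) r)
  ∑opick-def m G = refl

  ∑opick-cong : (m : List (A × A)) → {G H : A × A → List (A × A) → ℚ} → (∀ e r → e ∷ r ≈ m → G e r ≡ H e r) → ∑opick m G ≡ ∑opick m H
  ∑opick-cong m h = ∑pick-cong m (λ { (a , b) r p →
    cong₂ _+_ (h (a , b) r (↭⇒≈ p)) (h (b , a) r (≈-trans (≈-flip b a) (↭⇒≈ p))) })

  ∑opick-+ : (m : List (A × A)) (G H : A × A → List (A × A) → ℚ) → ∑opick m (λ e r → G e r + H e r) ≡ ∑opick m G + ∑opick m H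
  ∑opick-+ m G H = trans (∑pick-cong m (λ { (a , b) r _ →
      solve 4 (λ p q r s → p :+ q :+ (r :+ s) := p :+ r :+ (q :+ s)) refl (G (a , b) r) (H (a , b) r) (G (b , a) r) (H (b , a) r) }))
    (∑pick-+ m _ _)

  ∑opick-*ˡ : (m : List (A × A)) (c : ℚ) (G : A × A → List (A × A) → ℚ) → ∑opick m (λ e r → c * G e r) ≡ c * ∑opick m G
  ∑opick-*ˡ m c G = trans (∑pick-cong m (λ { (a , b) r _ → sym (ℚ.*-distribˡ-+ c (G (a , b) r) (G (b , a) r)) })) (∑pick-*ˡ c m _)

  ∑opick-const : (m : List (A × A)) (c : ℚ) → ∑opick m (λ _ _ → c) ≡ fromℕ (double (length m)) * c
  ∑opick-const m c = trans (∑pick-const m (c + c)) (trans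
    (solve 2 (λ l c → l :* (c :+ c) := (l :+ l) :* c) refl (fromℕ (length m)) c)
    (cong (_* c) (sym (fromℕ-double (length m)))))

  ∑opick-exchange : (m : List (A × A)) (F : A × A → A × A → List (A × A) → ℚ) → (∀ e → RInv (F e)) →
                    ∑opick m (λ e r → ∑opick r (F e)) ≡ ∑opick m (λ e r → ∑opick r (λ f → F f e))
  ∑opick-exchange {A = A} m F inv = begin
    ∑opick m (λ e r → ∑opick r (F e))
      ≡⟨ ∑pick-cong m (λ e r _ → sym (∑pick-+ r _ _)) ⟩
    ∑pick m (λ e r → ∑pick r (λ f s → (F e f s + F e (flip f) s) + (F (flip e) f s + F (flip e) (flip f) s)))
      ≡⟨ ∑pick-exchange m _ (λ e f p → cong₂ _+_ (cong₂ _+_ (inv e f p) (inv e (flip f) p)) (cong₂ _+_ (inv (flip e) f p) (inv (flip e) (flip f) p))) ⟩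
    ∑pick m (λ e r → ∑pick r (λ f s → (F f e s + F f (flip e) s) + (F (flip f) e s + F (flip f) (flip e) s)))
      ≡⟨ ∑pick-cong m (λ e r _ → ∑pick-cong r (λ f s _ → solve 4 (λ p q r s → p :+ q :+ (r :+ s) := p :+ r :+ (q :+ s)) refl
           (F f e s) (F f (flip e) s) (F (flip f) e s) (F (flip f) (flip e) s))) ⟩
    ∑pick m (λ e r → ∑pick r (λ f s → (F f e s + F (flip f) e s) + (F f (flip e) s + F (flip f) (flip e) s)))
      ≡⟨ ∑pick-cong m (λ e r _ → ∑pick-+ r _ _) ⟩
    ∑opick m (λ e r → ∑opick r (λ f → F f e)) ∎
    where
    flip : A × A → A × A
    flip e = proj₂ e , proj₁ e

opaque
  unfolding ∑opick

  ∑opick-↭ : {m m' : List (A × A)} {G : A × A → List (A × A) → ℚ} → RInv G → m ↭ m' → ∑opick m G ≡ ∑opick m' G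
  ∑opick-↭ inv p = ∑pick-↭ (λ e q → cong₂ _+_ (inv e q) (inv (proj₂ e , proj₁ e) q)) p

-- Invariance under flips makes the two orientations of a marked edge contribute equally, so the
-- factor of `∑flag-pick` doubles and a fixed orientation remains.
∑flag-opick : ∀ n (xs : List A) {V : List (A × A) → ℚ} → HInv V → (G : A × A → List (A × A) → ℚ) →
              ∑flag (suc n) xs (λ m → V m * ∑opick m G) ≡
              fromℕ (double (suc n)) * ∑edge xs (λ e r → ∑flag n r (λ m → V (e ∷ m) * G e m))
∑flag-opick n xs {V} inv G = begin
  ∑flag (suc n) xs (λ m → V m * ∑opick m G)
    ≡⟨ ∑flag-ext (suc n) (λ m → cong (V m *_) (∑opick-def m G)) ⟩
  ∑flag (suc n) xs (λ m → V m * ∑pick m (λ e r → G e r + G (proj₂ e , proj₁ e) r))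
    ≡⟨ ∑flag-pick n xs {V} (λ {e} {f} → inv (≈-swap e f)) (λ {e} p → inv (≈-prep e (↭⇒≈ p))) (λ e r → G e r + G (proj₂ e , proj₁ e) r) ⟩
  fromℕ (suc n) * ∑edge xs (λ e r → ∑flag n r (λ m → V (e ∷ m) * (G e m + G (proj₂ e , proj₁ e) m)))
    ≡⟨ cong (fromℕ (suc n) *_) (begin
         ∑edge xs (λ e r → ∑flag n r (λ m → V (e ∷ m) * (G e m + G (proj₂ e , proj₁ e) m)))
           ≡⟨ ∑edge-cong xs (λ x y r _ → trans (∑flag-ext n (λ m → trans
                (ℚ.*-distribˡ-+ (V ((x , y) ∷ m)) (G (x , y) m) (G (y , x) m))
                (cong (λ t → V ((x , y) ∷ m) * G (x , y) m + t * G (y , x) m) (inv (≈-flip x y))))) (∑flag-+ n r _ _)) ⟩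
         ∑edge xs (λ e r → ∑flag n r (λ m → V (e ∷ m) * G e m)
           + ∑flag n r (λ m → V ((proj₂ e , proj₁ e) ∷ m) * G (proj₂ e , proj₁ e) m))
           ≡⟨ ∑edge-+ xs _ _ ⟩
         T + ∑edge xs (λ e r → ∑flag n r (λ m → V ((proj₂ e , proj₁ e) ∷ m) * G (proj₂ e , proj₁ e) m))
           ≡⟨ cong (T +_) (∑edge-flip xs (λ e r → ∑flag n r (λ m → V (e ∷ m) * G e m)) (λ e → ∑flag-↭ n _)) ⟨
         T + T ∎) ⟩
  fromℕ (suc n) * (T + T)
    ≡⟨ solve 2 (λ k t → (con 1ℚ :+ k) :* (t :+ t) := (con 1ℚ :+ (con 1ℚ :+ (k :+ k))) :* t) refl (fromℕ n) T ⟩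
  (1ℚ + (1ℚ + (fromℕ n + fromℕ n))) * T
    ≡⟨ cong (λ t → (1ℚ + (1ℚ + t)) * T) (sym (fromℕ-double n)) ⟩
  fromℕ (double (suc n)) * T ∎
  where
  T = ∑edge xs (λ e r → ∑flag n r (λ m → V (e ∷ m) * G e m))

-- Eight times the neighbour sum in the graph of [4,1ⁿ⁻⁴]: an 8-cycle has eight directed starting points.
∑nbr : (Matching → ℚ) → Matching → ℚ
∑nbr V m = ∑opick m (λ e₁ r₁ → ∑opick r₁ (λ e₂ r₂ → ∑opick r₂ (λ e₃ r₃ → ∑opick r₃ (λ e₄ r →
             V (rot (e₁ ∷ e₂ ∷ e₃ ∷ e₄ ∷ r))))))

-- The index is n − 4, and degree is eight times the valency.
degree : ℕ → ℚ
degree j = fromℕ (double (4 ℕ.+ j)) * (fromℕ (double (3 ℕ.+ j)) * (fromℕ (double (2 ℕ.+ j)) * fromℕ (double (1 ℕ.+ j))))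

-- The four chosen oriented edges are moved to the front one after another; each contributes the
-- number of oriented edges still available.
∑flag-∑nbr : ∀ j xs {V W : Matching → ℚ} → HInv V →
             ∑flag (4 ℕ.+ j) xs (λ m → V m * ∑nbr W m) ≡ degree j * rotForm (4 ℕ.+ j) xs V W
∑flag-∑nbr j xs {V} {W} inv = begin
  ∑flag (4 ℕ.+ j) xs (λ m → V m * ∑nbr W m)
    ≡⟨ ∑flag-opick (3 ℕ.+ j) xs inv _ ⟩
  k₄ * ∑edge xs (λ e₁ r₁ → ∑flag (3 ℕ.+ j) r₁ (λ m → V (e₁ ∷ m) * N₃ e₁ m))
    ≡⟨ cong (k₄ *_) (scaled xs k₃ (λ x y r₁ → trans (∑flag-opick (2 ℕ.+ j) r₁ (HInv-∷ inv (x , y)) _)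
         (cong (k₃ *_) (trans (scaled r₁ k₂ (λ z w r₂ → trans (∑flag-opick (1 ℕ.+ j) r₂ (HInv-∷ (HInv-∷ inv (x , y)) (z , w)) _)
           (cong (k₂ *_) (scaled r₂ k₁ (λ u v r₃ → ∑flag-opick j r₃ (HInv-∷ (HInv-∷ (HInv-∷ inv (x , y)) (z , w)) (u , v)) _)))))
           (cong (k₂ *_) (∑edge-*ˡ r₁ k₁ _)))))) ⟩
  k₄ * (k₃ * ∑edge xs (λ e₁ r₁ → k₂ * (k₁ * ∑edge r₁ (λ e₂ r₂ → ∑edge r₂ (λ e₃ r₃ → ∑edge r₃ (λ e₄ r₄ →
    ∑flag j r₄ (λ m → V (e₁ ∷ e₂ ∷ e₃ ∷ e₄ ∷ m) * W (rot (e₁ ∷ e₂ ∷ e₃ ∷ e₄ ∷ m)))))))))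
    ≡⟨ cong (λ t → k₄ * (k₃ * t)) (trans (∑edge-*ˡ xs k₂ _) (cong (k₂ *_) (∑edge-*ˡ xs k₁ _))) ⟩
  k₄ * (k₃ * (k₂ * (k₁ * rotForm (4 ℕ.+ j) xs V W)))
    ≡⟨ solve 5 (λ a b c d r → a :* (b :* (c :* (d :* r))) := a :* (b :* (c :* d)) :* r) refl k₄ k₃ k₂ k₁ (rotForm (4 ℕ.+ j) xs V W) ⟩
  degree j * rotForm (4 ℕ.+ j) xs V W ∎
  where
  k₁ = fromℕ (double (1 ℕ.+ j))
  k₂ = fromℕ (double (2 ℕ.+ j))
  k₃ = fromℕ (double (3 ℕ.+ j))
  k₄ = fromℕ (double (4 ℕ.+ j))
  N₃ : ℕ × ℕ → Matching → ℚ
  N₃ e₁ m = ∑opick m (λ e₂ r₂ → ∑opick r₂ (λ e₃ r₃ → ∑opick r₃ (λ e₄ r → W (rot (e₁ ∷ e₂ ∷ e₃ ∷ e₄ ∷ r)))))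
  scaled : ∀ xs c {G H : ℕ × ℕ → List ℕ → ℚ} → (∀ x y r → G (x , y) r ≡ c * H (x , y) r) → ∑edge xs G ≡ c * ∑edge xs H
  scaled xs c h = trans (∑edge-cong xs (λ x y r _ → h x y r)) (∑edge-*ˡ xs c _)

pairs : List A → List (A × A)
pairs (a ∷ b ∷ l) = (a , b) ∷ pairs l
pairs _           = []

-- Up to order, rot (rot m) is m with its first eight points shifted cyclically by two places.
rotForm-sym : ∀ j xs {V W : Matching → ℚ} → HInv V → HInv W → rotForm (4 ℕ.+ j) xs V W ≡ rotForm (4 ℕ.+ j) xs W V
rotForm-sym j xs {V} {W} invV invW = trans
  (∑tuple-swapsAt (0 ∷ 1 ∷ 2 ∷ 3 ∷ 4 ∷ 5 ∷ 6 ∷ []) 8 {xs} {F V W} (λ l → ∑flag-↭ j _))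
  (∑tuple-cong 8 {xs} {λ l → F V W (swapsAt (0 ∷ 1 ∷ 2 ∷ 3 ∷ 4 ∷ 5 ∷ 6 ∷ []) l)} {F W V} shift)
  where
  F : (Matching → ℚ) → (Matching → ℚ) → List ℕ → List ℕ → ℚ
  F V W l r = ∑flag j r (λ m → V (pairs l ++ m) * W (rot (pairs l ++ m)))
  shift : ∀ l r → length l ≡ 8 → l ++ r ↭ xs → F V W (swapsAt (0 ∷ 1 ∷ 2 ∷ 3 ∷ 4 ∷ 5 ∷ 6 ∷ []) l) r ≡ F W V l r
  shift (a ∷ b ∷ c ∷ d ∷ e ∷ f ∷ g ∷ h ∷ []) r refl _ = ∑flag-ext j (λ m → trans
    (cong (_* W ((a , b) ∷ (c , d) ∷ (e , f) ∷ (g , h) ∷ m)) (invV (↭⇒≈ (Perm.shifts ((h , a) ∷ []) ((b , c) ∷ (d , e) ∷ (f , g) ∷ []) {m}))))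
    (ℚ.*-comm _ (W ((a , b) ∷ (c , d) ∷ (e , f) ∷ (g , h) ∷ m))))

weight : (A × A → ℚ) → List (A × A) → ℚ
weight Y m = ∑ m Y

Symm : (A × A → ℚ) → Set
Symm Y = ∀ a b → Y (a , b) ≡ Y (b , a)

weight-HInv : {Y : A × A → ℚ} → Symm Y → HInv (weight Y)
weight-HInv sy ≈-refl = refl
weight-HInv {Y = Y} sy (≈-prep e p) = trans (∑-∷ e _ _) (trans (cong (Y e +_) (weight-HInv sy p)) (sym (∑-∷ e _ _)))
weight-HInv sy (≈-swap e f) = ∑-↭ _ (swap e f refl)
weight-HInv {Y = Y} sy (≈-flip a b {m}) = trans (∑-∷ (a , b) m Y) (trans (cong (_+ ∑ m Y) (sy a b)) (sym (∑-∷ (b , a) m Y)))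
weight-HInv sy (≈-trans p q) = trans (weight-HInv sy p) (weight-HInv sy q)

∑-flat : (m : List (A × A)) (f : A → ℚ) → ∑ (flat m) f ≡ ∑opick m (λ e _ → f (proj₁ e))
∑-flat []            f = trans (∑-[] f) (sym (trans (∑opick-def [] _) (∑pick-[] _)))
∑-flat ((a , b) ∷ m) f = begin
  ∑ (a ∷ b ∷ flat m) f                              ≡⟨ trans (∑-∷ a _ f) (cong (f a +_) (∑-∷ b _ f)) ⟩
  f a + (f b + ∑ (flat m) f)                        ≡⟨ ℚ.+-assoc (f a) (f b) _ ⟨
  f a + f b + ∑ (flat m) f                          ≡⟨ cong (f a + f b +_) (∑-flat m f) ⟩
  f a + f b + ∑opick m (λ e _ → f (proj₁ e))
    ≡⟨ trans (∑opick-def _ _) (trans (∑pick-∷ (a , b) m _) (cong (f a + f b +_) (sym (∑opick-def m _)))) ⟨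
  ∑opick ((a , b) ∷ m) (λ e _ → f (proj₁ e))        ∎

≈-length : {m m' : List (A × A)} → m ≈ m' → length m ≡ length m'
≈-length ≈-refl        = refl
≈-length (≈-prep e p)  = cong suc (≈-length p)
≈-length (≈-swap e f)  = refl
≈-length (≈-flip a b)  = refl
≈-length (≈-trans p q) = trans (≈-length p) (≈-length q)

length-opick : {e : A × A} {r m : List (A × A)} {n : ℕ} → e ∷ r ≈ m → length m ≡ suc n → length r ≡ n
length-opick p e = cong ℕ.pred (trans (≈-length p) e)

-- Eight times phi1; again the index is n − 4.
eigen : ℕ → ℚ
eigen j = fromℕ (double (2 ℕ.+ j)) * (fromℕ (double (1 ℕ.+ j)) * (fromℕ 4 * (fromℕ j * fromℕ (3 ℕ.+ j) - fromℕ 2)))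

-- For distinct points, the symmetric functions of this kind on the edges of the complete graph form
-- the Specht module of shape [2n-2,2], which belongs to λ = [n-1,1].
RowsVanish : List ℕ → (ℕ × ℕ → ℚ) → Set
RowsVanish xs Y = ∀ x r → x ∷ r ↭ xs → ∑ r (λ y → Y (x , y)) ≡ 0ℚ

module _ (xs : List ℕ) {Y : ℕ × ℕ → ℚ} (sy : Symm Y) (rows : RowsVanish xs Y) where

  private
    quad : List (ℕ × ℕ) → (ℕ × ℕ → ℕ × ℕ → ℕ × ℕ → ℕ × ℕ → ℚ) → ℚ
    quad m F = ∑opick m (λ e₁ r₁ → ∑opick r₁ (λ e₂ r₂ → ∑opick r₂ (λ e₃ r₃ → ∑opick r₃ (λ e₄ _ → F e₁ e₂ e₃ e₄))))

    swap₁₂ : ∀ m F → quad m F ≡ quad m (λ e₁ e₂ → F e₂ e₁)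
    swap₁₂ m F = ∑opick-exchange m (λ e₁ e₂ r₂ → ∑opick r₂ (λ e₃ r₃ → ∑opick r₃ (λ e₄ _ → F e₁ e₂ e₃ e₄)))
      (λ e₁ e₂ p → ∑opick-↭ (λ e₃ q → ∑opick-↭ (λ _ _ → refl) q) p)

    swap₂₃ : ∀ m F → quad m F ≡ quad m (λ e₁ e₂ e₃ → F e₁ e₃ e₂)
    swap₂₃ m F = ∑opick-cong m (λ e₁ r₁ _ → ∑opick-exchange r₁ (λ e₂ e₃ r₃ → ∑opick r₃ (λ e₄ _ → F e₁ e₂ e₃ e₄))
      (λ e₂ e₃ p → ∑opick-↭ (λ _ _ → refl) p))

    swap₃₄ : ∀ m F → quad m F ≡ quad m (λ e₁ e₂ e₃ e₄ → F e₁ e₂ e₄ e₃)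
    swap₃₄ m F = ∑opick-cong m (λ e₁ r₁ _ → ∑opick-cong r₁ (λ e₂ r₂ _ →
      ∑opick-exchange r₂ (λ e₃ e₄ _ → F e₁ e₂ e₃ e₄) (λ _ _ _ → refl)))

    b→a : ℕ × ℕ → ℕ × ℕ → ℚ
    b→a e f = Y (proj₂ e , proj₁ f)

    -- Permuting the four choices shows that the four new edges of `rot` contribute equally.
    cyc₁ : ∀ m → quad m (λ _ e₂ e₃ _ → b→a e₂ e₃) ≡ quad m (λ e₁ e₂ _ _ → b→a e₁ e₂)
    cyc₁ m = trans (swap₁₂ m _) (swap₂₃ m _)

    cyc₂ : ∀ m → quad m (λ _ _ e₃ e₄ → b→a e₃ e₄) ≡ quad m (λ e₁ e₂ _ _ → b→a e₁ e₂)
    cyc₂ m = trans (swap₂₃ m _) (trans (swap₁₂ m _) (trans (swap₃₄ m _) (swap₂₃ m _)))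

    cyc₃ : ∀ m → quad m (λ e₁ _ _ e₄ → b→a e₄ e₁) ≡ quad m (λ e₁ e₂ _ _ → b→a e₁ e₂)
    cyc₃ m = trans (swap₃₄ m _) (trans (swap₂₃ m _) (swap₁₂ m _))

    -- An edge is missing from the remainder only when it is itself chosen, in one of its two
    -- orientations.
    rest : ∀ n m → length m ≡ suc n → ∑opick m (λ _ r → weight Y r) ≡ fromℕ (double n) * weight Y m
    rest n m len = begin
      ∑opick m (λ _ r → weight Y r)
        ≡⟨ ∑opick-cong m (λ e r p → trans
             (solve 2 (λ y w → w := y :+ w :+ con (- 1ℚ) :* y) refl (Y e) (weight Y r))
             (cong (_+ (- 1ℚ) * Y e) (trans (sym (∑-∷ e r Y)) (weight-HInv sy p)))) ⟩
      ∑opick m (λ e _ → weight Y m + (- 1ℚ) * Y e)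
        ≡⟨ trans (∑opick-+ m _ _) (cong₂ _+_ (∑opick-const m (weight Y m)) (∑opick-*ˡ m (- 1ℚ) (λ e _ → Y e))) ⟩
      fromℕ (double (length m)) * weight Y m + (- 1ℚ) * ∑opick m (λ e _ → Y e)
        ≡⟨ cong₂ (λ k s → fromℕ (double k) * weight Y m + (- 1ℚ) * s) len ∑opick-Y ⟩
      (1ℚ + (1ℚ + fromℕ (double n))) * weight Y m + (- 1ℚ) * (weight Y m + weight Y m)
        ≡⟨ solve 2 (λ k w → (con 1ℚ :+ (con 1ℚ :+ k)) :* w :+ con (- 1ℚ) :* (w :+ w) := k :* w) refl (fromℕ (double n)) (weight Y m) ⟩
      fromℕ (double n) * weight Y m ∎
      where
      ∑opick-Y : ∑opick m (λ e _ → Y e) ≡ weight Y m + weight Y m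
      ∑opick-Y = trans (∑opick-def m _) (trans (∑pick-fst m (λ e → Y e + Y (proj₂ e , proj₁ e)))
        (trans (∑-cong m (λ { (a , b) → cong (Y (a , b) +_) (sy b a) })) (∑-+ m Y Y)))

    -- For a fixed edge {a,b} the other end of the new edge at b runs over all points except a and
    -- b, so the vanishing row of b leaves -Y (b , a).
    adjacent : ∀ m → flat m ↭ xs → ∑opick m (λ e r → ∑opick r (λ f _ → b→a e f)) ≡ (- fromℕ 2) * weight Y m
    adjacent m full = begin
      ∑opick m (λ e r → ∑opick r (λ f _ → b→a e f))
        ≡⟨ ∑opick-cong m (λ { (a , b) r p → begin
             ∑opick r (λ f _ → Y (b , proj₁ f))
               ≡⟨ ∑-flat r (λ y → Y (b , y)) ⟨
             ∑ (flat r) (λ y → Y (b , y))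
               ≡⟨ solve 2 (λ y s → s := y :+ s :+ con (- 1ℚ) :* y) refl (Y (b , a)) _ ⟩
             Y (b , a) + ∑ (flat r) (λ y → Y (b , y)) + (- 1ℚ) * Y (b , a)
               ≡⟨ cong₂ (λ s t → s + (- 1ℚ) * t) (trans (sym (∑-∷ a (flat r) _)) (rows b (a ∷ flat r)
                    (↭-trans (swap b a refl) (↭-trans (flat-≈ p) full)))) (sy b a) ⟩
             0ℚ + (- 1ℚ) * Y (a , b)
               ≡⟨ ℚ.+-identityˡ _ ⟩
             (- 1ℚ) * Y (a , b) ∎ }) ⟩
      ∑opick m (λ e _ → (- 1ℚ) * Y e)
        ≡⟨ ∑opick-def m _ ⟩
      ∑pick m (λ e _ → (- 1ℚ) * Y e + (- 1ℚ) * Y (proj₂ e , proj₁ e))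
        ≡⟨ trans (∑pick-fst m _) (∑-cong m (λ { (a , b) → trans (cong (λ t → (- 1ℚ) * Y (a , b) + (- 1ℚ) * t) (sy b a))
             (solve 1 (λ y → con (- 1ℚ) :* y :+ con (- 1ℚ) :* y := (:- con (fromℕ 2)) :* y) refl (Y (a , b))) })) ⟩
      ∑ m (λ e → (- fromℕ 2) * Y e)
        ≡⟨ ∑-*ˡ (- fromℕ 2) m Y ⟩
      (- fromℕ 2) * weight Y m ∎

    pairs₃₄ : ∀ j m (f : ℕ × ℕ → ℕ × ℕ → ℚ) → length m ≡ 4 ℕ.+ j →
              quad m (λ e₁ e₂ _ _ → f e₁ e₂) ≡
              fromℕ (double (2 ℕ.+ j)) * (fromℕ (double (1 ℕ.+ j)) * ∑opick m (λ e₁ r₁ → ∑opick r₁ (λ e₂ _ → f e₁ e₂)))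
    pairs₃₄ j m f len = begin
      quad m (λ e₁ e₂ _ _ → f e₁ e₂)
        ≡⟨ ∑opick-cong m (λ e₁ r₁ p₁ → trans (∑opick-cong r₁ (λ e₂ r₂ p₂ →
             let l₂ = length-opick p₂ (length-opick p₁ len) in
             trans (∑opick-cong r₂ (λ e₃ r₃ p₃ → trans (∑opick-const r₃ (f e₁ e₂)) (cong (λ k → fromℕ (double k) * f e₁ e₂) (length-opick p₃ l₂))))
               (trans (∑opick-const r₂ _) (cong (λ k → fromℕ (double k) * (k₁ * f e₁ e₂)) l₂))))
             (trans (∑opick-*ˡ r₁ k₂ _) (cong (k₂ *_) (∑opick-*ˡ r₁ k₁ _)))) ⟩
      ∑opick m (λ e₁ r₁ → k₂ * (k₁ * ∑opick r₁ (λ e₂ _ → f e₁ e₂)))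
        ≡⟨ trans (∑opick-*ˡ m k₂ _) (cong (k₂ *_) (∑opick-*ˡ m k₁ _)) ⟩
      k₂ * (k₁ * ∑opick m (λ e₁ r₁ → ∑opick r₁ (λ e₂ _ → f e₁ e₂))) ∎
      where
      k₁ = fromℕ (double (1 ℕ.+ j))
      k₂ = fromℕ (double (2 ℕ.+ j))

    rests : ∀ j m → length m ≡ 4 ℕ.+ j →
            ∑opick m (λ e₁ r₁ → ∑opick r₁ (λ e₂ r₂ → ∑opick r₂ (λ e₃ r₃ → ∑opick r₃ (λ e₄ r → weight Y r)))) ≡
            fromℕ (double j) * (fromℕ (double (1 ℕ.+ j)) * (fromℕ (double (2 ℕ.+ j)) * (fromℕ (double (3 ℕ.+ j)) * weight Y m)))
    rests j m l = trans (∑opick-cong m (λ e₁ r₁ p₁ → let l₁ = length-opick p₁ l in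
        trans (∑opick-cong r₁ (λ e₂ r₂ p₂ → let l₂ = length-opick p₂ l₁ in
          trans (∑opick-cong r₂ (λ e₃ r₃ p₃ → rest j r₃ (length-opick p₃ l₂)))
            (trans (∑opick-*ˡ r₂ k₀ _) (cong (k₀ *_) (rest (1 ℕ.+ j) r₂ l₂)))))
          (trans (∑opick-*ˡ r₁ k₀ _) (cong (k₀ *_) (trans (∑opick-*ˡ r₁ k₁ _) (cong (k₁ *_) (rest (2 ℕ.+ j) r₁ l₁)))))))
      (trans (∑opick-*ˡ m k₀ _) (cong (k₀ *_) (trans (∑opick-*ˡ m k₁ _) (cong (k₁ *_)
        (trans (∑opick-*ˡ m k₂ _) (cong (k₂ *_) (rest (3 ℕ.+ j) m l)))))))
      where
      k₀ = fromℕ (double j)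
      k₁ = fromℕ (double (1 ℕ.+ j))
      k₂ = fromℕ (double (2 ℕ.+ j))

  -- The four new edges contribute -2 k₁ k₂ each and the kept edges contribute k₀ k₁ k₂ k₃; with k₀
  -- k₃ = 4 j (j + 3) the factor is `eigen j`.
  ∑nbr-weight : ∀ j m → length m ≡ 4 ℕ.+ j → flat m ↭ xs → ∑nbr (weight Y) m ≡ eigen j * weight Y m
  ∑nbr-weight j m len full = begin
    ∑nbr (weight Y) m
      ≡⟨ ∑opick-cong m (λ e₁ r₁ _ → ∑opick-cong r₁ (λ e₂ r₂ _ → ∑opick-cong r₂ (λ e₃ r₃ _ → ∑opick-cong r₃ (λ e₄ r _ →
           trans (∑-∷ _ _ Y) (cong (b→a e₁ e₂ +_) (trans (∑-∷ _ _ Y) (cong (b→a e₂ e₃ +_)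
             (trans (∑-∷ _ _ Y) (cong (b→a e₃ e₄ +_) (∑-∷ _ _ Y))))))))))  ⟩
    ∑opick m (λ e₁ r₁ → ∑opick r₁ (λ e₂ r₂ → ∑opick r₂ (λ e₃ r₃ → ∑opick r₃ (λ e₄ r →
      b→a e₁ e₂ + (b→a e₂ e₃ + (b→a e₃ e₄ + (b→a e₄ e₁ + weight Y r)))))))
      ≡⟨ trans (quad-+ (λ e₁ e₂ _ _ _ → b→a e₁ e₂) (λ e₁ e₂ e₃ e₄ r → b→a e₂ e₃ + (b→a e₃ e₄ + (b→a e₄ e₁ + weight Y r))))
           (cong (D +_) (trans (quad-+ (λ _ e₂ e₃ _ _ → b→a e₂ e₃) (λ e₁ e₂ e₃ e₄ r → b→a e₃ e₄ + (b→a e₄ e₁ + weight Y r)))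
             (cong₂ _+_ (cyc₁ m) (trans (quad-+ (λ _ _ e₃ e₄ _ → b→a e₃ e₄) (λ e₁ e₂ e₃ e₄ r → b→a e₄ e₁ + weight Y r))
               (cong₂ _+_ (cyc₂ m) (trans (quad-+ (λ e₁ _ _ e₄ _ → b→a e₄ e₁) (λ _ _ _ _ r → weight Y r))
                 (cong₂ _+_ (cyc₃ m) (rests j m len)))))))) ⟩
    D + (D + (D + (D + k₀ * (k₁ * (k₂ * (k₃ * w))))))
      ≡⟨ cong (λ d → d + (d + (d + (d + k₀ * (k₁ * (k₂ * (k₃ * w)))))))
           (trans (pairs₃₄ j m b→a len) (cong (λ t → k₂ * (k₁ * t)) (adjacent m full))) ⟩
    d + (d + (d + (d + k₀ * (k₁ * (k₂ * (k₃ * w))))))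
      ≡⟨ cong₂ (λ s t → d + (d + (d + (d + s * (k₁ * (k₂ * (t * w))))))) (fromℕ-double j) (fromℕ-double (3 ℕ.+ j)) ⟩
    d + (d + (d + (d + (fromℕ j + fromℕ j) * (k₁ * (k₂ * ((fromℕ (3 ℕ.+ j) + fromℕ (3 ℕ.+ j)) * w))))))
      ≡⟨ solve 5 (λ k₁ k₂ a b w →
           let d = k₂ :* (k₁ :* ((:- con (fromℕ 2)) :* w)) in
           d :+ (d :+ (d :+ (d :+ (a :+ a) :* (k₁ :* (k₂ :* ((b :+ b) :* w))))))
           := k₂ :* (k₁ :* (con (fromℕ 4) :* (a :* b :- con (fromℕ 2)))) :* w) refl k₁ k₂ (fromℕ j) (fromℕ (3 ℕ.+ j)) w ⟩
    eigen j * weight Y m ∎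
    where
    w  = weight Y m
    k₀ = fromℕ (double j)
    k₁ = fromℕ (double (1 ℕ.+ j))
    k₂ = fromℕ (double (2 ℕ.+ j))
    k₃ = fromℕ (double (3 ℕ.+ j))
    D  = quad m (λ e₁ e₂ _ _ → b→a e₁ e₂)
    d  = k₂ * (k₁ * ((- fromℕ 2) * w))
    quad-+ : ∀ (F G : ℕ × ℕ → ℕ × ℕ → ℕ × ℕ → ℕ × ℕ → List (ℕ × ℕ) → ℚ) →
      ∑opick m (λ e₁ r₁ → ∑opick r₁ (λ e₂ r₂ → ∑opick r₂ (λ e₃ r₃ → ∑opick r₃ (λ e₄ r → F e₁ e₂ e₃ e₄ r + G e₁ e₂ e₃ e₄ r)))) ≡
      ∑opick m (λ e₁ r₁ → ∑opick r₁ (λ e₂ r₂ → ∑opick r₂ (λ e₃ r₃ → ∑opick r₃ (λ e₄ r → F e₁ e₂ e₃ e₄ r)))) +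
      ∑opick m (λ e₁ r₁ → ∑opick r₁ (λ e₂ r₂ → ∑opick r₂ (λ e₃ r₃ → ∑opick r₃ (λ e₄ r → G e₁ e₂ e₃ e₄ r))))
    quad-+ F G = trans (∑opick-cong m (λ e₁ r₁ _ → trans (∑opick-cong r₁ (λ e₂ r₂ _ →
        trans (∑opick-cong r₂ (λ e₃ r₃ _ → ∑opick-+ r₃ (F e₁ e₂ e₃) (G e₁ e₂ e₃))) (∑opick-+ r₂ _ _))) (∑opick-+ r₁ _ _))) (∑opick-+ m _ _)

-- The spectral bound by induction on n

fromℕ-nonneg : ∀ n → 0ℚ ≤ℚ fromℕ n
fromℕ-nonneg zero    = ℚ.≤-refl
fromℕ-nonneg (suc n) = +-nonneg (toWitness {a? = 0ℚ ℚ.≤? 1ℚ} _) (fromℕ-nonneg n)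

0<1 : 0ℚ ℚ.< 1ℚ
0<1 = toWitness {a? = 0ℚ ℚ.<? 1ℚ} _

fromℕ-pos : ∀ n → 0ℚ ℚ.< fromℕ (suc n)
fromℕ-pos n = ℚ.<-≤-trans 0<1 (≤-from-diff (fromℕ n) (fromℕ-nonneg n) refl)

*-pos : ∀ {a b} → 0ℚ ℚ.< a → 0ℚ ℚ.< b → 0ℚ ℚ.< a * b
*-pos {a} {b} p q = subst (ℚ._< a * b) (ℚ.*-zeroʳ a) (ℚ.*-monoʳ-<-pos a ⦃ ℚ.positive p ⦄ q)

cnt-pos : ∀ n → 0ℚ ℚ.< cnt n
cnt-pos zero    = 0<1
cnt-pos (suc n) = *-pos (fromℕ-pos (suc (double n))) (*-pos (fromℕ-pos (double n)) (cnt-pos n))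

*-cancel-zero : ∀ {c x} → 0ℚ ℚ.< c → c * x ≡ 0ℚ → x ≡ 0ℚ
*-cancel-zero {c} {x} p e = ℚ.≤-antisym
  (ℚ.*-cancelˡ-≤-pos c ⦃ ℚ.positive p ⦄ (ℚ.≤-reflexive (trans e (sym (ℚ.*-zeroʳ c)))))
  (ℚ.*-cancelˡ-≤-pos c ⦃ ℚ.positive p ⦄ (ℚ.≤-reflexive (trans (ℚ.*-zeroʳ c) (sym e))))

*-cancel-≤ : ∀ {c x y} → 0ℚ ℚ.< c → c * x ≤ℚ c * y → x ≤ℚ y
*-cancel-≤ {c} p = ℚ.*-cancelˡ-≤-pos c ⦃ ℚ.positive p ⦄

*-mono-nonneg : ∀ {c x y} → 0ℚ ≤ℚ c → x ≤ℚ y → c * x ≤ℚ c * y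
*-mono-nonneg {c} p = ℚ.*-monoˡ-≤-nonNeg c ⦃ ℚ.nonNegative p ⦄

removeElem-comm : ∀ a b l → removeElem a (removeElem b l) ≡ removeElem b (removeElem a l)
removeElem-comm a b []      = refl
removeElem-comm a b (z ∷ l) with b ≡ᵇ z in p | a ≡ᵇ z in q
... | true  | true  rewrite ≡ᵇ-true {b} p | ≡ᵇ-true {a} q = refl
... | true  | false rewrite p = refl
... | false | true  rewrite q = refl
... | false | false rewrite p | q = cong (z ∷_) (removeElem-comm a b l)

removeElem-rest : ∀ {x r xs} → x ∷ r ↭ xs → r ↭ removeElem x xs
removeElem-rest p = Perm.drop-∷ (↭-trans p (↭-sym (removeElem-↭ (Perm.∈-resp-↭ p (here refl)))))

Bound : ℕ → ℚ → Set
Bound j c = ∀ {xs} → length xs ≡ double (4 ℕ.+ j) → ∀ {V} → HInv V → ∑flag (4 ℕ.+ j) xs V ≡ 0ℚ →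
            degree j * rotForm (4 ℕ.+ j) xs V V ≤ℚ c * inner (4 ℕ.+ j) xs V V

rot-∷ʳ : ∀ j m e → length m ≡ 4 ℕ.+ j → rot (m ∷ʳ e) ≡ rot m ∷ʳ e
rot-∷ʳ j (_ ∷ _ ∷ _ ∷ _ ∷ m) e refl = refl

-- V splits into a function of the form weight Y, on which ∑nbr acts by the scalar eigen, and a function U
-- with vanishing sum over the flags through any given edge; to the latter the bound for n − 1 applies.
module Step (j : ℕ) {xs : List ℕ} (len : length xs ≡ double (5 ℕ.+ j)) {V : Matching → ℚ} (inv : HInv V)
            (sum0 : ∑flag (5 ℕ.+ j) xs V ≡ 0ℚ) where

  k n : ℕ
  k = 4 ℕ.+ j
  n = 5 ℕ.+ j

  -- The sum of `V` over the flags through an edge. Deleting the endpoints by `removeElem` makes it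
  -- a function of the edge alone, independent of how the remaining points are arranged.
  Y : ℕ × ℕ → ℚ
  Y e = ∑flag k (removeElem (proj₂ e) (removeElem (proj₁ e) xs)) (λ m → V (e ∷ m))

  Y-sym : Symm Y
  Y-sym a b = trans (cong (λ l → ∑flag k l (λ m → V ((a , b) ∷ m))) (removeElem-comm b a xs))
    (∑flag-ext k {V = λ m → V ((a , b) ∷ m)} {λ m → V ((b , a) ∷ m)} (λ m → inv (≈-flip a b)))

  Y-marginal : ∀ x y r → x ∷ y ∷ r ↭ xs → ∑flag k r (λ m → V ((x , y) ∷ m)) ≡ Y (x , y)
  Y-marginal x y r p = ∑flag-↭ k (λ m → V ((x , y) ∷ m)) (removeElem-rest (removeElem-rest p))

  -- Every flag reaches `x`, so the row of `x` is proportional to the total of `V`.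
  rows : RowsVanish xs Y
  rows x r p = *-cancel-zero (fromℕ-pos (suc (double k))) (begin
    fromℕ (double n) * ∑ r (λ y → Y (x , y))
      ≡⟨ cong (fromℕ (double n) *_) (trans (sym (∑pick-fst r _))
           (∑pick-cong r (λ y s q → sym (Y-marginal x y s (↭-trans (prep x q) p))))) ⟩
    fromℕ (double n) * ∑pick r (λ y s → ∑flag k s (λ m → V ((x , y) ∷ m)))
      ≡⟨ ∑flag-head k x r inv (cong ℕ.pred (trans (Perm.↭-length p) len)) ⟨
    ∑flag n (x ∷ r) V
      ≡⟨ trans (∑flag-↭ n V p) sum0 ⟩
    0ℚ ∎)

  W : Matching → ℚ
  W = weight Y

  W-inv : HInv W
  W-inv = weight-HInv Y-sym

  ∑edge-Y : List ℕ → ℚ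
  ∑edge-Y l = ∑edge l (λ e _ → Y e)

  ∑edge-Y-∷ : ∀ x l → ∑edge-Y (x ∷ l) ≡ ∑ l (λ y → Y (x , y)) + (∑ l (λ y → Y (x , y)) + ∑edge-Y l)
  ∑edge-Y-∷ x l = trans (∑pick-∷ x l _) (cong₂ _+_ (∑pick-fst l _)
    (trans (∑pick-cong l (λ a s _ → ∑pick-∷ x s _)) (trans (∑pick-+ l _ _)
      (cong (_+ ∑edge-Y l) (trans (∑pick-fst l _) (∑-cong l (λ a → Y-sym a x)))))))

  -- Inclusion and exclusion: the total and the rows of `x` and `y` vanish, and only the pair {x,y}
  -- lies in both rows.
  ∑edge-Y-rest : ∀ x y r → x ∷ y ∷ r ↭ xs → ∑edge-Y r ≡ fromℕ 2 * Y (x , y)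
  ∑edge-Y-rest x y r p = begin
    ∑edge-Y r
      ≡⟨ solve 3 (λ e s z → e := (con 0ℚ :+ (con 0ℚ :+ (s :+ (s :+ e)))) :+ (con (fromℕ 2) :* z :+ (:- con (fromℕ 2)) :* (z :+ s)))
           refl (∑edge-Y r) s (Y (y , x)) ⟩
    (0ℚ + (0ℚ + (s + (s + ∑edge-Y r)))) + (fromℕ 2 * Y (y , x) + (- fromℕ 2) * (Y (y , x) + s))
      ≡⟨ cong₂ _+_ total (cong₂ (λ a b → fromℕ 2 * a + (- fromℕ 2) * b) (Y-sym y x)
           (trans (sym (∑-∷ x r _)) (rows y (x ∷ r) (↭-trans (swap y x refl) p)))) ⟩
    0ℚ + (fromℕ 2 * Y (x , y) + (- fromℕ 2) * 0ℚ)
      ≡⟨ solve 1 (λ z → con 0ℚ :+ (con (fromℕ 2) :* z :+ (:- con (fromℕ 2)) :* con 0ℚ) := con (fromℕ 2) :* z) refl (Y (x , y)) ⟩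
    fromℕ 2 * Y (x , y) ∎
    where
    s = ∑ r (λ z → Y (y , z))
    row-x : ∑ (y ∷ r) (λ z → Y (x , z)) ≡ 0ℚ
    row-x = rows x (y ∷ r) p
    total : 0ℚ + (0ℚ + (s + (s + ∑edge-Y r))) ≡ 0ℚ
    total = begin
      0ℚ + (0ℚ + (s + (s + ∑edge-Y r)))   ≡⟨ cong (λ t → 0ℚ + (0ℚ + t)) (∑edge-Y-∷ y r) ⟨
      0ℚ + (0ℚ + ∑edge-Y (y ∷ r))         ≡⟨ cong (λ t → t + (t + ∑edge-Y (y ∷ r))) row-x ⟨
      ∑ (y ∷ r) (λ z → Y (x , z)) + (∑ (y ∷ r) (λ z → Y (x , z)) + ∑edge-Y (y ∷ r))
                                          ≡⟨ ∑edge-Y-∷ x (y ∷ r) ⟨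
      ∑edge-Y (x ∷ y ∷ r)                 ≡⟨ ∑edge-↭ (λ _ _ → refl) p ⟩
      ∑edge-Y xs                          ≡⟨ ∑pick-zero xs (λ a r q → trans (∑pick-fst r _) (rows a r q)) ⟩
      0ℚ ∎

  -- The factor by which `Y` is multiplied when `weight Y` is again summed over the flags through an
  -- edge: the edge itself gives `cnt k`, the other edges give the second term through
  -- `∑edge-Y-rest`.
  κ : ℚ
  κ = cnt k + fromℕ k * (cnt (3 ℕ.+ j) * fromℕ 2)

  κ-pos : 0ℚ ℚ.< κ
  κ-pos = ℚ.+-mono-< (cnt-pos k) (*-pos (fromℕ-pos (3 ℕ.+ j)) (*-pos (cnt-pos (3 ℕ.+ j)) (fromℕ-pos 1)))

  ∑flag-W : ∀ x y r → x ∷ y ∷ r ↭ xs → ∑flag k r (λ m → W ((x , y) ∷ m)) ≡ κ * Y (x , y)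
  ∑flag-W x y r p = begin
    ∑flag k r (λ m → W ((x , y) ∷ m))
      ≡⟨ trans (∑flag-ext k {V' = λ m → Y (x , y) + W m} (λ m → ∑-∷ (x , y) m Y)) (∑flag-+ k r (λ _ → Y (x , y)) W) ⟩
    ∑flag k r (λ _ → Y (x , y)) + ∑flag k r W
      ≡⟨ cong₂ _+_ (∑flag-const k r (Y (x , y)) lr) (begin
           ∑flag k r W
             ≡⟨ ∑flag-ext k (λ m → trans (sym (∑pick-fst m Y)) (sym (ℚ.*-identityˡ _))) ⟩
           ∑flag k r (λ m → 1ℚ * ∑pick m (λ e _ → Y e))
             ≡⟨ ∑flag-pick (3 ℕ.+ j) r {λ _ → 1ℚ} refl (λ _ → refl) (λ e _ → Y e) ⟩
           fromℕ k * ∑edge r (λ e s → ∑flag (3 ℕ.+ j) s (λ m → 1ℚ * Y e))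
             ≡⟨ cong (fromℕ k *_) (trans (∑edge-cong r (λ a b s q →
                  trans (∑flag-const (3 ℕ.+ j) s _ (length-edge q lr)) (cong (cnt (3 ℕ.+ j) *_) (ℚ.*-identityˡ (Y (a , b))))))
                  (∑edge-*ˡ r (cnt (3 ℕ.+ j)) _)) ⟩
           fromℕ k * (cnt (3 ℕ.+ j) * ∑edge-Y r)
             ≡⟨ cong (λ t → fromℕ k * (cnt (3 ℕ.+ j) * t)) (∑edge-Y-rest x y r p) ⟩
           fromℕ k * (cnt (3 ℕ.+ j) * (fromℕ 2 * Y (x , y))) ∎) ⟩
    cnt k * Y (x , y) + fromℕ k * (cnt (3 ℕ.+ j) * (fromℕ 2 * Y (x , y)))
      ≡⟨ solve 4 (λ a b c y → a :* y :+ b :* (c :* (con (fromℕ 2) :* y)) := (a :+ b :* (c :* con (fromℕ 2))) :* y)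
           refl (cnt k) (fromℕ k) (cnt (3 ℕ.+ j)) (Y (x , y)) ⟩
    κ * Y (x , y) ∎
    where lr = length-edge p len

  -- `κ` times the component of `V` orthogonal to the edge weights; the scaling avoids division.
  U : Matching → ℚ
  U m = κ * V m + (- 1ℚ) * W m

  U-inv : HInv U
  U-inv p = cong₂ (λ a b → κ * a + (- 1ℚ) * b) (inv p) (W-inv p)

  U-marginal : ∀ x y r → x ∷ y ∷ r ↭ xs → ∑flag k r (λ m → U ((x , y) ∷ m)) ≡ 0ℚ
  U-marginal x y r p = begin
    ∑flag k r (λ m → U ((x , y) ∷ m))
      ≡⟨ trans (∑flag-+ k r (λ m → κ * V ((x , y) ∷ m)) (λ m → (- 1ℚ) * W ((x , y) ∷ m)))
           (cong₂ _+_ (∑flag-*ˡ k κ r (λ m → V ((x , y) ∷ m))) (∑flag-*ˡ k (- 1ℚ) r (λ m → W ((x , y) ∷ m)))) ⟩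
    κ * ∑flag k r (λ m → V ((x , y) ∷ m)) + (- 1ℚ) * ∑flag k r (λ m → W ((x , y) ∷ m))
      ≡⟨ cong₂ (λ a b → κ * a + (- 1ℚ) * b) (Y-marginal x y r p) (∑flag-W x y r p) ⟩
    κ * Y (x , y) + (- 1ℚ) * (κ * Y (x , y))
      ≡⟨ solve 1 (λ t → t :+ con (- 1ℚ) :* t := con 0ℚ) refl (κ * Y (x , y)) ⟩
    0ℚ ∎

  -- As `W` is a sum over edges, its inner product with `U` involves only the sums of `U` through
  -- single edges.
  ⟨U,W⟩ : inner n xs U W ≡ 0ℚ
  ⟨U,W⟩ = begin
    ∑flag n xs (λ m → U m * W m)
      ≡⟨ ∑flag-ext n (λ m → cong (U m *_) (sym (∑pick-fst m Y))) ⟩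
    ∑flag n xs (λ m → U m * ∑pick m (λ e _ → Y e))
      ≡⟨ ∑flag-pick k xs {U} (λ {e} {f} → U-inv (≈-swap e f)) (λ {e} p → U-inv (≈-prep e (↭⇒≈ p))) (λ e _ → Y e) ⟩
    fromℕ n * ∑edge xs (λ e r → ∑flag k r (λ m → U (e ∷ m) * Y e))
      ≡⟨ cong (fromℕ n *_) (∑edge-zero xs (λ x y r p → trans
           (trans (∑flag-ext k {V' = λ m → Y (x , y) * U ((x , y) ∷ m)} (λ m → ℚ.*-comm (U ((x , y) ∷ m)) (Y (x , y))))
             (∑flag-*ˡ k (Y (x , y)) r (λ m → U ((x , y) ∷ m))))
           (trans (cong (Y (x , y) *_) (U-marginal x y r p)) (ℚ.*-zeroʳ (Y (x , y)))))) ⟩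
    fromℕ n * 0ℚ
      ≡⟨ ℚ.*-zeroʳ (fromℕ n) ⟩
    0ℚ ∎

  form : (Matching → ℚ) → (Matching → ℚ) → ℚ
  form A B = degree (1 ℕ.+ j) * rotForm n xs A B

  form-W : ∀ {A} → HInv A → form A W ≡ eigen (1 ℕ.+ j) * inner n xs A W
  form-W {A} invA = begin
    form A W                                               ≡⟨ ∑flag-∑nbr (1 ℕ.+ j) xs {A} {W} invA ⟨
    ∑flag n xs (λ m → A m * ∑nbr W m)                      ≡⟨ ∑flag-cong n len (λ m l p → trans
      (cong (A m *_) (∑nbr-weight xs Y-sym rows (1 ℕ.+ j) m l p))
      (solve 3 (λ a e w → a :* (e :* w) := e :* (a :* w)) refl (A m) (eigen (1 ℕ.+ j)) (W m))) ⟩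
    ∑flag n xs (λ m → eigen (1 ℕ.+ j) * (A m * W m))       ≡⟨ ∑flag-*ˡ n (eigen (1 ℕ.+ j)) xs (λ m → A m * W m) ⟩
    eigen (1 ℕ.+ j) * inner n xs A W ∎

  -- Both mixed terms are multiples of `⟨U,W⟩`: one because `W` is an eigenvector, the other by
  -- symmetry of the form.
  form-split : (κ * κ) * form V V ≡ form U U + eigen (1 ℕ.+ j) * inner n xs W W
  form-split = begin
    (κ * κ) * (d * rotForm n xs V V)
      ≡⟨ solve 3 (λ k d r → k :* (d :* r) := d :* (k :* r)) refl (κ * κ) d (rotForm n xs V V) ⟩
    d * ((κ * κ) * rotForm n xs V V)
      ≡⟨ cong (d *_) (trans (sym (∑flag-*ˡ n (κ * κ) xs (λ m → V m * V (rot m)))) (trans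
           (∑flag-ext n {V' = λ m → UU m + (UW m + (WU m + WW m))} (λ m → solve 5 (λ k v w v' w' → (k :* k) :* (v :* v') :=
              let u = k :* v :+ con (- 1ℚ) :* w ; u' = k :* v' :+ con (- 1ℚ) :* w' in
              u :* u' :+ (u :* w' :+ (w :* u' :+ w :* w'))) refl κ (V m) (W m) (V (rot m)) (W (rot m))))
           (trans (∑flag-+ n xs UU (λ m → UW m + (WU m + WW m))) (cong (rotForm n xs U U +_)
             (trans (∑flag-+ n xs UW (λ m → WU m + WW m)) (cong (rotForm n xs U W +_) (∑flag-+ n xs WU WW))))))) ⟩
    d * (rotForm n xs U U + (rotForm n xs U W + (rotForm n xs W U + rotForm n xs W W)))
      ≡⟨ solve 5 (λ d p q r s → d :* (p :+ (q :+ (r :+ s))) := d :* p :+ (d :* q :+ (d :* r :+ d :* s))) refl d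
           (rotForm n xs U U) (rotForm n xs U W) (rotForm n xs W U) (rotForm n xs W W) ⟩
    form U U + (form U W + (form W U + form W W))
      ≡⟨ cong (form U U +_) (cong₂ _+_ (trans (form-W U-inv) (cong (e *_) ⟨U,W⟩)) (cong₂ _+_
           (trans (cong (d *_) (rotForm-sym (1 ℕ.+ j) xs W-inv U-inv)) (trans (form-W U-inv) (cong (e *_) ⟨U,W⟩))) (form-W W-inv))) ⟩
    form U U + (e * 0ℚ + (e * 0ℚ + e * inner n xs W W))
      ≡⟨ cong (form U U +_) (solve 2 (λ e i → e :* con 0ℚ :+ (e :* con 0ℚ :+ e :* i) := e :* i) refl e (inner n xs W W)) ⟩
    form U U + e * inner n xs W W ∎
    where
    d = degree (1 ℕ.+ j)
    e = eigen (1 ℕ.+ j)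
    UU UW WU WW : Matching → ℚ
    UU m = U m * U (rot m)
    UW m = U m * W (rot m)
    WU m = W m * U (rot m)
    WW m = W m * W (rot m)

  inner-split : (κ * κ) * inner n xs V V ≡ inner n xs U U + inner n xs W W
  inner-split = begin
    (κ * κ) * inner n xs V V
      ≡⟨ trans (sym (∑flag-*ˡ n (κ * κ) xs (λ m → V m * V m))) (trans
           (∑flag-ext n {V' = λ m → UU m + (WW m + fromℕ 2 * UW m)} (λ m → solve 3 (λ k v w → (k :* k) :* (v :* v) :=
              let u = k :* v :+ con (- 1ℚ) :* w in u :* u :+ (w :* w :+ con (fromℕ 2) :* (u :* w))) refl κ (V m) (W m)))
           (trans (∑flag-+ n xs UU (λ m → WW m + fromℕ 2 * UW m)) (cong (inner n xs U U +_)
             (trans (∑flag-+ n xs WW (λ m → fromℕ 2 * UW m)) (cong (inner n xs W W +_) (∑flag-*ˡ n (fromℕ 2) xs UW)))))) ⟩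
    inner n xs U U + (inner n xs W W + fromℕ 2 * inner n xs U W)
      ≡⟨ cong (λ t → inner n xs U U + (inner n xs W W + fromℕ 2 * t)) ⟨U,W⟩ ⟩
    inner n xs U U + (inner n xs W W + 0ℚ)
      ≡⟨ cong (inner n xs U U +_) (ℚ.+-identityʳ _) ⟩
    inner n xs U U + inner n xs W W ∎
    where
    UU UW WW : Matching → ℚ
    UU m = U m * U m
    UW m = U m * W m
    WW m = W m * W m

  -- The last of the at least five edges is common to `m` and `rot m`. With that edge fixed, the
  -- form for n - 1 of the restricted function remains.
  rotForm-U : rotForm n xs U U ≡ ∑edge xs (λ e r → rotForm k r (λ m → U (e ∷ m)) (λ m → U (e ∷ m)))
  rotForm-U = trans (∑flag-snoc k xs (λ m → U m * U (rot m))) (∑edge-cong xs (λ x y r p →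
    ∑flag-cong k (length-edge p len) {λ m → U (m ∷ʳ (x , y)) * U (rot (m ∷ʳ (x , y)))} {λ m → U ((x , y) ∷ m) * U ((x , y) ∷ rot m)}
      (λ m l _ → cong₂ _*_ (to-front (x , y) m) (trans (cong U (rot-∷ʳ j m (x , y) l)) (to-front (x , y) (rot m))))))
    where
    to-front : ∀ e m → U (m ∷ʳ e) ≡ U (e ∷ m)
    to-front e m = U-inv (↭⇒≈ (↭-sym (Perm.∷↭∷ʳ e m)))

  -- The restrictions are bounded with `degree j`, and `degree (1 + j)` is n/(n - 4) times as large;
  -- this is the ratio in the hypothesis on `c` and `c'`.
  bound-U : ∀ {c c'} → Bound j c → fromℕ n * c ≤ℚ fromℕ (1 ℕ.+ j) * c' → form U U ≤ℚ c' * inner n xs U U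
  bound-U {c} {c'} bound hc = *-cancel-≤ (fromℕ-pos j) (subst₂ _≤ℚ_
    (sym (trans (cong (λ t → fromℕ (1 ℕ.+ j) * (degree (1 ℕ.+ j) * t)) rotForm-U) (degree-step _)))
    (ℚ.*-assoc (fromℕ (1 ℕ.+ j)) c' (inner n xs U U))
    (ℚ.≤-trans
      (*-mono-nonneg (fromℕ-nonneg n) (subst₂ _≤ℚ_ (∑edge-*ˡ xs (degree j) _) (∑edge-*ˡ xs c _)
        (∑edge-mono xs (λ x y r p → bound (length-edge p len) (HInv-∷ U-inv (x , y)) (U-marginal x y r p)))))
      (subst (_≤ℚ fromℕ (1 ℕ.+ j) * c' * inner n xs U U) (ℚ.*-assoc (fromℕ n) c (inner n xs U U))
        (ℚ.*-monoʳ-≤-nonNeg (inner n xs U U) ⦃ ℚ.nonNegative (∑flag-nonneg n (λ m → square-nonneg (U m))) ⦄ hc))))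
    where
    degree-step : ∀ t → fromℕ (1 ℕ.+ j) * (degree (1 ℕ.+ j) * t) ≡ fromℕ n * (degree j * t)
    degree-step t rewrite fromℕ-double j = solve 2 (λ j t →
      let s = λ x → con 1ℚ :+ x ; d₁ = s (s (j :+ j)) ; d₂ = s (s d₁) ; d₃ = s (s d₂) ; d₄ = s (s d₃) ; d₅ = s (s d₄) in
      s j :* ((d₅ :* (d₄ :* (d₃ :* d₂))) :* t) := s (s (s (s (s j)))) :* ((d₄ :* (d₃ :* (d₂ :* d₁))) :* t)) refl (fromℕ j) t

  conclusion : ∀ {c c'} → Bound j c → fromℕ n * c ≤ℚ fromℕ (1 ℕ.+ j) * c' → eigen (1 ℕ.+ j) ≤ℚ c' →
               form V V ≤ℚ c' * inner n xs V V
  conclusion {c} {c'} bound hc he = *-cancel-≤ (*-pos κ-pos κ-pos) (subst₂ _≤ℚ_ (sym form-split)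
    (trans (sym (ℚ.*-distribˡ-+ c' _ _)) (trans (cong (c' *_) (sym inner-split))
      (solve 3 (λ a b d → a :* (b :* d) := b :* (a :* d)) refl c' (κ * κ) (inner n xs V V))))
    (ℚ.+-mono-≤ (bound-U bound hc)
      (ℚ.*-monoʳ-≤-nonNeg (inner n xs W W) ⦃ ℚ.nonNegative (∑flag-nonneg n (λ m → square-nonneg (W m))) ⦄ he)))

-- Eight times 64/5; the factor 384/15 is `degree 0` over the 15 of `rotForm-base`.
bound-base : Bound 0 (fromℕ 512 * ((ℤ.+ 1) ℚ./ 5))
bound-base {xs} len {V} inv s0 = subst₂ _≤ℚ_
  (solve 1 (λ r → con (ℤ.+ 384 ℚ./ 15) :* (con (fromℕ 15) :* r) := con (degree 0) :* r) refl (rotForm 4 xs V V))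
  (solve 1 (λ r → con (ℤ.+ 384 ℚ./ 15) :* (con (fromℕ 4) :* r) := con (fromℕ 512 * ((ℤ.+ 1) ℚ./ 5)) :* r) refl (inner 4 xs V V))
  (*-mono-nonneg (toWitness {a? = 0ℚ ℚ.≤? (ℤ.+ 384 ℚ./ 15)} _) (rotForm-base len inv s0))

-- Eight times 64, well above `eigen 1`, which is eight times 24. The next step multiplies by 6/2
-- and meets `eigen 2` with equality.
bound-5 : Bound 1 (fromℕ 512)
bound-5 len inv s0 = Step.conclusion 0 len inv s0 bound-base
  (toWitness {a? = fromℕ 5 * (fromℕ 512 * ((ℤ.+ 1) ℚ./ 5)) ℚ.≤? fromℕ 1 * fromℕ 512} _)
  (toWitness {a? = eigen 1 ℚ.≤? fromℕ 512} _)

bound-eigen : ∀ j → Bound (2 ℕ.+ j) (eigen (2 ℕ.+ j))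
bound-eigen zero    len inv s0 = Step.conclusion 1 len inv s0 bound-5
  (toWitness {a? = fromℕ 6 * fromℕ 512 ℚ.≤? fromℕ 2 * eigen 2} _) ℚ.≤-refl
bound-eigen (suc j) len inv s0 = Step.conclusion (2 ℕ.+ j) len inv s0 (bound-eigen j)
  -- With n = 7 + j this is (n - 4) `eigen` at n minus n times `eigen` at n - 1, written as a
  -- product of nonnegative factors.
  (≤-from-diff (k₁ * (k₂ * (fromℕ 32 * fromℕ (6 ℕ.+ j))))
    (*-nonneg (fromℕ-nonneg (3 ℕ.+ j)) (*-nonneg (fromℕ-nonneg (double (4 ℕ.+ j))) (*-nonneg (fromℕ-nonneg 32) (fromℕ-nonneg (6 ℕ.+ j)))))
    expand) ℚ.≤-refl
  where
  k₁ = fromℕ (3 ℕ.+ j)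
  k₂ = fromℕ (double (4 ℕ.+ j))
  expand : fromℕ (3 ℕ.+ j) * eigen (3 ℕ.+ j) ≡
           fromℕ (7 ℕ.+ j) * eigen (2 ℕ.+ j) + k₁ * (k₂ * (fromℕ 32 * fromℕ (6 ℕ.+ j)))
  expand rewrite fromℕ-double j = solve 1 (λ j →
    let s = λ x → con 1ℚ :+ x ; j₂ = s (s j) ; j₃ = s j₂ ; j₅ = s (s j₃) ; j₆ = s j₅
        d₃ = s (s (s (s (s (s (j :+ j)))))) ; d₄ = s (s d₃) ; d₅ = s (s d₄) in
    j₃ :* (d₅ :* (d₄ :* (con (fromℕ 4) :* (j₃ :* j₆ :- con (fromℕ 2))))) :=
    s j₆ :* (d₄ :* (d₃ :* (con (fromℕ 4) :* (j₂ :* j₅ :- con (fromℕ 2))))) :+ j₃ :* (d₄ :* (con (fromℕ 32) :* j₆))) refl (fromℕ j)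

-- Matchings of 2n points

∈-matchingsOf-∷ : ∀ f x xs {P} → P ∈ matchingsOf (suc f) (x ∷ xs) →
                  ∃₂ λ y P' → P ≡ (x , y) ∷ P' × y ∈ xs × P' ∈ matchingsOf f (removeElem y xs)
∈-matchingsOf-∷ f x xs i =
  let y , y∈ , j = find (∈-concatMap⁻ (λ y → map ((x , y) ∷_) (matchingsOf f (removeElem y xs))) {xs = xs} i)
      P' , P'∈ , e = ∈-map⁻ ((x , y) ∷_) j
  in y , P' , e , y∈ , P'∈

∈-matchingsOf⁻ : ∀ f {xs P} → P ∈ matchingsOf f xs → flat P ↭ xs
∈-matchingsOf⁻ zero    {[]}     (here refl) = refl
∈-matchingsOf⁻ (suc f) {[]}     (here refl) = refl
∈-matchingsOf⁻ (suc f) {x ∷ xs} i with ∈-matchingsOf-∷ f x xs i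
... | y , P' , refl , y∈ , j = prep x (↭-trans (prep y (∈-matchingsOf⁻ f j)) (removeElem-↭ y∈))

Ascending : List ℕ → Set
Ascending = AllPairs _<_

-- Every edge ascends and starts at the least point not yet used, which determines the presentation.
-- `matchingsOf` on an ascending list and `canon` share this normal form.
data Canonical : Matching → Set where
  []  : Canonical []
  _∷_ : ∀ {a b m} → a < b × All (a <_) (flat m) → Canonical m → Canonical ((a , b) ∷ m)

removeElem-All : ∀ {P : ℕ → Set} y {xs} → All P xs → All P (removeElem y xs)
removeElem-All y []       = []
removeElem-All y {x ∷ xs} (p ∷ ps) with y ≡ᵇ x
... | true  = ps
... | false = p ∷ removeElem-All y ps

removeElem-Ascending : ∀ y {xs} → Ascending xs → Ascending (removeElem y xs)
removeElem-Ascending y []       = []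
removeElem-Ascending y {x ∷ xs} (p ∷ ps) with y ≡ᵇ x
... | true  = ps
... | false = removeElem-All y p ∷ removeElem-Ascending y ps

-- Both the list and the matching begin with their least point, so these agree, and the partner of
-- that point is one of the choices of `matchingsOf`.
Canonical⇒∈ : ∀ f {xs m} → length m ℕ.≤ f → Ascending xs → Canonical m → flat m ↭ xs → m ∈ matchingsOf f xs
Canonical⇒∈ f {xs} {[]} _ as [] p with Perm.↭-length p
Canonical⇒∈ zero    {[]} {[]} _ as [] p | _ = here refl
Canonical⇒∈ (suc f) {[]} {[]} _ as [] p | _ = here refl
Canonical⇒∈ f {[]} {(a , b) ∷ m} _ as (_ ∷ _) p with Perm.↭-length p
... | ()
Canonical⇒∈ (suc f) {x ∷ xs} {(a , b) ∷ m} (ℕ.s≤s l) (x< ∷ as) ((a<b , a<) ∷ c) p = head≡ a≡x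
  where
  least : ∀ {z} → z ∈ a ∷ b ∷ flat m → a ℕ.≤ z
  least (here refl)         = ℕ.≤-refl
  least (there (here refl)) = ℕ.<⇒≤ a<b
  least (there (there i))   = ℕ.<⇒≤ (All.lookup a< i)
  least' : ∀ {z} → z ∈ x ∷ xs → x ℕ.≤ z
  least' (here refl) = ℕ.≤-refl
  least' (there i)   = ℕ.<⇒≤ (All.lookup x< i)
  a≡x : a ≡ x
  a≡x = ℕ.≤-antisym (least (Perm.∈-resp-↭ (↭-sym p) (here refl))) (least' (Perm.∈-resp-↭ p (here refl)))
  head≡ : a ≡ x → (a , b) ∷ m ∈ matchingsOf (suc f) (x ∷ xs)
  head≡ refl = ∈-concatMap⁺ (λ y → map ((x , y) ∷_) (matchingsOf f (removeElem y xs))) (lose b∈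
    (∈-map⁺ ((x , b) ∷_) (Canonical⇒∈ f l (removeElem-Ascending b as) c (removeElem-rest tail↭))))
    where
    tail↭ : b ∷ flat m ↭ xs
    tail↭ = Perm.drop-∷ p
    b∈ : b ∈ xs
    b∈ = Perm.∈-resp-↭ tail↭ (here refl)

orient-< : ∀ {a b} → a ≢ b → proj₁ (orient (a , b)) < proj₂ (orient (a , b))
orient-< {a} {b} a≢b with b <ᵇ a in e
... | true  = ℕ.<ᵇ⇒< b a (subst Bool.T (sym e) _)
... | false = ℕ.≤∧≢⇒< (ℕ.≮⇒≥ (λ b<a → subst Bool.T e (ℕ.<⇒<ᵇ b<a))) a≢b

insertEdge-Canonical : ∀ {a b m} → a < b → Canonical m → Unique (a ∷ b ∷ flat m) → Canonical (insertEdge (a , b) m)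
insertEdge-Canonical a<b []  u = (a<b , []) ∷ []
insertEdge-Canonical {a} {b} {(c , d) ∷ m} a<b ((c<d , c<) ∷ can) u@((_ ∷ a≢c ∷ _) ∷ _) with c <ᵇ a in e
... | true  = (c<d , Perm.All-resp-↭ (flat-≈ (↭⇒≈ (insertEdge-↭ (a , b) m))) (c<a ∷ ℕ.<-trans c<a a<b ∷ c<))
              ∷ insertEdge-Canonical a<b can (drop₂ (Unique-↭ (Perm.shifts (a ∷ b ∷ []) (c ∷ d ∷ []) {flat m}) u))
  where
  c<a : c < a
  c<a = ℕ.<ᵇ⇒< c a (subst Bool.T (sym e) _)
  drop₂ : ∀ {x y : ℕ} {l} → Unique (x ∷ y ∷ l) → Unique l
  drop₂ (_ ∷ _ ∷ v) = v
... | false = (a<b , a<c ∷ ℕ.<-trans a<c c<d ∷ All.map (ℕ.<-trans a<c) c<) ∷ ((c<d , c<) ∷ can)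
  where
  a<c : a < c
  a<c = ℕ.≤∧≢⇒< (ℕ.≮⇒≥ (λ c<a → subst Bool.T e (ℕ.<⇒<ᵇ c<a))) a≢c

canon-Canonical : ∀ m → Unique (flat m) → Canonical (canon m)
canon-Canonical []            u = []
canon-Canonical ((a , b) ∷ m) u@((a≢b ∷ _) ∷ (_ ∷ v)) = insertEdge-Canonical (orient-< a≢b) (canon-Canonical m v)
  (Unique-↭ (↭-trans (flat-≈ (≈-prep (a , b) (canon-≈ m))) (flat-≈ (orient-≈ (a , b)))) u)

upTo-Ascending : ∀ n → Ascending (upTo n)
upTo-Ascending n = AllPairs.applyUpTo⁺₁ id n (λ i<j _ → i<j)

double-2* : ∀ n → 2 ℕ.* n ≡ double n
double-2* zero    = refl
double-2* (suc n) = cong suc (trans (ℕ.+-suc n (n ℕ.+ 0)) (cong suc (double-2* n)))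

points : ℕ → List ℕ
points n = upTo (2 ℕ.* n)

points-length : ∀ n → length (points n) ≡ double n
points-length n = trans (List.length-upTo (2 ℕ.* n)) (double-2* n)

points-Unique : ∀ n → Unique (points n)
points-Unique n = Unique.upTo⁺ (2 ℕ.* n)

flat-length : (m : List (A × A)) → length (flat m) ≡ double (length m)
flat-length []      = refl
flat-length (e ∷ m) = cong (suc ∘ suc) (flat-length m)

double-injective : ∀ {m n} → double m ≡ double n → m ≡ n
double-injective {zero}  {zero}  e = refl
double-injective {suc m} {suc n} e = cong suc (double-injective (ℕ.suc-injective (ℕ.suc-injective e)))

full-length : ∀ n {m} → flat m ↭ points n → length m ≡ n
full-length n {m} p = double-injective (trans (sym (flat-length m)) (trans (Perm.↭-length p) (points-length n)))

Ms-full : ∀ n {P} → P ∈ Ms n → flat P ↭ points n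
Ms-full n = ∈-matchingsOf⁻ (2 ℕ.* n)

canon-∈ : ∀ n {m} → flat m ↭ points n → canon m ∈ Ms n
canon-∈ n {m} p = Canonical⇒∈ (2 ℕ.* n)
  (ℕ.≤-trans (ℕ.≤-reflexive (full-length n p')) (ℕ.m≤m+n n (n ℕ.+ 0)))
  (upTo-Ascending (2 ℕ.* n)) (canon-Canonical m (Unique-↭ (↭-sym p) (points-Unique n))) p'
  where p' = ↭-trans (↭-sym (flat-≈ (canon-≈ m))) p

∑-Ms : ∀ n {V : Matching → ℚ} → HInv V → hyper n * ∑ (Ms n) V ≡ ∑flag n (points n) V
∑-Ms n inv = ∑-matchingsOf n (2 ℕ.* n) (ℕ.m≤m+n n (n ℕ.+ 0)) (points-length n) (points-Unique n) inv

-- Extending functions from the enumerated matchings to all presentations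

indicator : Bool → ℚ
indicator b = if b then 1ℚ else 0ℚ

-- Testing both directions of an edge makes the value independent of its orientation for any map
-- `q`.
inside : (ℕ → ℕ) → Matching → Bool
inside q []            = true
inside q ((a , b) ∷ m) = ((q a ≡ᵇ b) ∧ (q b ≡ᵇ a)) ∧ inside q m

inside-≈ : ∀ q {m m'} → m ≈ m' → inside q m ≡ inside q m'
inside-≈ q ≈-refl                      = refl
inside-≈ q (≈-prep e p)                = cong (_ ∧_) (inside-≈ q p)
inside-≈ q (≈-swap (a , b) (c , d) {m}) = begin
  x ∧ (y ∧ z)   ≡⟨ Bool.∧-assoc x y z ⟨
  (x ∧ y) ∧ z   ≡⟨ cong (_∧ z) (Bool.∧-comm x y) ⟩
  (y ∧ x) ∧ z   ≡⟨ Bool.∧-assoc y x z ⟩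
  y ∧ (x ∧ z)   ∎
  where
  x = (q a ≡ᵇ b) ∧ (q b ≡ᵇ a)
  y = (q c ≡ᵇ d) ∧ (q d ≡ᵇ c)
  z = inside q m
inside-≈ q (≈-flip a b {m})            = cong (_∧ inside q m) (Bool.∧-comm (q a ≡ᵇ b) (q b ≡ᵇ a))
inside-≈ q (≈-trans p p')              = trans (inside-≈ q p) (inside-≈ q p')

inside-cong : ∀ {q q'} m → (∀ z → z ∈ flat m → q z ≡ q' z) → inside q m ≡ inside q' m
inside-cong []            h = refl
inside-cong {q} {q'} ((a , b) ∷ m) h rewrite h a (here refl) | h b (there (here refl)) =
  cong (((q' a ≡ᵇ b) ∧ (q' b ≡ᵇ a)) ∧_) (inside-cong m (λ z i → h z (there (there i))))

∑-pick-one : ∀ {xs : List ℕ} {y} {f : ℕ → ℚ} → Unique xs → y ∈ xs → (∀ z → z ∈ xs → z ≢ y → f z ≡ 0ℚ) → ∑ xs f ≡ f y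
∑-pick-one {x ∷ xs} {y} {f} (x∉ ∷ u) (here refl) h = trans (∑-∷ x xs f) (trans
  (cong (f x +_) (∑-zero xs (λ {z} i → h z (there i) (λ e → All.lookup x∉ i (sym e))))) (ℚ.+-identityʳ (f x)))
∑-pick-one {x ∷ xs} {y} {f} (x∉ ∷ u) (there i) h = trans (∑-∷ x xs f) (trans
  (cong₂ _+_ (h x (here refl) (λ e → All.lookup x∉ i e)) (∑-pick-one u i (λ z j → h z (there j)))) (ℚ.+-identityˡ (f y)))

-- A perfect matching contained in another one equals it, so a single summand survives: a different
-- partner for the first point already violates `inside`.
∑-inside : ∀ f {xs R} (G : Matching → ℚ) → Unique xs → R ∈ matchingsOf f xs →
           ∑ (matchingsOf f xs) (λ Q → indicator (inside (partner Q) R) * G Q) ≡ G R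
∑-inside zero    {[]}     G u (here refl) = trans (∑-single [] _) (ℚ.*-identityˡ (G []))
∑-inside (suc f) {[]}     G u (here refl) = trans (∑-single [] _) (ℚ.*-identityˡ (G []))
∑-inside (suc f) {x ∷ xs} G (x∉ ∷ u) i with ∈-matchingsOf-∷ f x xs i
... | y , R , refl , y∈ , j = begin
  ∑ (matchingsOf (suc f) (x ∷ xs)) g
    ≡⟨ trans (∑-concatMap _ xs g) (∑-cong xs (λ z → ∑-map ((x , z) ∷_) (matchingsOf f (removeElem z xs)) g)) ⟩
  ∑ xs (λ z → ∑ (matchingsOf f (removeElem z xs)) (λ Q → g ((x , z) ∷ Q)))
    ≡⟨ ∑-pick-one u y∈ (λ z _ z≢y → ∑-zero (matchingsOf f (removeElem z xs)) (λ {Q} _ →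
         trans (cong (λ b → indicator b * G ((x , z) ∷ Q)) (other z Q z≢y)) (ℚ.*-zeroˡ (G ((x , z) ∷ Q))))) ⟩
  ∑ (matchingsOf f (removeElem y xs)) (λ Q → g ((x , y) ∷ Q))
    ≡⟨ ∑-cong (matchingsOf f (removeElem y xs)) (λ Q → cong (λ b → indicator b * G ((x , y) ∷ Q)) (same Q)) ⟩
  ∑ (matchingsOf f (removeElem y xs)) (λ Q → indicator (inside (partner Q) R) * G ((x , y) ∷ Q))
    ≡⟨ ∑-inside f (λ Q → G ((x , y) ∷ Q)) u-y j ⟩
  G ((x , y) ∷ R) ∎
  where
  g : Matching → ℚ
  g Q = indicator (inside (partner Q) ((x , y) ∷ R)) * G Q
  y∷-Unique : Unique (y ∷ removeElem y xs)
  y∷-Unique = Unique-↭ (↭-sym (removeElem-↭ y∈)) u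
  u-y : Unique (removeElem y xs)
  u-y with y∷-Unique
  ... | _ ∷ v = v
  x≢ : ∀ {z} → z ∈ xs → z ≢ x
  x≢ i e = All.lookup x∉ i (sym e)
  other : ∀ z Q → z ≢ y → inside (partner ((x , z) ∷ Q)) ((x , y) ∷ R) ≡ false
  other z Q z≢y rewrite ≡ᵇ-refl x | ≡ᵇ-≢ z≢y = refl
  same : ∀ Q → inside (partner ((x , y) ∷ Q)) ((x , y) ∷ R) ≡ inside (partner Q) R
  same Q = trans (cong₂ (λ a b → ((a ≡ᵇ y) ∧ (b ≡ᵇ x)) ∧ inside (partner ((x , y) ∷ Q)) R) at-x at-y)
    (trans (cong₂ (λ a b → (a ∧ b) ∧ inside (partner ((x , y) ∷ Q)) R) (≡ᵇ-refl y) (≡ᵇ-refl x)) (inside-cong R agree))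
    where
    at-x : partner ((x , y) ∷ Q) x ≡ y
    at-x rewrite ≡ᵇ-refl x = refl
    at-y : partner ((x , y) ∷ Q) y ≡ x
    at-y rewrite ≡ᵇ-≢ (x≢ y∈) | ≡ᵇ-refl y = refl
    agree : ∀ z → z ∈ flat R → partner ((x , y) ∷ Q) z ≡ partner Q z
    agree z k = away (x≢ (Perm.∈-resp-↭ (removeElem-↭ y∈) (there z∈))) z≢y
      where
      z∈ : z ∈ removeElem y xs
      z∈ = Perm.∈-resp-↭ (∈-matchingsOf⁻ f j) k
      z≢y : z ≢ y
      z≢y e with y∷-Unique
      ... | y∉ ∷ _ = All.lookup y∉ z∈ (sym e)
      away : z ≢ x → z ≢ y → partner ((x , y) ∷ Q) z ≡ partner Q z
      away p q rewrite ≡ᵇ-≢ p | ≡ᵇ-≢ q = refl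

-- Writes evaluation at any presentation as a combination of values on `Ms n` with coefficients
-- independent of `F`; this is how matrix entries emerge from `∑nbr`.
∑-reproduce : ∀ n {F : Matching → ℚ} → HInv F → ∀ {m} → flat m ↭ points n →
              ∑ (Ms n) (λ Q → indicator (inside (partner Q) m) * F Q) ≡ F m
∑-reproduce n {F} inv {m} p = begin
  ∑ (Ms n) (λ Q → indicator (inside (partner Q) m) * F Q)
    ≡⟨ ∑-cong (Ms n) (λ Q → cong (λ b → indicator b * F Q) (inside-≈ (partner Q) (canon-≈ m))) ⟩
  ∑ (Ms n) (λ Q → indicator (inside (partner Q) (canon m)) * F Q)
    ≡⟨ ∑-inside (2 ℕ.* n) F (points-Unique n) (canon-∈ n p) ⟩
  F (canon m)
    ≡⟨ inv (canon-≈ m) ⟨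
  F m ∎

-- A `Vector` has meaning only on `Ms n`. This is the function of the matching alone that takes the
-- same values there.
extend : ℕ → (Matching → ℚ) → Matching → ℚ
extend n v m = ∑ (Ms n) (λ Q → indicator (inside (partner Q) m) * v Q)

extend-HInv : ∀ n v → HInv (extend n v)
extend-HInv n v p = ∑-cong (Ms n) (λ Q → cong (λ b → indicator b * v Q) (inside-≈ (partner Q) p))

extend-Ms : ∀ n v {P} → P ∈ Ms n → extend n v P ≡ v P
extend-Ms n v i = ∑-inside (2 ℕ.* n) v (points-Unique n) i

-- Octagons in the union of two matchings

private
  T-false : ∀ {b} → b ≡ false → b ≡ true → ⊥
  T-false refl ()

partner-≢ : ∀ {a b z} m → z ≢ a → z ≢ b → partner ((a , b) ∷ m) z ≡ partner m z
partner-≢ m p q rewrite ≡ᵇ-≢ p | ≡ᵇ-≢ q = refl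

partner-fst : ∀ a b m → partner ((a , b) ∷ m) a ≡ b
partner-fst a b m rewrite ≡ᵇ-refl a = refl

partner-snd : ∀ {a b} m → b ≢ a → partner ((a , b) ∷ m) b ≡ a
partner-snd {a} {b} m p rewrite ≡ᵇ-≢ p | ≡ᵇ-refl b = refl

partner-≈ : ∀ {m m'} → m ≈ m' → Unique (flat m) → ∀ z → partner m z ≡ partner m' z
partner-≈ ≈-refl u z = refl
partner-≈ (≈-prep (a , b) p) (_ ∷ _ ∷ u) z with z ≡ᵇ a | z ≡ᵇ b
... | true  | _     = refl
... | false | true  = refl
... | false | false = partner-≈ p u z
partner-≈ (≈-swap (a , b) (c , d) {m}) ((_ ∷ a≢c ∷ a≢d ∷ _) ∷ (b≢c ∷ b≢d ∷ _) ∷ u) z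
  with z ≡ᵇ a in za | z ≡ᵇ b in zb | z ≡ᵇ c in zc | z ≡ᵇ d in zd
... | true  | _     | true  | _     = ⊥-elim (a≢c (trans (sym (≡ᵇ-true {z} za)) (≡ᵇ-true {z} zc)))
... | true  | _     | false | true  = ⊥-elim (a≢d (trans (sym (≡ᵇ-true {z} za)) (≡ᵇ-true {z} zd)))
... | true  | _     | false | false = refl
... | false | true  | true  | _     = ⊥-elim (b≢c (trans (sym (≡ᵇ-true {z} zb)) (≡ᵇ-true {z} zc)))
... | false | true  | false | true  = ⊥-elim (b≢d (trans (sym (≡ᵇ-true {z} zb)) (≡ᵇ-true {z} zd)))
... | false | true  | false | false = refl
... | false | false | true  | _     = refl
... | false | false | false | true  = refl
... | false | false | false | false = refl
partner-≈ (≈-flip a b {m}) ((a≢b ∷ _) ∷ u) z with z ≡ᵇ a in za | z ≡ᵇ b in zb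
... | true  | true  = ⊥-elim (a≢b (trans (sym (≡ᵇ-true {z} za)) (≡ᵇ-true {z} zb)))
... | true  | false = refl
... | false | true  = refl
... | false | false = refl
partner-≈ (≈-trans p q) u z = trans (partner-≈ p u z) (partner-≈ q (Unique-↭ (flat-≈ p) u) z)

edge-out : ∀ m {z} → Unique (flat m) → z ∈ flat m → ∃ λ r → m ≈ (z , partner m z) ∷ r
edge-out ((a , b) ∷ m) u (here refl) = m , subst (λ w → (a , b) ∷ m ≈ (a , w) ∷ m) (sym (partner-fst a b m)) ≈-refl
edge-out ((a , b) ∷ m) ((a≢b ∷ _) ∷ u) (there (here refl)) =
  m , subst (λ w → (a , b) ∷ m ≈ (b , w) ∷ m) (sym (partner-snd m (a≢b ∘ sym))) (≈-flip a b)
edge-out ((a , b) ∷ m) {z} ((_ ∷ a∉) ∷ (b∉ ∷ u)) (there (there i)) =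
  let r , p = edge-out m u i in
  (a , b) ∷ r , subst (λ w → (a , b) ∷ m ≈ (z , w) ∷ (a , b) ∷ r)
    (sym (partner-≢ m (λ e → All.lookup a∉ i (sym e)) (λ e → All.lookup b∉ i (sym e))))
    (≈-trans (≈-prep (a , b) p) (≈-swap (a , b) (z , partner m z)))

-- A fixed-point-free involution of `xs`, which is all that the traversal of cycles uses of a
-- matching.
record Pairing (xs : List ℕ) (p : ℕ → ℕ) : Set where
  field
    closed : ∀ {z} → z ∈ xs → p z ∈ xs
    moves  : ∀ {z} → z ∈ xs → p z ≢ z
    invol  : ∀ {z} → z ∈ xs → p (p z) ≡ z

partner-edge : ∀ {m a b r} → Unique (flat m) → m ≈ (a , b) ∷ r → partner m a ≡ b × partner m b ≡ a
partner-edge {m} {a} {b} {r} u p with Unique-↭ (flat-≈ p) u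
... | (a≢b ∷ _) ∷ _ = trans (partner-≈ p u a) (partner-fst a b r) , trans (partner-≈ p u b) (partner-snd r (a≢b ∘ sym))

partner-Pairing : ∀ {xs m} → Unique xs → flat m ↭ xs → Pairing xs (partner m)
partner-Pairing {xs} {m} uxs f = record { closed = closed ; moves = moves ; invol = invol }
  where
  u : Unique (flat m)
  u = Unique-↭ (↭-sym f) uxs
  out : ∀ {z} → z ∈ xs → ∃ λ r → m ≈ (z , partner m z) ∷ r
  out i = edge-out m u (Perm.∈-resp-↭ (↭-sym f) i)
  closed : ∀ {z} → z ∈ xs → partner m z ∈ xs
  closed i = Perm.∈-resp-↭ (↭-trans (↭-sym (flat-≈ (proj₂ (out i)))) f) (there (here refl))
  moves : ∀ {z} → z ∈ xs → partner m z ≢ z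
  moves i e with Unique-↭ (flat-≈ (proj₂ (out i))) u
  ... | (z≢ ∷ _) ∷ _ = z≢ (sym e)
  invol : ∀ {z} → z ∈ xs → partner m (partner m z) ≡ z
  invol i = proj₂ (partner-edge u (proj₂ (out i)))

-- The involutions are recorded in both directions, so that rotating or reflecting an octagon only
-- permutes the fields.
record Octagon (p q : ℕ → ℕ) (xs : List ℕ) (a₁ b₁ a₂ b₂ a₃ b₃ a₄ b₄ : ℕ) : Set where
  field
    p₁ : p a₁ ≡ b₁ ; p₂ : p a₂ ≡ b₂ ; p₃ : p a₃ ≡ b₃ ; p₄ : p a₄ ≡ b₄
    q₁ : q b₁ ≡ a₂ ; q₂ : q b₂ ≡ a₃ ; q₃ : q b₃ ≡ a₄ ; q₄ : q b₄ ≡ a₁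
    p₁' : p b₁ ≡ a₁ ; p₂' : p b₂ ≡ a₂ ; p₃' : p b₃ ≡ a₃ ; p₄' : p b₄ ≡ a₄
    q₁' : q a₂ ≡ b₁ ; q₂' : q a₃ ≡ b₂ ; q₃' : q a₄ ≡ b₃ ; q₄' : q a₁ ≡ b₄
    distinct : Unique (a₁ ∷ b₁ ∷ a₂ ∷ b₂ ∷ a₃ ∷ b₃ ∷ a₄ ∷ b₄ ∷ [])
    members  : All (_∈ xs) (a₁ ∷ b₁ ∷ a₂ ∷ b₂ ∷ a₃ ∷ b₃ ∷ a₄ ∷ b₄ ∷ [])
    others   : ∀ z → z ∈ xs → z ∉ a₁ ∷ b₁ ∷ a₂ ∷ b₂ ∷ a₃ ∷ b₃ ∷ a₄ ∷ b₄ ∷ [] → p z ≡ q z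

module _ {p q : ℕ → ℕ} {xs : List ℕ} where

  private
    rotation : ∀ (a₁ b₁ a₂ b₂ a₃ b₃ a₄ b₄ : ℕ) →
      a₁ ∷ b₁ ∷ a₂ ∷ b₂ ∷ a₃ ∷ b₃ ∷ a₄ ∷ b₄ ∷ [] ↭ a₂ ∷ b₂ ∷ a₃ ∷ b₃ ∷ a₄ ∷ b₄ ∷ a₁ ∷ b₁ ∷ []
    rotation a₁ b₁ a₂ b₂ a₃ b₃ a₄ b₄ = Perm.++-comm (a₁ ∷ b₁ ∷ []) (a₂ ∷ b₂ ∷ a₃ ∷ b₃ ∷ a₄ ∷ b₄ ∷ [])

    reflection : ∀ (a₁ b₁ a₂ b₂ a₃ b₃ a₄ b₄ : ℕ) →
      a₁ ∷ b₁ ∷ a₂ ∷ b₂ ∷ a₃ ∷ b₃ ∷ a₄ ∷ b₄ ∷ [] ↭ b₁ ∷ a₁ ∷ b₄ ∷ a₄ ∷ b₃ ∷ a₃ ∷ b₂ ∷ a₂ ∷ []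
    reflection a₁ b₁ a₂ b₂ a₃ b₃ a₄ b₄ = swap a₁ b₁ (↭-sym (Perm.↭-reverse (a₂ ∷ b₂ ∷ a₃ ∷ b₃ ∷ a₄ ∷ b₄ ∷ [])))

  rotate : ∀ {a₁ b₁ a₂ b₂ a₃ b₃ a₄ b₄} → Octagon p q xs a₁ b₁ a₂ b₂ a₃ b₃ a₄ b₄ → Octagon p q xs a₂ b₂ a₃ b₃ a₄ b₄ a₁ b₁
  rotate {a₁} {b₁} {a₂} {b₂} {a₃} {b₃} {a₄} {b₄} o = record
    { p₁ = p₂ ; p₂ = p₃ ; p₃ = p₄ ; p₄ = p₁ ; q₁ = q₂ ; q₂ = q₃ ; q₃ = q₄ ; q₄ = q₁
    ; p₁' = p₂' ; p₂' = p₃' ; p₃' = p₄' ; p₄' = p₁' ; q₁' = q₂' ; q₂' = q₃' ; q₃' = q₄' ; q₄' = q₁'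
    ; distinct = Unique-↭ ρ distinct ; members = Perm.All-resp-↭ ρ members
    ; others = λ z i z∉ → others z i (z∉ ∘ Perm.∈-resp-↭ ρ) }
    where
    open Octagon o
    ρ = rotation a₁ b₁ a₂ b₂ a₃ b₃ a₄ b₄

  reflect : ∀ {a₁ b₁ a₂ b₂ a₃ b₃ a₄ b₄} → Octagon p q xs a₁ b₁ a₂ b₂ a₃ b₃ a₄ b₄ → Octagon p q xs b₁ a₁ b₄ a₄ b₃ a₃ b₂ a₂
  reflect {a₁} {b₁} {a₂} {b₂} {a₃} {b₃} {a₄} {b₄} o = record
    { p₁ = p₁' ; p₂ = p₄' ; p₃ = p₃' ; p₄ = p₂' ; q₁ = q₄' ; q₂ = q₃' ; q₃ = q₂' ; q₄ = q₁'
    ; p₁' = p₁ ; p₂' = p₄ ; p₃' = p₃ ; p₄' = p₂ ; q₁' = q₄ ; q₂' = q₃ ; q₃' = q₂ ; q₄' = q₁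
    ; distinct = Unique-↭ σ distinct ; members = Perm.All-resp-↭ σ members
    ; others = λ z i z∉ → others z i (z∉ ∘ Perm.∈-resp-↭ σ) }
    where
    open Octagon o
    σ = reflection a₁ b₁ a₂ b₂ a₃ b₃ a₄ b₄

  -- The vertices `l` stay fixed up to order while the starting point and the direction vary.
  record OctagonAt (x : ℕ) (l : List ℕ) : Set where
    constructor octagonAt
    field
      {b₁ a₂ b₂ a₃ b₃ a₄ b₄} : ℕ
      octagon : Octagon p q xs x b₁ a₂ b₂ a₃ b₃ a₄ b₄
      vertices : x ∷ b₁ ∷ a₂ ∷ b₂ ∷ a₃ ∷ b₃ ∷ a₄ ∷ b₄ ∷ [] ↭ l

  private
    rotateAt : ∀ {x l} (o : OctagonAt x l) → OctagonAt (OctagonAt.a₂ o) l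
    rotateAt (octagonAt o v) = octagonAt (rotate o) (↭-trans (↭-sym (rotation _ _ _ _ _ _ _ _)) v)

    reflectAt : ∀ {x l} (o : OctagonAt x l) → OctagonAt (OctagonAt.b₁ o) l
    reflectAt (octagonAt o v) = octagonAt (reflect o) (↭-trans (↭-sym (reflection _ _ _ _ _ _ _ _)) v)

  -- The dihedral group is transitive on the vertices; half of them are reached by rotations and the
  -- other half by a reflection in addition.
  OctagonAt-∈ : ∀ {x z l} → OctagonAt x l → z ∈ l → OctagonAt z l
  OctagonAt-∈ {x} {z} o i = go (Perm.∈-resp-↭ (↭-sym (OctagonAt.vertices o)) i)
    where
    o₂ = rotateAt o
    o₃ = rotateAt o₂
    o₄ = rotateAt o₃
    go : z ∈ x ∷ _ ∷ _ ∷ _ ∷ _ ∷ _ ∷ _ ∷ _ ∷ [] → OctagonAt z _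
    go (here refl) = o
    go (there (here refl)) = reflectAt o
    go (there (there (here refl))) = o₂
    go (there (there (there (here refl)))) = reflectAt o₂
    go (there (there (there (there (here refl))))) = o₃
    go (there (there (there (there (there (here refl)))))) = reflectAt o₃
    go (there (there (there (there (there (there (here refl))))))) = o₄
    go (there (there (there (there (there (there (there (here refl)))))))) = reflectAt o₄

∈-memb : ∀ {x l} → x ∈ l → memb x l ≡ true
∈-memb {x} {y ∷ l} (here refl) rewrite ≡ᵇ-refl x = refl
∈-memb {x} {y ∷ l} (there i) rewrite ∈-memb i = Bool.∨-zeroʳ (y ≡ᵇ x)

memb-∈ : ∀ x l → memb x l ≡ true → x ∈ l
memb-∈ x (y ∷ l) e with y ≡ᵇ x in yx
... | true  = here (sym (≡ᵇ-true yx))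
... | false = there (memb-∈ x l e)

∉-memb : ∀ {x l} → x ∉ l → memb x l ≡ false
∉-memb {x} {l} h with memb x l in e
... | true  = ⊥-elim (h (memb-∈ x l e))
... | false = refl

memb-∉ : ∀ x l → memb x l ≡ false → x ∉ l
memb-∉ x l e i = T-false e (∈-memb i)

module Walk {p q : ℕ → ℕ} {xs : List ℕ} (uxs : Unique xs) (P : Pairing xs p) (Q : Pairing xs q) (g : ℕ) where
  module P = Pairing P
  module Q = Pairing Q

  -- One unit yields two points. Four units cover an octagon, and the fifth distinguishes a trail
  -- that closes after eight points from one that runs on.
  fuel : ℕ
  fuel = 5 ℕ.+ g

  trail : ℕ → List ℕ
  trail x = orbit fuel p q x x

  -- The traversal of `cycleHalfLengths`, for arbitrary involutions in place of `partner`.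
  walk : List ℕ → List ℕ → List ℕ
  walk vis []       = []
  walk vis (x ∷ ys) = if memb x vis then walk vis ys else (⌊ length (trail x) /2⌋ ∷ walk (trail x ++ vis) ys)

  q-inj : ∀ {y z} → y ∈ xs → z ∈ xs → q y ≡ q z → y ≡ z
  q-inj i j e = trans (sym (Q.invol i)) (trans (cong q e) (Q.invol j))

  trail-2 : ∀ {x} → x ∈ xs → p x ≡ q x → trail x ≡ x ∷ p x ∷ []
  trail-2 {x} i e rewrite trans (cong q e) (Q.invol i) | ≡ᵇ-refl x = refl

  half-1 : ∀ {x} → x ∈ xs → ⌊ length (trail x) /2⌋ ≡ 1 → p x ≡ q x
  half-1 {x} i e with q (p x) ≡ᵇ x in e₁
  ... | true  = q-inj (P.closed i) (Q.closed i) (trans (≡ᵇ-true e₁) (sym (Q.invol i)))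
  half-1 {x} i () | false

  trail-8 : ∀ {a₁ b₁ a₂ b₂ a₃ b₃ a₄ b₄} → Octagon p q xs a₁ b₁ a₂ b₂ a₃ b₃ a₄ b₄ →
            trail a₁ ≡ a₁ ∷ b₁ ∷ a₂ ∷ b₂ ∷ a₃ ∷ b₃ ∷ a₄ ∷ b₄ ∷ []
  trail-8 {a₁} o with Octagon.distinct o
  ... | (_ ∷ n₂ ∷ _ ∷ n₃ ∷ _ ∷ n₄ ∷ _) ∷ _
    rewrite Octagon.p₁ o | Octagon.q₁ o | ≡ᵇ-≢ (n₂ ∘ sym) | Octagon.p₂ o | Octagon.q₂ o | ≡ᵇ-≢ (n₃ ∘ sym)
          | Octagon.p₃ o | Octagon.q₃ o | ≡ᵇ-≢ (n₄ ∘ sym) | Octagon.p₄ o | Octagon.q₄ o | ≡ᵇ-refl a₁ = refl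

  -- n₁₂ and n₁₃ say that the walk does not close before its eighth step, which makes all eight points distinct.
  record Closed8 (p q : ℕ → ℕ) (a₁ b₁ a₂ b₂ a₃ b₃ a₄ b₄ : ℕ) : Set where
    field
      p₁ : p a₁ ≡ b₁ ; p₂ : p a₂ ≡ b₂ ; p₃ : p a₃ ≡ b₃ ; p₄ : p a₄ ≡ b₄
      q₁ : q b₁ ≡ a₂ ; q₂ : q b₂ ≡ a₃ ; q₃ : q b₃ ≡ a₄ ; q₄ : q b₄ ≡ a₁
      p₁' : p b₁ ≡ a₁ ; p₂' : p b₂ ≡ a₂ ; p₃' : p b₃ ≡ a₃ ; p₄' : p b₄ ≡ a₄
      q₁' : q a₂ ≡ b₁ ; q₂' : q a₃ ≡ b₂ ; q₃' : q a₄ ≡ b₃ ; q₄' : q a₁ ≡ b₄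
      n₁₂ : a₁ ≢ a₂
      n₁₃ : a₁ ≢ a₃

  private
    step : ∀ {p q a₁ b₁ a₂ b₂ a₃ b₃ a₄ b₄} → Closed8 p q a₁ b₁ a₂ b₂ a₃ b₃ a₄ b₄ → Closed8 q p b₁ a₂ b₂ a₃ b₃ a₄ b₄ a₁
    step {p} o = record
      { p₁ = q₁ ; p₂ = q₂ ; p₃ = q₃ ; p₄ = q₄ ; q₁ = p₂ ; q₂ = p₃ ; q₃ = p₄ ; q₄ = p₁
      ; p₁' = q₁' ; p₂' = q₂' ; p₃' = q₃' ; p₄' = q₄' ; q₁' = p₂' ; q₂' = p₃' ; q₃' = p₄' ; q₄' = p₁'
      ; n₁₂ = λ e → n₁₂ (trans (sym p₁') (trans (cong p e) p₂'))
      ; n₁₃ = λ e → n₁₃ (trans (sym p₁') (trans (cong p e) p₃')) }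
      where open Closed8 o

    -- A coincidence at odd distance propagates along the walk until `p` or `q` has a fixed point;
    -- one at even distance reduces to `n₁₂` or `n₁₃`.
    head-distinct : ∀ {p q a₁ b₁ a₂ b₂ a₃ b₃ a₄ b₄} → Pairing xs p → Pairing xs q → Closed8 p q a₁ b₁ a₂ b₂ a₃ b₃ a₄ b₄ →
                    All (_∈ xs) (a₁ ∷ b₁ ∷ a₂ ∷ b₂ ∷ a₃ ∷ b₃ ∷ a₄ ∷ b₄ ∷ []) →
                    All (a₁ ≢_) (b₁ ∷ a₂ ∷ b₂ ∷ a₃ ∷ b₃ ∷ a₄ ∷ b₄ ∷ [])
    head-distinct {p} {q} Pp Qq o (i₁ ∷ j₁ ∷ i₂ ∷ j₂ ∷ i₃ ∷ j₃ ∷ i₄ ∷ j₄ ∷ []) =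
      (λ e → Pairing.moves Pp i₁ (trans p₁ (sym e))) ∷ n₁₂ ∷
      (λ e → Pairing.moves Qq j₁ (trans q₁ (trans (sym p₂') (trans (cong p (sym e)) p₁)))) ∷ n₁₃ ∷
      (λ e → Pairing.moves Pp i₂ (trans p₂ (trans (sym q₂') (trans (cong q (trans (sym p₃') (trans (cong p (sym e)) p₁))) q₁)))) ∷
      (λ e → n₁₂ (trans (sym q₄) (trans (cong q (trans (sym p₄) (trans (cong p (sym e)) p₁))) q₁))) ∷
      (λ e → Pairing.moves Qq j₄ (trans q₄ e)) ∷ []
      where open Closed8 o

  -- Shifting the walk by one place exchanges `p` and `q`, so `head-distinct` applies at every point
  -- in turn.
  Closed8-Unique : ∀ {a₁ b₁ a₂ b₂ a₃ b₃ a₄ b₄} → Closed8 p q a₁ b₁ a₂ b₂ a₃ b₃ a₄ b₄ →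
                   All (_∈ xs) (a₁ ∷ b₁ ∷ a₂ ∷ b₂ ∷ a₃ ∷ b₃ ∷ a₄ ∷ b₄ ∷ []) →
                   Unique (a₁ ∷ b₁ ∷ a₂ ∷ b₂ ∷ a₃ ∷ b₃ ∷ a₄ ∷ b₄ ∷ [])
  Closed8-Unique o m@(i₁ ∷ j₁ ∷ i₂ ∷ j₂ ∷ i₃ ∷ j₃ ∷ i₄ ∷ j₄ ∷ [])
    with head-distinct P Q o m
       | head-distinct Q P (step o) (j₁ ∷ i₂ ∷ j₂ ∷ i₃ ∷ j₃ ∷ i₄ ∷ j₄ ∷ i₁ ∷ [])
       | head-distinct P Q (step (step o)) (i₂ ∷ j₂ ∷ i₃ ∷ j₃ ∷ i₄ ∷ j₄ ∷ i₁ ∷ j₁ ∷ [])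
       | head-distinct Q P (step (step (step o))) (j₂ ∷ i₃ ∷ j₃ ∷ i₄ ∷ j₄ ∷ i₁ ∷ j₁ ∷ i₂ ∷ [])
       | head-distinct P Q (step (step (step (step o)))) (i₃ ∷ j₃ ∷ i₄ ∷ j₄ ∷ i₁ ∷ j₁ ∷ i₂ ∷ j₂ ∷ [])
       | head-distinct Q P (step (step (step (step (step o))))) (j₃ ∷ i₄ ∷ j₄ ∷ i₁ ∷ j₁ ∷ i₂ ∷ j₂ ∷ i₃ ∷ [])
       | head-distinct P Q (step (step (step (step (step (step o)))))) (i₄ ∷ j₄ ∷ i₁ ∷ j₁ ∷ i₂ ∷ j₂ ∷ i₃ ∷ j₃ ∷ [])
  ... | h₁ | a ∷ b ∷ c ∷ d ∷ e ∷ f ∷ _ | a' ∷ b' ∷ c' ∷ d' ∷ e' ∷ _ | a'' ∷ b'' ∷ c'' ∷ d'' ∷ _ | x ∷ y ∷ z ∷ _ | u ∷ v ∷ _ | w ∷ _ =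
    h₁ ∷ (a ∷ b ∷ c ∷ d ∷ e ∷ f ∷ []) ∷ (a' ∷ b' ∷ c' ∷ d' ∷ e' ∷ []) ∷ (a'' ∷ b'' ∷ c'' ∷ d'' ∷ []) ∷
    (x ∷ y ∷ z ∷ []) ∷ (u ∷ v ∷ []) ∷ (w ∷ []) ∷ [] ∷ []

  module _ (x : ℕ) where
    private
      a₂ = q (p x)
      a₃ = q (p a₂)
      a₄ = q (p a₃)

    vertices₈ : List ℕ
    vertices₈ = x ∷ p x ∷ a₂ ∷ p a₂ ∷ a₃ ∷ p a₃ ∷ a₄ ∷ p a₄ ∷ []

    half-4 : x ∈ xs → ⌊ length (trail x) /2⌋ ≡ 4 → Unique vertices₈ ×
             ((∀ z → z ∈ xs → z ∉ vertices₈ → p z ≡ q z) → Octagon p q xs x (p x) a₂ (p a₂) a₃ (p a₃) a₄ (p a₄)) ×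
             trail x ≡ vertices₈
    half-4 i₁ e with q (p x) ≡ᵇ x in e₁
    half-4 i₁ () | true
    ... | false with q (p a₂) ≡ᵇ x in e₂
    half-4 i₁ () | false | true
    ... | false with q (p a₃) ≡ᵇ x in e₃
    half-4 i₁ () | false | false | true
    ... | false with q (p a₄) ≡ᵇ x in e₄
    half-4 i₁ () | false | false | false | false
    ... | true = unique , oct , refl
      where
      j₁ = P.closed i₁
      i₂ = Q.closed j₁
      j₂ = P.closed i₂
      i₃ = Q.closed j₂
      j₃ = P.closed i₃
      i₄ = Q.closed j₃
      j₄ = P.closed i₄
      back : q x ≡ p a₄
      back = trans (cong q (sym (≡ᵇ-true e₄))) (Q.invol j₄)
      ≢-from : ∀ {y} → (y ≡ᵇ x) ≡ false → x ≢ y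
      ≢-from f refl = T-false f (≡ᵇ-refl x)
      closed8 : Closed8 p q x (p x) a₂ (p a₂) a₃ (p a₃) a₄ (p a₄)
      closed8 = record
        { p₁ = refl ; p₂ = refl ; p₃ = refl ; p₄ = refl ; q₁ = refl ; q₂ = refl ; q₃ = refl ; q₄ = ≡ᵇ-true e₄
        ; p₁' = P.invol i₁ ; p₂' = P.invol i₂ ; p₃' = P.invol i₃ ; p₄' = P.invol i₄
        ; q₁' = Q.invol j₁ ; q₂' = Q.invol j₂ ; q₃' = Q.invol j₃ ; q₄' = back
        ; n₁₂ = ≢-from e₁ ; n₁₃ = ≢-from e₂ }
      mem : All (_∈ xs) vertices₈
      mem = i₁ ∷ j₁ ∷ i₂ ∷ j₂ ∷ i₃ ∷ j₃ ∷ i₄ ∷ j₄ ∷ []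
      unique = Closed8-Unique closed8 mem
      oct = λ h → record
        { p₁ = refl ; p₂ = refl ; p₃ = refl ; p₄ = refl ; q₁ = refl ; q₂ = refl ; q₃ = refl ; q₄ = ≡ᵇ-true e₄
        ; p₁' = P.invol i₁ ; p₂' = P.invol i₂ ; p₃' = P.invol i₃ ; p₄' = P.invol i₄
        ; q₁' = Q.invol j₁ ; q₂' = Q.invol j₂ ; q₃' = Q.invol j₃ ; q₄' = back
        ; distinct = unique ; members = mem ; others = h }

-- The cycle type computed by Defs

-- The arrangements of [4,1,...,1]. The place of the 4 depends on when the traversal meets the
-- octagon.
data OneFour : List ℕ → Set where
  four : ∀ {l} → All (_≡ 1) l → OneFour (4 ∷ l)
  one  : ∀ {l} → OneFour l → OneFour (1 ∷ l)

OneFour-∷⁻ : ∀ {h l} → OneFour (h ∷ l) → (h ≡ 4 × All (_≡ 1) l) ⊎ (h ≡ 1 × OneFour l)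
OneFour-∷⁻ (four a) = inj₁ (refl , a)
OneFour-∷⁻ (one o)  = inj₂ (refl , o)

OneFour-↭ : ∀ {l l'} → l ↭ l' → OneFour l → OneFour l'
OneFour-↭ refl o = o
OneFour-↭ (prep x p) (four a) = four (Perm.All-resp-↭ p a)
OneFour-↭ (prep x p) (one o)  = one (OneFour-↭ p o)
OneFour-↭ (swap x y p) (four (refl ∷ a))  = one (four (Perm.All-resp-↭ p a))
OneFour-↭ (swap x y p) (one (four a))     = four (refl ∷ Perm.All-resp-↭ p a)
OneFour-↭ (swap x y p) (one (one o))      = one (one (OneFour-↭ p o))
OneFour-↭ (↭.trans p q) o = OneFour-↭ q (OneFour-↭ p o)

insertDesc-↭ : ∀ x l → x ∷ l ↭ insertDesc x l
insertDesc-↭ x []      = refl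
insertDesc-↭ x (y ∷ l) with y <ᵇ x
... | true  = refl
... | false = ↭-trans (swap x y refl) (prep y (insertDesc-↭ x l))

sortDesc-↭ : ∀ l → l ↭ sortDesc l
sortDesc-↭ []      = refl
sortDesc-↭ (x ∷ l) = ↭-trans (prep x (sortDesc-↭ l)) (insertDesc-↭ x (sortDesc l))

listEqᵇ-sound : ∀ l m → listEqᵇ l m ≡ true → l ≡ m
listEqᵇ-sound []      []      e = refl
listEqᵇ-sound (x ∷ l) (y ∷ m) e with x ≡ᵇ y in xy
... | true = cong₂ _∷_ (≡ᵇ-true xy) (listEqᵇ-sound l m e)

listEqᵇ-refl : ∀ l → listEqᵇ l l ≡ true
listEqᵇ-refl []      = refl
listEqᵇ-refl (x ∷ l) rewrite ≡ᵇ-refl x = listEqᵇ-refl l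

replicate-ones : ∀ k → All (_≡ 1) (replicate k 1)
replicate-ones zero    = []
replicate-ones (suc k) = refl ∷ replicate-ones k

insertDesc-ones : ∀ k → insertDesc 1 (replicate k 1) ≡ replicate (suc k) 1
insertDesc-ones zero    = refl
insertDesc-ones (suc k) = cong (1 ∷_) (insertDesc-ones k)

sortDesc-ones : ∀ {l} → All (_≡ 1) l → sortDesc l ≡ replicate (length l) 1
sortDesc-ones []             = refl
sortDesc-ones (_∷_ {xs = l} refl a) = trans (cong (insertDesc 1) (sortDesc-ones a)) (insertDesc-ones (length l))

sortDesc-OneFour : ∀ {l k} → OneFour l → length l ≡ suc k → sortDesc l ≡ 4 ∷ replicate k 1
sortDesc-OneFour (four a) refl = trans (cong (insertDesc 4) (sortDesc-ones a)) (top _)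
  where
  top : ∀ k → insertDesc 4 (replicate k 1) ≡ 4 ∷ replicate k 1
  top zero    = refl
  top (suc k) = refl
sortDesc-OneFour {k = zero}  (one {[]} ()) e
sortDesc-OneFour {k = suc k} (one o) e =
  trans (cong (insertDesc 1) (sortDesc-OneFour o (ℕ.suc-injective e))) (cong (4 ∷_) (insertDesc-ones k))

-- Counting points ties the number of cycles to the number of points, which is needed to know how
-- many ones the cycle type has.
unvisited : List ℕ → List ℕ → ℕ
unvisited vis []       = 0
unvisited vis (y ∷ ys) = if memb y vis then unvisited vis ys else suc (unvisited vis ys)

unvisited-∉ : ∀ {y} vis ys → y ∉ ys → unvisited (y ∷ vis) ys ≡ unvisited vis ys
unvisited-∉ vis []       h = refl
unvisited-∉ {y} vis (z ∷ ys) h rewrite ≡ᵇ-≢ {y} {z} (λ e → h (here e)) with memb z vis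
... | true  = unvisited-∉ vis ys (h ∘ there)
... | false = cong suc (unvisited-∉ vis ys (h ∘ there))

unvisited-∈ : ∀ {y vis ys} → Unique ys → y ∈ ys → y ∉ vis → unvisited vis ys ≡ suc (unvisited (y ∷ vis) ys)
unvisited-∈ {y} {vis} {_ ∷ ys} (y∉ ∷ u) (here refl) h rewrite ≡ᵇ-refl y | ∉-memb h =
  cong suc (sym (unvisited-∉ vis ys (λ i → All.lookup y∉ i refl)))
unvisited-∈ {y} {vis} {z ∷ ys} (z∉ ∷ u) (there i) h rewrite ≡ᵇ-≢ {y} {z} (λ e → All.lookup z∉ i (sym e)) with memb z vis
... | true  = unvisited-∈ u i h
... | false = cong suc (unvisited-∈ u i h)

unvisited-++ : ∀ {vis ys} R → Unique ys → Unique R → (∀ z → z ∈ R → z ∈ ys × z ∉ vis) →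
               unvisited vis ys ≡ length R ℕ.+ unvisited (R ++ vis) ys
unvisited-++ []      uy uR h = refl
unvisited-++ {vis} {ys} (r ∷ R) uy (r∉ ∷ uR) h = begin
  unvisited vis ys                            ≡⟨ unvisited-++ R uy uR (λ z i → h z (there i)) ⟩
  length R ℕ.+ unvisited (R ++ vis) ys        ≡⟨ cong (length R ℕ.+_) (unvisited-∈ uy (proj₁ (h r (here refl))) fresh) ⟩
  length R ℕ.+ suc (unvisited (r ∷ R ++ vis) ys) ≡⟨ ℕ.+-suc (length R) _ ⟩
  suc (length R) ℕ.+ unvisited (r ∷ R ++ vis) ys ∎
  where
  fresh : r ∉ R ++ vis
  fresh i with ∈-++⁻ R i
  ... | inj₁ k = All.lookup r∉ k refl
  ... | inj₂ k = proj₂ (h r (here refl)) k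

module WalkType {p q : ℕ → ℕ} {xs : List ℕ} (uxs : Unique xs) (Pp : Pairing xs p) (Qq : Pairing xs q) (g : ℕ) where
  open Walk uxs Pp Qq g

  private
    _⊆xs : List ℕ → Set
    ys ⊆xs = ∀ {z} → z ∈ ys → z ∈ xs

  common-p : ∀ {y} → y ∈ xs → p y ≡ q y → p (p y) ≡ q (p y)
  common-p i e = trans (P.invol i) (sym (trans (cong q e) (Q.invol i)))

  -- `S` is a property shared by all visited points. Behind an octagon a visited point need not lie
  -- on a common edge, so there `S` also admits the vertices.
  ones-common : ∀ (S : ℕ → Set) → (∀ z → z ∈ xs → p z ≡ q z → S z) → ∀ ys vis → ys ⊆xs → All (_≡ 1) (walk vis ys) →
                (∀ z → z ∈ vis → S z) → ∀ z → z ∈ ys → S z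
  ones-common S cS (y ∷ ys) vis sub a hv z i with memb y vis in e
  ones-common S cS (y ∷ ys) vis sub a hv z (here refl) | true = hv y (memb-∈ y vis e)
  ones-common S cS (y ∷ ys) vis sub a hv z (there i)   | true = ones-common S cS ys vis (sub ∘ there) a hv z i
  ones-common S cS (y ∷ ys) vis sub (h ∷ a) hv z i | false = go i
    where
    y∈ = sub (here refl)
    cy : p y ≡ q y
    cy = half-1 y∈ h
    hv' : ∀ z → z ∈ trail y ++ vis → S z
    hv' z k with ∈-++⁻ (trail y) k
    ... | inj₂ k' = hv z k'
    ... | inj₁ k' with subst (z ∈_) (trail-2 y∈ cy) k'
    ... | here refl         = cS z y∈ cy
    ... | there (here refl) = cS z (P.closed y∈) (common-p y∈ cy)
    go : z ∈ y ∷ ys → S z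
    go (here refl) = cS y y∈ cy
    go (there k)   = ones-common S cS ys _ (sub ∘ there) a hv' z k

  four-vertex : ∀ ys vis → ys ⊆xs → OneFour (walk vis ys) → (∀ z → z ∈ vis → p z ≡ q z) →
                ∃ λ x → x ∈ ys × ⌊ length (trail x) /2⌋ ≡ 4 × (∀ z → z ∈ ys → z ∈ vertices₈ x ⊎ p z ≡ q z)
  four-vertex (y ∷ ys) vis sub o hv with memb y vis in e
  ... | true =
    let x , i , h , f = four-vertex ys vis (sub ∘ there) o hv in
    x , there i , h , λ { z (here refl) → inj₂ (hv z (memb-∈ z vis e)) ; z (there k) → f z k }
  ... | false with OneFour-∷⁻ o
  ... | inj₁ (h , a) = y , here refl , h , λ { z (here refl) → inj₁ (here refl) ; z (there k) →
    ones-common (λ z → z ∈ vertices₈ y ⊎ p z ≡ q z) (λ _ _ c → inj₂ c) ys _ (sub ∘ there) a seen z k }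
    where
    seen : ∀ z → z ∈ trail y ++ vis → z ∈ vertices₈ y ⊎ p z ≡ q z
    seen z k with ∈-++⁻ (trail y) k
    ... | inj₁ k' = inj₁ (subst (z ∈_) (proj₂ (proj₂ (half-4 y (sub (here refl)) h))) k')
    ... | inj₂ k' = inj₂ (hv z k')
  ... | inj₂ (h , o') =
    let x , i , h' , f = four-vertex ys _ (sub ∘ there) o' hv' in
    x , there i , h' , λ { z (here refl) → inj₂ cy ; z (there k) → f z k }
    where
    y∈ = sub (here refl)
    cy : p y ≡ q y
    cy = half-1 y∈ h
    hv' : ∀ z → z ∈ trail y ++ vis → p z ≡ q z
    hv' z k with ∈-++⁻ (trail y) k
    ... | inj₂ k' = hv z k'
    ... | inj₁ k' with subst (z ∈_) (trail-2 y∈ cy) k'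
    ... | here refl         = cy
    ... | there (here refl) = common-p y∈ cy

  walk⇒octagon : OneFour (walk [] xs) → ∃₂ λ x l → OctagonAt {p} {q} {xs} x l
  walk⇒octagon o =
    let x , i , h , f = four-vertex xs [] id o (λ _ ())
        u , oct , _ = half-4 x i h
    in x , _ , octagonAt (oct (λ z k z∉ → case f z k of λ { (inj₁ v) → ⊥-elim (z∉ v) ; (inj₂ c) → c })) refl

  module _ {x l} (o : OctagonAt {p} {q} {xs} x l) where

    ∈-octagon-p : ∀ {z} → z ∈ l → p z ∈ l
    ∈-octagon-p i = let oct = OctagonAt-∈ o i in
      Perm.∈-resp-↭ (OctagonAt.vertices oct) (there (here (Octagon.p₁ (OctagonAt.octagon oct))))

    ∉-octagon : ∀ {z} → z ∈ xs → z ∉ l → p z ≡ q z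
    ∉-octagon {z} i z∉ = Octagon.others (OctagonAt.octagon o) z i (z∉ ∘ Perm.∈-resp-↭ (OctagonAt.vertices o))

    private
      -- Closure of the visited points under `p` ensures that the partner of a fresh point is fresh.
      record Inv (vis ys : List ℕ) : Set where
        field
          sub    : ys ⊆xs
          uniq   : Unique ys
          cover  : ∀ {z} → z ∈ xs → z ∈ vis ⊎ z ∈ ys
          p-vis  : ∀ {z} → z ∈ vis → p z ∈ vis

      open Inv

      skip : ∀ {vis y ys} → Inv vis (y ∷ ys) → y ∈ vis → Inv vis ys
      skip I y∈ with uniq I
      ... | _ ∷ u = record { sub = sub I ∘ there ; uniq = u ; p-vis = p-vis I ; cover = λ i → drop (cover I i) }
        where
        drop : ∀ {z} → z ∈ _ ⊎ z ∈ _ → z ∈ _ ⊎ z ∈ _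
        drop (inj₁ k)           = inj₁ k
        drop (inj₂ (here refl)) = inj₁ y∈
        drop (inj₂ (there k))   = inj₂ k

      enter : ∀ {vis y ys} → Inv vis (y ∷ ys) → ∀ R → (∀ {z} → z ∈ y ∷ R → p z ∈ y ∷ R) → Inv (y ∷ R ++ vis) ys
      enter {vis} {y} {ys} I R pR with uniq I
      ... | _ ∷ u = record { sub = sub I ∘ there ; uniq = u ; p-vis = pv ; cover = λ i → grow (cover I i) }
        where
        pv : ∀ {z} → z ∈ y ∷ R ++ vis → p z ∈ y ∷ R ++ vis
        pv k with ∈-++⁻ (y ∷ R) k
        ... | inj₁ k' = ∈-++⁺ˡ (pR k')
        ... | inj₂ k' = ∈-++⁺ʳ (y ∷ R) (p-vis I k')
        grow : ∀ {z} → z ∈ vis ⊎ z ∈ y ∷ ys → z ∈ y ∷ R ++ vis ⊎ z ∈ ys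
        grow (inj₁ k)           = inj₁ (∈-++⁺ʳ (y ∷ R) k)
        grow (inj₂ (here refl)) = inj₁ (here refl)
        grow (inj₂ (there k))   = inj₂ k

      count : ∀ {vis y ys} → Inv vis (y ∷ ys) → ∀ R → Unique (y ∷ R) → (∀ z → z ∈ R → z ∈ xs × z ∉ vis) →
              suc (unvisited vis ys) ≡ suc (length R) ℕ.+ unvisited (y ∷ R ++ vis) ys
      count {vis} {y} {ys} I R (y∉R ∷ uR) h with uniq I
      ... | y∉ ∷ u = cong suc (trans (unvisited-++ R u uR later)
        (cong (length R ℕ.+_) (sym (unvisited-∉ (R ++ vis) ys (λ k → All.lookup y∉ k refl)))))
        where
        later : ∀ z → z ∈ R → z ∈ ys × z ∉ vis
        later z k with cover I (proj₁ (h z k))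
        ... | inj₁ v           = ⊥-elim (proj₂ (h z k) v)
        ... | inj₂ (here refl) = ⊥-elim (All.lookup y∉R k refl)
        ... | inj₂ (there k')  = k' , proj₂ (h z k)

      module Common {vis y ys} (I : Inv vis (y ∷ ys)) (y∉vis : y ∉ vis) (y∉l : y ∉ l) where
        y∈ : y ∈ xs
        y∈ = sub I (here refl)
        cy : p y ≡ q y
        cy = ∉-octagon y∈ y∉l
        trail-y : trail y ≡ y ∷ p y ∷ []
        trail-y = trail-2 y∈ cy
        py∉vis : p y ∉ vis
        py∉vis k = y∉vis (subst (_∈ vis) (P.invol y∈) (p-vis I k))
        inv' : Inv (y ∷ p y ∷ vis) ys
        inv' = enter I (p y ∷ []) λ { (here refl) → there (here refl) ; (there (here refl)) → here (P.invol y∈) }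
        count' : suc (unvisited vis ys) ≡ 2 ℕ.+ unvisited (y ∷ p y ∷ vis) ys
        count' = count I (p y ∷ []) (((λ e → P.moves y∈ (sym e)) ∷ []) ∷ ([] ∷ []))
          λ { z (here refl) → P.closed y∈ , py∉vis }
        py∉l : p y ∉ l
        py∉l k = y∉l (subst (_∈ l) (P.invol y∈) (∈-octagon-p k))

      ones-walk : ∀ ys vis → Inv vis ys → (∀ z → z ∈ l → z ∈ vis) →
                  All (_≡ 1) (walk vis ys) × unvisited vis ys ≡ double (length (walk vis ys))
      ones-walk []       vis I h = [] , refl
      ones-walk (y ∷ ys) vis I h with memb y vis in e
      ... | true  = ones-walk ys vis (skip I (memb-∈ y vis e)) h
      ... | false = result
        where
        open Common I (memb-∉ y vis e) (λ k → memb-∉ y vis e (h y k))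
        result : All (_≡ 1) (⌊ length (trail y) /2⌋ ∷ walk (trail y ++ vis) ys) ×
                 suc (unvisited vis ys) ≡ double (suc (length (walk (trail y ++ vis) ys)))
        result = subst (λ t → All (_≡ 1) (⌊ length t /2⌋ ∷ walk (t ++ vis) ys) ×
                             suc (unvisited vis ys) ≡ double (suc (length (walk (t ++ vis) ys)))) (sym trail-y)
          (let a , c = ones-walk ys (y ∷ p y ∷ vis) inv' (λ z k → there (there (h z k))) in
           refl ∷ a , trans count' (cong (suc ∘ suc) c))

      -- The octagon is visited as a whole: as long as none of its vertices has been met only common
      -- edges occur, and afterwards `ones-walk` applies.
      four-walk : ∀ ys vis → Inv vis ys → (∀ z → z ∈ l → z ∉ vis) → ∃ λ k →
                  OneFour (walk vis ys) × length (walk vis ys) ≡ suc k × unvisited vis ys ≡ double (4 ℕ.+ k)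
      four-walk []       vis I h = ⊥-elim (nowhere (cover I (All.lookup (Octagon.members oct) (here refl))))
        where
        oct = OctagonAt.octagon o
        nowhere : x ∈ vis ⊎ x ∈ [] → ⊥
        nowhere (inj₁ k) = h x (Perm.∈-resp-↭ (OctagonAt.vertices o) (here refl)) k
      four-walk (y ∷ ys) vis I h with memb y vis in e
      ... | true  = four-walk ys vis (skip I (memb-∈ y vis e)) h
      ... | false with memb y l in ey
      ... | false = result
        where
        open Common I (memb-∉ y vis e) (memb-∉ y l ey)
        h' : ∀ z → z ∈ l → z ∉ y ∷ p y ∷ vis
        h' z k (here refl)         = memb-∉ y l ey k
        h' z k (there (here refl)) = py∉l k
        h' z k (there (there v))   = h z k v
        result : ∃ λ k → OneFour (⌊ length (trail y) /2⌋ ∷ walk (trail y ++ vis) ys) ×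
                 suc (length (walk (trail y ++ vis) ys)) ≡ suc k × suc (unvisited vis ys) ≡ double (4 ℕ.+ k)
        result = subst (λ t → ∃ λ k → OneFour (⌊ length t /2⌋ ∷ walk (t ++ vis) ys) ×
                 suc (length (walk (t ++ vis) ys)) ≡ suc k × suc (unvisited vis ys) ≡ double (4 ℕ.+ k)) (sym trail-y)
          (let k , f , len , c = four-walk ys (y ∷ p y ∷ vis) inv' h' in
           suc k , one f , cong suc len , trans count' (cong (suc ∘ suc) c))
      ... | true = result
        where
        y∈l = memb-∈ y l ey
        oy = OctagonAt-∈ o y∈l
        open OctagonAt oy
        open Octagon octagon using (distinct; members)
        R = b₁ ∷ a₂ ∷ b₂ ∷ a₃ ∷ b₃ ∷ a₄ ∷ b₄ ∷ []
        pR : ∀ {z} → z ∈ y ∷ R → p z ∈ y ∷ R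
        pR k = Perm.∈-resp-↭ (↭-sym vertices) (∈-octagon-p (Perm.∈-resp-↭ vertices k))
        fresh : ∀ z → z ∈ R → z ∈ xs × z ∉ vis
        fresh z k = All.lookup members (there k) , h z (Perm.∈-resp-↭ vertices (there k))
        result : ∃ λ k → OneFour (⌊ length (trail y) /2⌋ ∷ walk (trail y ++ vis) ys) ×
                 suc (length (walk (trail y ++ vis) ys)) ≡ suc k × suc (unvisited vis ys) ≡ double (4 ℕ.+ k)
        result = subst (λ t → ∃ λ k → OneFour (⌊ length t /2⌋ ∷ walk (t ++ vis) ys) ×
                 suc (length (walk (t ++ vis) ys)) ≡ suc k × suc (unvisited vis ys) ≡ double (4 ℕ.+ k)) (sym (trail-8 octagon))
          (let a , c = ones-walk ys (y ∷ R ++ vis) (enter I R pR) (λ z k → ∈-++⁺ˡ (Perm.∈-resp-↭ (↭-sym vertices) k)) in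
           _ , four a , refl , trans (count I R distinct fresh) (cong (8 ℕ.+_) c))

    octagon⇒walk : ∃ λ k → OneFour (walk [] xs) × length (walk [] xs) ≡ suc k × length xs ≡ double (4 ℕ.+ k)
    octagon⇒walk =
      let k , f , len , c = four-walk xs [] (record { sub = id ; uniq = uxs ; cover = inj₂ ; p-vis = λ () }) (λ _ _ ())
      in k , f , len , trans (sym (all-unvisited xs)) c
      where
      all-unvisited : ∀ ys → unvisited [] ys ≡ length ys
      all-unvisited []       = refl
      all-unvisited (y ∷ ys) = cong suc (all-unvisited ys)

-- The adjacency matrix as a neighbour sum

opaque
  unfolding ∑opick

  ∑opick-∑ : (m : List (A × A)) (ys : List B) (F : B → A × A → List (A × A) → ℚ) →
             ∑opick m (λ e r → ∑ ys (λ y → F y e r)) ≡ ∑ ys (λ y → ∑opick m (F y))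
  ∑opick-∑ m ys F = trans (∑pick-cong m (λ e r _ → sym (∑-+ ys _ _))) (∑pick-∑ m ys _)

  ∑opick-≈ : {m m' : List (A × A)} {G : A × A → List (A × A) → ℚ} →
             (∀ e {r r'} → r ≈ r' → G e r ≡ G e r') → m ≈ m' → ∑opick m G ≡ ∑opick m' G
  ∑opick-≈ inv ≈-refl = refl
  ∑opick-≈ {G = G} inv (≈-prep e {m} {m'} p) = trans (∑pick-∷ e m _) (trans
    (cong₂ _+_ (cong₂ _+_ (inv e p) (inv (proj₂ e , proj₁ e) p)) (∑opick-≈ (λ f q → inv f (≈-prep e q)) p))
    (sym (∑pick-∷ e m' _)))
  ∑opick-≈ inv (≈-swap e f) =
    ∑pick-↭ (λ g q → cong₂ _+_ (inv g (↭⇒≈ q)) (inv (proj₂ g , proj₁ g) (↭⇒≈ q))) (swap e f refl)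
  ∑opick-≈ {G = G} inv (≈-flip a b {m}) = trans (∑pick-∷ (a , b) m _) (trans
    (cong₂ _+_ (ℚ.+-comm (G (a , b) m) (G (b , a) m))
      (∑pick-cong m (λ e r _ → cong₂ _+_ (inv e (≈-flip a b)) (inv (proj₂ e , proj₁ e) (≈-flip a b)))))
    (sym (∑pick-∷ (b , a) m _)))
  ∑opick-≈ inv (≈-trans p q) = trans (∑opick-≈ inv p) (∑opick-≈ inv q)

∑opick-zero : (m : List (A × A)) {G : A × A → List (A × A) → ℚ} → (∀ e r → e ∷ r ≈ m → G e r ≡ 0ℚ) → ∑opick m G ≡ 0ℚ
∑opick-zero m h = trans (∑opick-cong m h) (trans (∑opick-const m 0ℚ) (ℚ.*-zeroʳ (fromℕ (double (length m)))))

module _ {V : Matching → ℚ} (inv : HInv V) where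

  ∑nbr₁ : ℕ × ℕ → ℕ × ℕ → ℕ × ℕ → Matching → ℚ
  ∑nbr₁ e₁ e₂ e₃ r₃ = ∑opick r₃ (λ e₄ r → V (rot (e₁ ∷ e₂ ∷ e₃ ∷ e₄ ∷ r)))

  ∑nbr₂ : ℕ × ℕ → ℕ × ℕ → Matching → ℚ
  ∑nbr₂ e₁ e₂ r₂ = ∑opick r₂ (∑nbr₁ e₁ e₂)

  ∑nbr₃ : ℕ × ℕ → Matching → ℚ
  ∑nbr₃ e₁ r₁ = ∑opick r₁ (∑nbr₂ e₁)

  ∑nbr₁-≈ : ∀ e₁ e₂ e₃ {r r'} → r ≈ r' → ∑nbr₁ e₁ e₂ e₃ r ≡ ∑nbr₁ e₁ e₂ e₃ r'
  ∑nbr₁-≈ e₁ e₂ e₃ = ∑opick-≈ (λ e₄ q → inv (≈-prep _ (≈-prep _ (≈-prep _ (≈-prep _ q)))))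

  ∑nbr₂-≈ : ∀ e₁ e₂ {r r'} → r ≈ r' → ∑nbr₂ e₁ e₂ r ≡ ∑nbr₂ e₁ e₂ r'
  ∑nbr₂-≈ e₁ e₂ = ∑opick-≈ (∑nbr₁-≈ e₁ e₂)

  ∑nbr₃-≈ : ∀ e₁ {r r'} → r ≈ r' → ∑nbr₃ e₁ r ≡ ∑nbr₃ e₁ r'
  ∑nbr₃-≈ e₁ = ∑opick-≈ (∑nbr₂-≈ e₁)

  ∑nbr-HInv : HInv (∑nbr V)
  ∑nbr-HInv = ∑opick-≈ ∑nbr₃-≈

inside-partner : ∀ q {r z} → inside q r ≡ true → Unique (flat r) → z ∈ flat r → q z ≡ partner r z
inside-partner q {(a , b) ∷ r} {z} e ((a≢b ∷ _) ∷ _) (here refl) =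
  trans (≡ᵇ-true (proj₁ (∧-true {q a ≡ᵇ b} (proj₁ (∧-true e))))) (sym (partner-fst a b r))
inside-partner q {(a , b) ∷ r} {z} e ((a≢b ∷ _) ∷ _) (there (here refl)) =
  trans (≡ᵇ-true (proj₂ (∧-true {q a ≡ᵇ b} (proj₁ (∧-true e))))) (sym (partner-snd r (a≢b ∘ sym)))
inside-partner q {(a , b) ∷ r} {z} e ((_ ∷ a∉) ∷ (b∉ ∷ u)) (there (there i)) =
  trans (inside-partner q (proj₂ (∧-true {(q a ≡ᵇ b) ∧ (q b ≡ᵇ a)} e)) u i)
    (sym (partner-≢ r (λ f → All.lookup a∉ i (sym f)) (λ f → All.lookup b∉ i (sym f))))

partner-inside : ∀ q r → Unique (flat r) → (∀ z → z ∈ flat r → q z ≡ partner r z) → inside q r ≡ true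
partner-inside q []            u h = refl
partner-inside q ((a , b) ∷ r) ((a≢b ∷ a∉) ∷ (b∉ ∷ u)) h
  rewrite trans (h a (here refl)) (partner-fst a b r) | trans (h b (there (here refl))) (partner-snd r (a≢b ∘ sym))
        | ≡ᵇ-refl a | ≡ᵇ-refl b =
  partner-inside q r u (λ z i → trans (h z (there (there i)))
    (partner-≢ r (λ f → All.lookup a∉ i (sym f)) (λ f → All.lookup b∉ i (sym f))))

-- Applied where `Q` prescribes the starting point of the next chosen edge, which fixes both the
-- edge and its orientation.
∑opick-select : ∀ {a b m} {H : ℕ × ℕ → Matching → ℚ} → Unique (a ∷ b ∷ flat m) →
                (∀ c d r → c ≢ a → H (c , d) r ≡ 0ℚ) → ∑opick ((a , b) ∷ m) H ≡ H (a , b) m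
∑opick-select {a} {b} {m} {H} ((a≢b ∷ a∉) ∷ _) h = begin
  ∑opick ((a , b) ∷ m) H
    ≡⟨ trans (∑opick-def _ H) (∑pick-∷ (a , b) m _) ⟩
  H (a , b) m + H (b , a) m + ∑pick m (λ e r → H e ((a , b) ∷ r) + H (proj₂ e , proj₁ e) ((a , b) ∷ r))
    ≡⟨ cong₂ (λ s t → H (a , b) m + s + t) (h b a m (a≢b ∘ sym))
         (∑pick-zero m (λ { (c , d) r p → cong₂ _+_ (h c d _ (away (flat-≈ (↭⇒≈ p)) (here refl)))
                                                    (h d c _ (away (flat-≈ (↭⇒≈ p)) (there (here refl)))) })) ⟩
  H (a , b) m + 0ℚ + 0ℚ
    ≡⟨ trans (ℚ.+-identityʳ _) (ℚ.+-identityʳ _) ⟩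
  H (a , b) m ∎
  where
  away : ∀ {l z} → l ↭ flat m → z ∈ l → z ≢ a
  away p i e = All.lookup a∉ (Perm.∈-resp-↭ p i) (sym e)

edge-out′ : ∀ {m z w} → Unique (flat m) → z ∈ flat m → partner m z ≡ w → ∃ λ r → m ≈ (z , w) ∷ r × Unique (z ∷ w ∷ flat r) ×
            (∀ y → y ≢ z → y ≢ w → partner r y ≡ partner m y) × (∀ y → y ≢ z → y ≢ w → y ∈ flat m → y ∈ flat r)
edge-out′ {m} {z} u i refl = let r , p = edge-out m u i in
  r , p , Unique-↭ (flat-≈ p) u , (λ y y≢z y≢w → trans (sym (partner-≢ r y≢z y≢w)) (sym (partner-≈ p u y))) ,
  (λ y y≢z y≢w j → drop y≢z y≢w (Perm.∈-resp-↭ (flat-≈ p) j))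
  where
  drop : ∀ {y z w l} → y ≢ z → y ≢ w → y ∈ z ∷ w ∷ l → y ∈ l
  drop y≢z y≢w (here e)          = ⊥-elim (y≢z e)
  drop y≢z y≢w (there (here e))  = ⊥-elim (y≢w e)
  drop y≢z y≢w (there (there k)) = k

rot-flat : ∀ e₁ e₂ e₃ e₄ r → flat (rot (e₁ ∷ e₂ ∷ e₃ ∷ e₄ ∷ r)) ↭ flat (e₁ ∷ e₂ ∷ e₃ ∷ e₄ ∷ r)
rot-flat (a₁ , b₁) (a₂ , b₂) (a₃ , b₃) (a₄ , b₄) r =
  ↭-sym (Perm.shifts (a₁ ∷ []) (b₁ ∷ a₂ ∷ b₂ ∷ a₃ ∷ b₃ ∷ a₄ ∷ b₄ ∷ []) {flat r})

partner-skip : ∀ {a₁ b₁ a₂ b₂ a₃ b₃ a₄ b₄ z} r → z ∉ a₁ ∷ b₁ ∷ a₂ ∷ b₂ ∷ a₃ ∷ b₃ ∷ a₄ ∷ b₄ ∷ [] →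
               partner ((a₁ , b₁) ∷ (a₂ , b₂) ∷ (a₃ , b₃) ∷ (a₄ , b₄) ∷ r) z ≡ partner r z
partner-skip {a₁} {b₁} {a₂} {b₂} {a₃} {b₃} {a₄} {b₄} r z∉ = trans
  (partner-≢ ((a₂ , b₂) ∷ (a₃ , b₃) ∷ (a₄ , b₄) ∷ r) (λ e → z∉ (here e)) (λ e → z∉ (there (here e)))) (trans
  (partner-≢ ((a₃ , b₃) ∷ (a₄ , b₄) ∷ r) (λ e → z∉ (there (there (here e)))) (λ e → z∉ (there (there (there (here e)))))) (trans
  (partner-≢ ((a₄ , b₄) ∷ r) (λ e → z∉ (there (there (there (there (here e)))))) (λ e → z∉ (there (there (there (there (there (here e))))))))
  (partner-≢ r (λ e → z∉ (there (there (there (there (there (there (here e)))))))) (λ e → z∉ (there (there (there (there (there (there (there (here e))))))))))))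

∑-memb : ∀ l xs → Unique xs → Unique l → (∀ {z} → z ∈ l → z ∈ xs) → ∑ xs (λ z → indicator (memb z l)) ≡ fromℕ (length l)
∑-memb []      xs ux u h = ∑-zero xs (λ _ → refl)
∑-memb (y ∷ l) xs ux (y∉ ∷ u) h = begin
  ∑ xs (λ z → indicator (memb z (y ∷ l)))
    ≡⟨ ∑-cong xs (λ z → ∨-split z) ⟩
  ∑ xs (λ z → indicator (y ≡ᵇ z) + indicator (memb z l))
    ≡⟨ ∑-+ xs _ _ ⟩
  ∑ xs (λ z → indicator (y ≡ᵇ z)) + ∑ xs (λ z → indicator (memb z l))
    ≡⟨ cong₂ _+_ (trans (∑-pick-one ux (h (here refl)) (λ z _ z≢y → cong indicator (≡ᵇ-≢ (z≢y ∘ sym)))) (cong indicator (≡ᵇ-refl y)))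
         (∑-memb l xs ux u (h ∘ there)) ⟩
  fromℕ (length (y ∷ l)) ∎
  where
  ∨-split : ∀ z → indicator ((y ≡ᵇ z) ∨ memb z l) ≡ indicator (y ≡ᵇ z) + indicator (memb z l)
  ∨-split z with y ≡ᵇ z in e
  ... | false = sym (ℚ.+-identityˡ _)
  ... | true  = cong (λ b → 1ℚ + indicator b) (sym (∉-memb (λ i → All.lookup y∉ i (≡ᵇ-true {y} e))))

module Neighbours {n g : ℕ} (fuel≡ : 2 ℕ.* n ≡ 5 ℕ.+ g) {P Q : Matching} (P∈ : P ∈ Ms n) (Q∈ : Q ∈ Ms n) where

  private
    xs = points n
    uxs = points-Unique n
    p = partner P
    q = partner Q
    fP = Ms-full n P∈
    uP : Unique (flat P)
    uP = Unique-↭ (↭-sym fP) uxs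
    Pp : Pairing xs p
    Pp = partner-Pairing uxs fP
    Qq : Pairing xs q
    Qq = partner-Pairing uxs (Ms-full n Q∈)

  open Walk uxs Pp Qq g
  open WalkType uxs Pp Qq g

  walk-cycles : ∀ ys vis → cycleHalfLengths n P Q vis ys ≡ walk vis ys
  walk-cycles []       vis = refl
  walk-cycles (y ∷ ys) vis with memb y vis
  ... | true  = walk-cycles ys vis
  ... | false = trans
    (cong (λ t → ⌊ length t /2⌋ ∷ cycleHalfLengths n P Q (t ++ vis) ys) (cong (λ f → orbit f p q y y) fuel≡))
    (cong (⌊ length (trail y) /2⌋ ∷_) (walk-cycles ys (trail y ++ vis)))

  related⇒octagon : listEqᵇ (cycleType n P Q) (hook4 n) ≡ true → ∃₂ λ x l → OctagonAt {p} {q} {xs} x l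
  related⇒octagon e = walk⇒octagon (subst OneFour (walk-cycles xs [])
    (OneFour-↭ (↭-sym (sortDesc-↭ (cycleHalfLengths n P Q [] xs)))
      (subst OneFour (sym (listEqᵇ-sound (cycleType n P Q) (hook4 n) e)) (four (replicate-ones (n ℕ.∸ 4))))))

  -- The number of ones in `hook4 n` is determined by n, and the point count `c` of the traversal
  -- gives the same number.
  octagon⇒related : ∀ {x l} → OctagonAt {p} {q} {xs} x l → listEqᵇ (cycleType n P Q) (hook4 n) ≡ true
  octagon⇒related o =
    let k , f , len , c = octagon⇒walk o
        n≡4+k = double-injective {n} {4 ℕ.+ k} (trans (sym (points-length n)) c)
        sorted = trans (cong sortDesc (walk-cycles xs [])) (sortDesc-OneFour f len)
    in trans (cong (λ l → listEqᵇ l (hook4 n)) (trans sorted (cong (λ i → 4 ∷ replicate i 1) (cong (ℕ._∸ 4) (sym n≡4+k)))))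
             (listEqᵇ-refl (hook4 n))

  -- The delta function at `Q`, so that `∑nbr I P` is eight times the matrix entry at `P` and `Q`.
  I : Matching → ℚ
  I m = indicator (inside q m)

  I-HInv : HInv I
  I-HInv e = cong indicator (inside-≈ q e)

  tuple⇒octagon : ∀ {a₁ b₁ a₂ b₂ a₃ b₃ a₄ b₄ r} → (a₁ , b₁) ∷ (a₂ , b₂) ∷ (a₃ , b₃) ∷ (a₄ , b₄) ∷ r ≈ P →
                  inside q ((b₁ , a₂) ∷ (b₂ , a₃) ∷ (b₃ , a₄) ∷ (b₄ , a₁) ∷ r) ≡ true →
                  Octagon p q xs a₁ b₁ a₂ b₂ a₃ b₃ a₄ b₄
  tuple⇒octagon {a₁} {b₁} {a₂} {b₂} {a₃} {b₃} {a₄} {b₄} {r} h t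
    with ∧-true {(q b₁ ≡ᵇ a₂) ∧ (q a₂ ≡ᵇ b₁)} t
  ... | t₁ , t with ∧-true {(q b₂ ≡ᵇ a₃) ∧ (q a₃ ≡ᵇ b₂)} t
  ... | t₂ , t with ∧-true {(q b₃ ≡ᵇ a₄) ∧ (q a₄ ≡ᵇ b₃)} t
  ... | t₃ , t with ∧-true {(q b₄ ≡ᵇ a₁) ∧ (q a₁ ≡ᵇ b₄)} t
  ... | t₄ , tr = record
    { p₁ = proj₁ e₁ ; p₂ = proj₁ e₂ ; p₃ = proj₁ e₃ ; p₄ = proj₁ e₄
    ; p₁' = proj₂ e₁ ; p₂' = proj₂ e₂ ; p₃' = proj₂ e₃ ; p₄' = proj₂ e₄
    ; q₁ = fst t₁ ; q₂ = fst t₂ ; q₃ = fst t₃ ; q₄ = fst t₄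
    ; q₁' = snd t₁ ; q₂' = snd t₂ ; q₃' = snd t₃ ; q₄' = snd t₄
    ; distinct = Unique.take⁺ 8 u ; members = All.tabulate (λ i → Perm.∈-resp-↭ full (∈-++⁺ˡ i))
    ; others = λ z i z∉ → outside z z∉ (Perm.∈-resp-↭ (↭-sym full) i) }
    where
    full : flat ((a₁ , b₁) ∷ (a₂ , b₂) ∷ (a₃ , b₃) ∷ (a₄ , b₄) ∷ r) ↭ xs
    full = ↭-trans (flat-≈ h) fP
    u : Unique (flat ((a₁ , b₁) ∷ (a₂ , b₂) ∷ (a₃ , b₃) ∷ (a₄ , b₄) ∷ r))
    u = Unique-↭ (↭-sym full) uxs
    fst : ∀ {a b} → (q a ≡ᵇ b) ∧ (q b ≡ᵇ a) ≡ true → q a ≡ b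
    fst {a} {b} e = ≡ᵇ-true (proj₁ (∧-true {q a ≡ᵇ b} e))
    snd : ∀ {a b} → (q a ≡ᵇ b) ∧ (q b ≡ᵇ a) ≡ true → q b ≡ a
    snd {a} {b} e = ≡ᵇ-true (proj₂ (∧-true {q a ≡ᵇ b} e))
    e₁ = partner-edge uP (≈-sym h)
    e₂ = partner-edge uP (≈-trans (≈-sym h) (↭⇒≈ (Perm.shifts ((a₁ , b₁) ∷ []) ((a₂ , b₂) ∷ []))))
    e₃ = partner-edge uP (≈-trans (≈-sym h) (↭⇒≈ (Perm.shifts ((a₁ , b₁) ∷ (a₂ , b₂) ∷ []) ((a₃ , b₃) ∷ []))))
    e₄ = partner-edge uP (≈-trans (≈-sym h) (↭⇒≈ (Perm.shifts ((a₁ , b₁) ∷ (a₂ , b₂) ∷ (a₃ , b₃) ∷ []) ((a₄ , b₄) ∷ []))))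
    outside : ∀ z → z ∉ a₁ ∷ b₁ ∷ a₂ ∷ b₂ ∷ a₃ ∷ b₃ ∷ a₄ ∷ b₄ ∷ [] →
              z ∈ flat ((a₁ , b₁) ∷ (a₂ , b₂) ∷ (a₃ , b₃) ∷ (a₄ , b₄) ∷ r) → p z ≡ q z
    outside z z∉ i with ∈-++⁻ (a₁ ∷ b₁ ∷ a₂ ∷ b₂ ∷ a₃ ∷ b₃ ∷ a₄ ∷ b₄ ∷ []) i
    ... | inj₁ k = ⊥-elim (z∉ k)
    ... | inj₂ k = trans (partner-≈ (≈-sym h) uP z) (trans (partner-skip r z∉) (sym (inside-partner q tr (Unique.drop⁺ 8 u) k)))

  ∑nbr-unrelated : listEqᵇ (cycleType n P Q) (hook4 n) ≡ false → ∑nbr I P ≡ 0ℚ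
  ∑nbr-unrelated e = ∑opick-zero P (λ { (a₁ , b₁) r₁ h₁ → ∑opick-zero r₁ (λ { (a₂ , b₂) r₂ h₂ →
    ∑opick-zero r₂ (λ { (a₃ , b₃) r₃ h₃ → ∑opick-zero r₃ (λ { (a₄ , b₄) r h₄ →
      cong indicator (not-inside (≈-trans (≈-prep _ (≈-trans (≈-prep _ (≈-trans (≈-prep _ h₄) h₃)) h₂)) h₁)) }) }) }) })
    where
    not-inside : ∀ {a₁ b₁ a₂ b₂ a₃ b₃ a₄ b₄ r} → (a₁ , b₁) ∷ (a₂ , b₂) ∷ (a₃ , b₃) ∷ (a₄ , b₄) ∷ r ≈ P →
                 inside q ((b₁ , a₂) ∷ (b₂ , a₃) ∷ (b₃ , a₄) ∷ (b₄ , a₁) ∷ r) ≡ false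
    not-inside {a₁} {b₁} {a₂} {b₂} {a₃} {b₃} {a₄} {b₄} {r} h with inside q ((b₁ , a₂) ∷ (b₂ , a₃) ∷ (b₃ , a₄) ∷ (b₄ , a₁) ∷ r) in t
    ... | false = refl
    ... | true  = case trans (sym e) (octagon⇒related (octagonAt (tuple⇒octagon h t) refl)) of λ ()

  ¬inside-here : ∀ {u c} m → (q u ≡ᵇ c) ≡ false → inside q ((u , c) ∷ m) ≡ false
  ¬inside-here {u} {c} m e = cong (λ t → (t ∧ (q c ≡ᵇ u)) ∧ inside q m) e

  ¬inside-there : ∀ e m → inside q m ≡ false → inside q (e ∷ m) ≡ false
  ¬inside-there (u , c) m e = trans (cong (((q u ≡ᵇ c) ∧ (q c ≡ᵇ u)) ∧_) e) (Bool.∧-zeroʳ _)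

  module _ {x l} (o : OctagonAt {p} {q} {xs} x l) where

    -- From the end of each chosen edge `Q` leads to the start of the next, so exactly one
    -- continuation of (a , b) has `Q` as its rotation.
    at-vertex : ∀ {a b r₁} → (a , b) ∷ r₁ ≈ P → a ∈ l → ∑nbr₃ I-HInv (a , b) r₁ ≡ 1ℚ
    at-vertex {a} {b} {r₁} h a∈l with OctagonAt-∈ o a∈l
    ... | octagonAt {b₁} {a₂} {b₂} {a₃} {b₃} {a₄} {b₄} oct _
      with trans (sym (proj₁ (partner-edge uP (≈-sym h)))) (Octagon.p₁ oct)
    ... | refl with Octagon.distinct oct
    ... | (_ ∷ n₁ ∷ n₂ ∷ n₃ ∷ n₄ ∷ n₅ ∷ n₆ ∷ []) ∷ (m₁ ∷ m₂ ∷ m₃ ∷ m₄ ∷ m₅ ∷ m₆ ∷ []) ∷ (_ ∷ k₁ ∷ k₂ ∷ k₃ ∷ k₄ ∷ []) ∷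
          (l₁ ∷ l₂ ∷ l₃ ∷ l₄ ∷ []) ∷ (_ ∷ i₁ ∷ i₂ ∷ []) ∷ (j₁ ∷ j₂ ∷ []) ∷ _
      with Unique-↭ (flat-≈ (≈-sym h)) uP
    ... | ua@(_ ∷ (_ ∷ u₁)) with Octagon.members oct
    ... | _ ∷ _ ∷ a₂∈ ∷ _ ∷ a₃∈ ∷ _ ∷ a₄∈ ∷ _ ∷ [] = begin
      ∑opick r₁ (∑nbr₂ I-HInv (a , b))
        ≡⟨ ∑opick-≈ (∑nbr₂-≈ I-HInv (a , b)) (proj₁ (proj₂ s₂)) ⟩
      ∑opick ((a₂ , b₂) ∷ r₂) (∑nbr₂ I-HInv (a , b))
        ≡⟨ ∑opick-select (proj₁ (proj₂ (proj₂ s₂))) (λ c d r c≢ → ∑opick-zero r (λ e₃ r₃ _ → ∑opick-zero r₃ (λ e₄ r₄ _ →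
             cong indicator (¬inside-here ((d , proj₁ e₃) ∷ (proj₂ e₃ , proj₁ e₄) ∷ (proj₂ e₄ , a) ∷ r₄) (wrong (Octagon.q₁ oct) c≢))))) ⟩
      ∑opick r₂ (∑nbr₁ I-HInv (a , b) (a₂ , b₂))
        ≡⟨ ∑opick-≈ (∑nbr₁-≈ I-HInv (a , b) (a₂ , b₂)) (proj₁ (proj₂ s₃)) ⟩
      ∑opick ((a₃ , b₃) ∷ r₃) (∑nbr₁ I-HInv (a , b) (a₂ , b₂))
        ≡⟨ ∑opick-select (proj₁ (proj₂ (proj₂ s₃))) (λ c d r c≢ → ∑opick-zero r (λ e₄ r₄ _ →
             cong indicator (¬inside-there (b , a₂) ((b₂ , c) ∷ (d , proj₁ e₄) ∷ (proj₂ e₄ , a) ∷ r₄)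
               (¬inside-here ((d , proj₁ e₄) ∷ (proj₂ e₄ , a) ∷ r₄) (wrong (Octagon.q₂ oct) c≢))))) ⟩
      ∑opick r₃ (λ e₄ r → I (rot ((a , b) ∷ (a₂ , b₂) ∷ (a₃ , b₃) ∷ e₄ ∷ r)))
        ≡⟨ ∑opick-≈ (λ e₄ e → I-HInv (≈-prep _ (≈-prep _ (≈-prep _ (≈-prep _ e))))) (proj₁ (proj₂ s₄)) ⟩
      ∑opick ((a₄ , b₄) ∷ r₄) (λ e₄ r → I (rot ((a , b) ∷ (a₂ , b₂) ∷ (a₃ , b₃) ∷ e₄ ∷ r)))
        ≡⟨ ∑opick-select (proj₁ (proj₂ (proj₂ s₄))) (λ c d r c≢ → cong indicator
             (¬inside-there (b , a₂) ((b₂ , a₃) ∷ (b₃ , c) ∷ (d , a) ∷ r) (¬inside-there (b₂ , a₃) ((b₃ , c) ∷ (d , a) ∷ r)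
               (¬inside-here ((d , a) ∷ r) (wrong (Octagon.q₃ oct) c≢))))) ⟩
      I ((b , a₂) ∷ (b₂ , a₃) ∷ (b₃ , a₄) ∷ (b₄ , a) ∷ r₄)
        ≡⟨ cong indicator all-inside ⟩
      1ℚ ∎
      where
      open Octagon oct using (p₂; p₃; p₄; q₁; q₂; q₃; q₄; q₁'; q₂'; q₃'; q₄')
      on-P : ∀ {z} → z ∈ xs → z ≢ a → z ≢ b → z ∈ flat r₁ × partner r₁ z ≡ p z
      on-P {z} i z≢a z≢b = drop (Perm.∈-resp-↭ (↭-sym (↭-trans (flat-≈ h) fP)) i) ,
                           trans (sym (partner-≢ r₁ z≢a z≢b)) (partner-≈ h ua z)
        where
        drop : z ∈ a ∷ b ∷ flat r₁ → z ∈ flat r₁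
        drop (here e)          = ⊥-elim (z≢a e)
        drop (there (here e))  = ⊥-elim (z≢b e)
        drop (there (there k)) = k
      t₂ = on-P a₂∈ (n₁ ∘ sym) (m₁ ∘ sym)
      t₃ = on-P a₃∈ (n₃ ∘ sym) (m₃ ∘ sym)
      t₄ = on-P a₄∈ (n₅ ∘ sym) (m₅ ∘ sym)
      s₂ = edge-out′ u₁ (proj₁ t₂) (trans (proj₂ t₂) p₂)
      r₂ = proj₁ s₂
      restU : ∀ {z w l} → Unique (z ∷ w ∷ l) → Unique l
      restU (_ ∷ (_ ∷ v)) = v
      par₂ = proj₁ (proj₂ (proj₂ (proj₂ s₂)))
      mem₂ = proj₂ (proj₂ (proj₂ (proj₂ s₂)))
      s₃ = edge-out′ (restU (proj₁ (proj₂ (proj₂ s₂)))) (mem₂ a₃ (k₁ ∘ sym) (l₁ ∘ sym) (proj₁ t₃))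
             (trans (par₂ a₃ (k₁ ∘ sym) (l₁ ∘ sym)) (trans (proj₂ t₃) p₃))
      r₃ = proj₁ s₃
      par₃ = proj₁ (proj₂ (proj₂ (proj₂ s₃)))
      mem₃ = proj₂ (proj₂ (proj₂ (proj₂ s₃)))
      s₄ = edge-out′ (restU (proj₁ (proj₂ (proj₂ s₃))))
             (mem₃ a₄ (i₁ ∘ sym) (j₁ ∘ sym) (mem₂ a₄ (k₃ ∘ sym) (l₃ ∘ sym) (proj₁ t₄)))
             (trans (par₃ a₄ (i₁ ∘ sym) (j₁ ∘ sym)) (trans (par₂ a₄ (k₃ ∘ sym) (l₃ ∘ sym)) (trans (proj₂ t₄) p₄)))
      r₄ = proj₁ s₄
      whole : P ≈ (a , b) ∷ (a₂ , b₂) ∷ (a₃ , b₃) ∷ (a₄ , b₄) ∷ r₄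
      whole = ≈-trans (≈-sym h) (≈-prep _ (≈-trans (proj₁ (proj₂ s₂)) (≈-prep _ (≈-trans (proj₁ (proj₂ s₃)) (≈-prep _ (proj₁ (proj₂ s₄)))))))
      uw : Unique (flat ((a , b) ∷ (a₂ , b₂) ∷ (a₃ , b₃) ∷ (a₄ , b₄) ∷ r₄))
      uw = Unique-↭ (flat-≈ whole) uP
      wrong : ∀ {u v c} → q u ≡ v → c ≢ v → (q u ≡ᵇ c) ≡ false
      wrong refl c≢ = ≡ᵇ-≢ (c≢ ∘ sym)
      both : ∀ {u v} → q u ≡ v → q v ≡ u → (q u ≡ᵇ v) ∧ (q v ≡ᵇ u) ≡ true
      both {u} {v} e f = cong₂ _∧_ (trans (cong (_≡ᵇ v) e) (≡ᵇ-refl v)) (trans (cong (_≡ᵇ u) f) (≡ᵇ-refl u))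
      disjoint : ∀ {z} → z ∈ flat r₄ → z ∉ a ∷ b ∷ a₂ ∷ b₂ ∷ a₃ ∷ b₃ ∷ a₄ ∷ b₄ ∷ []
      disjoint {z} i k = unique-++ (a ∷ b ∷ a₂ ∷ b₂ ∷ a₃ ∷ b₃ ∷ a₄ ∷ b₄ ∷ []) uw k i
        where
        unique-++ : ∀ l {m} → Unique (l ++ m) → z ∈ l → z ∈ m → ⊥
        unique-++ (c ∷ l) (c∉ ∷ u) (here refl) j = All.lookup c∉ (∈-++⁺ʳ l j) refl
        unique-++ (c ∷ l) (c∉ ∷ u) (there i)   j = unique-++ l u i j
      all-inside : inside q ((b , a₂) ∷ (b₂ , a₃) ∷ (b₃ , a₄) ∷ (b₄ , a) ∷ r₄) ≡ true
      all-inside rewrite both q₁ q₁' | both q₂ q₂' | both q₃ q₃' | both q₄ q₄' =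
        partner-inside q r₄ (restU (proj₁ (proj₂ (proj₂ s₄)))) (λ z i →
          let z∉ = disjoint i
              z∈ = Perm.∈-resp-↭ (↭-trans (↭-sym (flat-≈ whole)) fP) (∈-++⁺ʳ (a ∷ b ∷ a₂ ∷ b₂ ∷ a₃ ∷ b₃ ∷ a₄ ∷ b₄ ∷ []) i)
          in trans (sym (Octagon.others oct z z∈ z∉)) (trans (partner-≈ whole uP z) (partner-skip r₄ z∉)))

    -- Off the octagon `Q` contains the edge {a,b} as well and leads from `b` back to `a`, which is
    -- never the start of the second chosen edge.
    off-vertex : ∀ {a b r₁} → (a , b) ∷ r₁ ≈ P → a ∉ l → ∑nbr₃ I-HInv (a , b) r₁ ≡ 0ℚ
    off-vertex {a} {b} {r₁} h a∉l = ∑opick-zero r₁ (λ { (c , d) r₂ h₂ → ∑opick-zero r₂ (λ e₃ r₃ _ → ∑opick-zero r₃ (λ e₄ r₄ _ →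
      cong indicator (¬inside-here ((d , proj₁ e₃) ∷ (proj₂ e₃ , proj₁ e₄) ∷ (proj₂ e₄ , a) ∷ r₄) (≡ᵇ-≢ {q b} {c} (λ e → apart (Perm.∈-resp-↭ (flat-≈ h₂) (here refl)) (trans (sym qb) e)))))) })
      where
      a∈ : a ∈ xs
      a∈ = Perm.∈-resp-↭ (↭-trans (flat-≈ h) fP) (here refl)
      qb : q b ≡ a
      qb = trans (cong q (trans (sym (proj₁ (partner-edge uP (≈-sym h)))) (∉-octagon o a∈ a∉l))) (Pairing.invol Qq a∈)
      apart : ∀ {c} → c ∈ flat r₁ → a ≢ c
      apart i with Unique-↭ (flat-≈ (≈-sym h)) uP
      ... | (_ ∷ a∉) ∷ _ = All.lookup a∉ i

    -- A starting vertex determines its edge of `P` and the orientation, so the contributing starts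
    -- correspond to the eight vertices.
    ∑nbr-octagon : ∑nbr I P ≡ fromℕ 8
    ∑nbr-octagon = begin
      ∑nbr I P
        ≡⟨ ∑opick-cong P (λ { (a , b) r₁ h → vertex? a b r₁ h }) ⟩
      ∑opick P (λ e _ → indicator (memb (proj₁ e) l))
        ≡⟨ ∑-flat P (λ z → indicator (memb z l)) ⟨
      ∑ (flat P) (λ z → indicator (memb z l))
        ≡⟨ ∑-↭ _ fP ⟩
      ∑ xs (λ z → indicator (memb z l))
        ≡⟨ ∑-memb l xs uxs (Unique-↭ vertices (Octagon.distinct octagon)) (λ i → All.lookup (Octagon.members octagon) (Perm.∈-resp-↭ (↭-sym vertices) i)) ⟩
      fromℕ (length l)
        ≡⟨ cong fromℕ (sym (Perm.↭-length vertices)) ⟩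
      fromℕ 8 ∎
      where
      open OctagonAt o using (octagon; vertices)
      vertex? : ∀ a b r₁ → (a , b) ∷ r₁ ≈ P → ∑nbr₃ I-HInv (a , b) r₁ ≡ indicator (memb a l)
      vertex? a b r₁ h with memb a l in e
      ... | true  = at-vertex h (memb-∈ a l e)
      ... | false = off-vertex h (memb-∉ a l e)

  ∑nbr-inside : ∑nbr I P ≡ fromℕ 8 * Aμ n (hook4 n) P Q
  ∑nbr-inside with listEqᵇ (cycleType n P Q) (hook4 n) in e
  ... | true  = let x , l , o = related⇒octagon e in ∑nbr-octagon o
  ... | false = ∑nbr-unrelated e

-- Both sides are linear in `F`, and `∑-reproduce` writes `F` as a combination of delta functions,
-- which reduces the claim to single entries.
∑nbr-applyA : ∀ {n g F P} → 2 ℕ.* n ≡ 5 ℕ.+ g → HInv F → P ∈ Ms n → ∑nbr F P ≡ fromℕ 8 * applyA n (hook4 n) F P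
∑nbr-applyA {n} {g} {F} {P} fuel≡ inv P∈ = begin
  ∑nbr F P
    ≡⟨ ∑opick-cong P (λ e₁ r₁ h₁ → ∑opick-cong r₁ (λ e₂ r₂ h₂ → ∑opick-cong r₂ (λ e₃ r₃ h₃ → ∑opick-cong r₃ (λ e₄ r h₄ →
         sym (∑-reproduce n inv (↭-trans (rot-flat e₁ e₂ e₃ e₄ r) (↭-trans
           (flat-≈ (≈-trans (≈-prep e₁ (≈-trans (≈-prep e₂ (≈-trans (≈-prep e₃ h₄) h₃)) h₂)) h₁)) (Ms-full n P∈))))))))  ⟩
  ∑nbr (λ m → ∑ (Ms n) (λ Q → indicator (inside (partner Q) m) * F Q)) P
    ≡⟨ trans (∑opick-cong P (λ e₁ r₁ _ → trans (∑opick-cong r₁ (λ e₂ r₂ _ → trans (∑opick-cong r₂ (λ e₃ r₃ _ →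
         ∑opick-∑ r₃ (Ms n) _)) (∑opick-∑ r₂ (Ms n) _))) (∑opick-∑ r₁ (Ms n) _))) (∑opick-∑ P (Ms n) _) ⟩
  ∑ (Ms n) (λ Q → ∑nbr (λ m → indicator (inside (partner Q) m) * F Q) P)
    ≡⟨ ∑-cong∈ (Ms n) (λ {Q} Q∈ → trans (∑nbr-*ʳ (F Q) (λ m → indicator (inside (partner Q) m)))
         (cong (F Q *_) (Neighbours.∑nbr-inside {n} fuel≡ P∈ Q∈))) ⟩
  ∑ (Ms n) (λ Q → F Q * (fromℕ 8 * Aμ n (hook4 n) P Q))
    ≡⟨ ∑-cong (Ms n) (λ Q → solve 3 (λ f e a → f :* (e :* a) := e :* (a :* f)) refl (F Q) (fromℕ 8) (Aμ n (hook4 n) P Q)) ⟩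
  ∑ (Ms n) (λ Q → fromℕ 8 * (Aμ n (hook4 n) P Q * F Q))
    ≡⟨ trans (∑-*ˡ (fromℕ 8) (Ms n) (λ Q → Aμ n (hook4 n) P Q * F Q)) (cong (fromℕ 8 *_) (sym (∑-def (Ms n) (λ Q → Aμ n (hook4 n) P Q * F Q)))) ⟩
  fromℕ 8 * applyA n (hook4 n) F P ∎
  where
  ∑nbr-*ʳ : ∀ c (V : Matching → ℚ) → ∑nbr (λ m → V m * c) P ≡ c * ∑nbr V P
  ∑nbr-*ʳ c V = trans (∑opick-cong P (λ e₁ r₁ _ → trans (∑opick-cong r₁ (λ e₂ r₂ _ → trans (∑opick-cong r₂ (λ e₃ r₃ _ →
    trans (∑opick-cong r₃ (λ e₄ r _ → ℚ.*-comm _ c)) (∑opick-*ˡ r₃ c _))) (∑opick-*ˡ r₂ c _))) (∑opick-*ˡ r₁ c _))) (∑opick-*ˡ P c _)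

-- Permutations of the points

Permutes : List ℕ → (ℕ → ℕ) → Set
Permutes xs σ = map σ xs ↭ xs

hyper-pos : ∀ n → 0ℚ ℚ.< hyper n
hyper-pos zero    = 0<1
hyper-pos (suc n) = *-pos (fromℕ-pos (suc (double n))) (hyper-pos n)

*-cancel-≡ : ∀ {c x y} → 0ℚ ℚ.< c → c * x ≡ c * y → x ≡ y
*-cancel-≡ p e = ℚ.≤-antisym (*-cancel-≤ p (ℚ.≤-reflexive e)) (*-cancel-≤ p (ℚ.≤-reflexive (sym e)))

flat-relabel : (σ : A → B) (m : List (A × A)) → flat (relabel σ m) ≡ map σ (flat m)
flat-relabel σ []      = refl
flat-relabel σ (e ∷ m) = cong (λ l → σ (proj₁ e) ∷ σ (proj₂ e) ∷ l) (flat-relabel σ m)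

∑-act : ∀ n {σ} → Permutes (points n) σ → (f : Matching → ℚ) → ∑ (Ms n) (λ P → f (act σ P)) ≡ ∑ (Ms n) f
∑-act n {σ} pσ f = *-cancel-≡ (hyper-pos n) (begin
  hyper n * ∑ (Ms n) (λ P → f (act σ P))
    ≡⟨ cong (hyper n *_) (∑-cong∈ (Ms n) (λ {P} P∈ → trans (sym (extend-Ms n f (canon-∈ n (full P∈))))
         (sym (extend-HInv n f (canon-≈ (relabel σ P)))))) ⟩
  hyper n * ∑ (Ms n) (extend n f ∘ relabel σ)
    ≡⟨ ∑-Ms n (λ q → extend-HInv n f (relabel-≈ σ q)) ⟩
  ∑flag n (points n) (extend n f ∘ relabel σ)
    ≡⟨ ∑flag-map n σ (points n) (extend n f) ⟨
  ∑flag n (map σ (points n)) (extend n f)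
    ≡⟨ ∑flag-↭ n (extend n f) pσ ⟩
  ∑flag n (points n) (extend n f)
    ≡⟨ ∑-Ms n (extend-HInv n f) ⟨
  hyper n * ∑ (Ms n) (extend n f)
    ≡⟨ cong (hyper n *_) (∑-cong∈ (Ms n) (extend-Ms n f)) ⟩
  hyper n * ∑ (Ms n) f ∎)
  where
  full : ∀ {P} → P ∈ Ms n → flat (relabel σ P) ↭ points n
  full {P} P∈ = subst (_↭ points n) (sym (flat-relabel σ P)) (↭-trans (Perm.map⁺ σ (Ms-full n P∈)) pσ)

insertEverywhere-↭ : ∀ x l {o} → o ∈ insertEverywhere x l → o ↭ x ∷ l
insertEverywhere-↭ x []      (here refl) = refl
insertEverywhere-↭ x (y ∷ l) (here refl) = refl
insertEverywhere-↭ x (y ∷ l) (there i) with ∈-map⁻ (y ∷_) i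
... | o , j , refl = ↭-trans (prep y (insertEverywhere-↭ x l j)) (swap y x refl)

orderings-↭ : ∀ b {o} → o ∈ orderings b → o ↭ b
orderings-↭ []      (here refl) = refl
orderings-↭ (x ∷ b) i with find (∈-concatMap⁻ (insertEverywhere x) {xs = orderings b} i)
... | o , j , k = ↭-trans (insertEverywhere-↭ x o k) (prep x (orderings-↭ b j))

self-ordering : ∀ b → b ∈ orderings b
self-ordering []      = here refl
self-ordering (x ∷ b) = ∈-concatMap⁺ (insertEverywhere x) (lose (self-ordering b) (first x b))
  where
  first : ∀ x l → x ∷ l ∈ insertEverywhere x l
  first x []      = here refl
  first x (y ∷ l) = here refl

assoc-self : ∀ b z → assoc b b z ≡ z
assoc-self []      z = refl
assoc-self (x ∷ b) z with z ≡ᵇ x in e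
... | true  = sym (≡ᵇ-true e)
... | false = assoc-self b z

assoc-∉ : ∀ b o {z} → z ∉ b → assoc b o z ≡ z
assoc-∉ []      o       h = refl
assoc-∉ (x ∷ b) []      h = refl
assoc-∉ (x ∷ b) (y ∷ o) h rewrite ≡ᵇ-≢ (h ∘ here) = assoc-∉ b o (h ∘ there)

assoc-∈ : ∀ b o {z} → length o ≡ length b → z ∈ b → assoc b o z ∈ o
assoc-∈ (x ∷ b) (y ∷ o) {z} len i with z ≡ᵇ x in e
... | true = here refl
assoc-∈ (x ∷ b) (y ∷ o) {z} len (here refl) | false = ⊥-elim (case trans (sym (≡ᵇ-refl z)) e of λ ())
assoc-∈ (x ∷ b) (y ∷ o) {z} len (there i)   | false = there (assoc-∈ b o (ℕ.suc-injective len) i)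

assoc-map : ∀ b o → Unique b → length o ≡ length b → map (assoc b o) b ≡ o
assoc-map []      []      u len = refl
assoc-map (x ∷ b) (y ∷ o) (x∉ ∷ u) len = cong₂ _∷_ head
  (trans (List.map-cong-local (All.tabulate (λ i → skip (λ e → All.lookup x∉ i (sym e))))) (assoc-map b o u (ℕ.suc-injective len)))
  where
  head : assoc (x ∷ b) (y ∷ o) x ≡ y
  head rewrite ≡ᵇ-refl x = refl
  skip : ∀ {z} → z ≢ x → assoc (x ∷ b) (y ∷ o) z ≡ assoc b o z
  skip h rewrite ≡ᵇ-≢ h = refl

complement : ∀ {b xs : List ℕ} → Unique b → (∀ {z} → z ∈ b → z ∈ xs) → ∃ λ c → b ++ c ↭ xs
complement {[]}    {xs} u sub = xs , refl
complement {x ∷ b} {xs} (x∉ ∷ u) sub =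
  let c , p = complement {b} {removeElem x xs} u (λ i → drop i (Perm.∈-resp-↭ (↭-sym x↭) (sub (there i))))
  in c , ↭-trans (prep x p) x↭
  where
  x↭ = removeElem-↭ (sub (here refl))
  drop : ∀ {z} → z ∈ b → z ∈ x ∷ removeElem x xs → z ∈ removeElem x xs
  drop i (here refl) = ⊥-elim (All.lookup x∉ i refl)
  drop i (there k)   = k

unique-disjoint : ∀ (l : List ℕ) {m z} → Unique (l ++ m) → z ∈ m → z ∉ l
unique-disjoint (c ∷ l) (c∉ ∷ u) j (here refl) = All.lookup c∉ (∈-++⁺ʳ l j) refl
unique-disjoint (c ∷ l) (c∉ ∷ u) j (there i)   = unique-disjoint l u j i

Block : List ℕ → List ℕ → Set
Block xs b = Unique b × (∀ {z} → z ∈ b → z ∈ xs)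

assoc-Permutes : ∀ {xs b o} → Unique xs → Block xs b → o ↭ b → Permutes xs (assoc b o)
assoc-Permutes {xs} {b} {o} uxs (ub , sub) p = let c , q = complement ub sub in
  ↭-trans (Perm.map⁺ (assoc b o) (↭-sym q)) (↭-trans (↭.↭-reflexive (trans (List.map-++ (assoc b o) b c)
    (cong₂ _++_ (assoc-map b o ub (Perm.↭-length p))
      (trans (List.map-cong-local (All.tabulate (λ i → assoc-∉ b o (unique-disjoint b (Unique-↭ (↭-sym q) uxs) i)))) (List.map-id c)))))
    (↭-trans (Perm.++⁺ʳ c p) q))

∘-Permutes : ∀ {xs σ τ} → Permutes xs σ → Permutes xs τ → Permutes xs (σ ∘ τ)
∘-Permutes {xs} {σ} {τ} p q = ↭-trans (↭.↭-reflexive (List.map-∘ xs)) (↭-trans (Perm.map⁺ σ q) p)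

∈-blockGroup-∷ : ∀ b bs {σ} → σ ∈ blockGroup (b ∷ bs) → ∃₂ λ o g → σ ≡ assoc b o ∘ g × o ∈ orderings b × g ∈ blockGroup bs
∈-blockGroup-∷ b bs i =
  let o , o∈ , j = find (∈-concatMap⁻ (λ o → map (λ g → assoc b o ∘ g) (blockGroup bs)) {xs = orderings b} i)
      g , g∈ , e = ∈-map⁻ (λ g → assoc b o ∘ g) j
  in o , g , e , o∈ , g∈

blockGroup-Permutes : ∀ {xs} → Unique xs → ∀ bs → All (Block xs) bs → ∀ {σ} → σ ∈ blockGroup bs → Permutes xs σ
blockGroup-Permutes {xs} uxs []       []       (here refl) = ↭.↭-reflexive (List.map-id xs)
blockGroup-Permutes {xs} uxs (b ∷ bs) (B ∷ Bs) i with ∈-blockGroup-∷ b bs i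
... | o , g , refl , o∈ , g∈ =
  ∘-Permutes {xs} {assoc b o} {g} (assoc-Permutes uxs B (orderings-↭ b o∈)) (blockGroup-Permutes uxs bs Bs g∈)

∑-blockGroup-∷ : ∀ b bs (F : (ℕ → ℕ) → ℚ) →
                 ∑ (blockGroup (b ∷ bs)) F ≡ ∑ (orderings b) (λ o → ∑ (blockGroup bs) (λ g → F (assoc b o ∘ g)))
∑-blockGroup-∷ b bs F = trans (∑-concatMap _ (orderings b) F) (∑-cong (orderings b) (λ o → ∑-map _ (blockGroup bs) F))

-- The signs of permutations

mutual
  sgnParity : ℕ → (ℕ → ℕ) → ℕ → Bool
  sgnParity k f m = _

  -- The underscore is solved by the local parity function of sgn, which has no accessible name.
  sgn-parity : ∀ k f → sgn k f ≡ (if sgnParity k f (inversions k f) then 1ℚ else - 1ℚ)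
  sgn-parity k f with inversions k f
  ... | m = refl

sign : ℕ → ℚ
sign zero    = 1ℚ
sign (suc m) = - sign m

sgn-sign : ∀ k f → sgn k f ≡ sign (inversions k f)
sgn-sign k f = trans (sgn-parity k f) (go (inversions k f))
  where
  flip : ∀ b → (if not b then 1ℚ else - 1ℚ) ≡ - (if b then 1ℚ else - 1ℚ)
  flip true  = refl
  flip false = refl
  go : ∀ m → (if sgnParity k f m then 1ℚ else - 1ℚ) ≡ sign m
  go zero    = refl
  go (suc m) = trans (flip (sgnParity k f m)) (cong -_ (go m))

∏ : List A → (A → ℚ) → ℚ
∏ []       f = 1ℚ
∏ (x ∷ xs) f = f x * ∏ xs f

∏-cong∈ : (xs : List A) {f g : A → ℚ} → (∀ {x} → x ∈ xs → f x ≡ g x) → ∏ xs f ≡ ∏ xs g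
∏-cong∈ []       h = refl
∏-cong∈ (x ∷ xs) h = cong₂ _*_ (h (here refl)) (∏-cong∈ xs (h ∘ there))

∏-* : (xs : List A) (f g : A → ℚ) → ∏ xs (λ x → f x * g x) ≡ ∏ xs f * ∏ xs g
∏-* []       f g = refl
∏-* (x ∷ xs) f g = trans (cong (f x * g x *_) (∏-* xs f g))
  (solve 4 (λ a b c d → a :* b :* (c :* d) := a :* c :* (b :* d)) refl (f x) (g x) (∏ xs f) (∏ xs g))

∏-1 : (xs : List A) {f : A → ℚ} → (∀ {x} → x ∈ xs → f x ≡ 1ℚ) → ∏ xs f ≡ 1ℚ
∏-1 []       h = refl
∏-1 (x ∷ xs) h = trans (cong₂ _*_ (h (here refl)) (∏-1 xs (h ∘ there))) (ℚ.*-identityˡ 1ℚ)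

∏-map : (h : A → B) (xs : List A) (f : B → ℚ) → ∏ (map h xs) f ≡ ∏ xs (f ∘ h)
∏-map h []       f = refl
∏-map h (x ∷ xs) f = cong (f (h x) *_) (∏-map h xs f)

∏-↭ : {xs ys : List A} (f : A → ℚ) → xs ↭ ys → ∏ xs f ≡ ∏ ys f
∏-↭ f refl = refl
∏-↭ f (prep x p) = cong (f x *_) (∏-↭ f p)
∏-↭ f (swap {xs} {ys} x y p) = trans (cong (λ s → f x * (f y * s)) (∏-↭ f p))
  (solve 3 (λ a b c → a :* (b :* c) := b :* (a :* c)) refl (f x) (f y) (∏ ys f))
∏-↭ f (↭.trans p q) = trans (∏-↭ f p) (∏-↭ f q)

∏pairs : (A → A → ℚ) → List A → ℚ
∏pairs η []       = 1ℚ
∏pairs η (x ∷ xs) = ∏ xs (η x) * ∏pairs η xs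

∏pairs-* : (η θ : A → A → ℚ) (xs : List A) → ∏pairs (λ x y → η x y * θ x y) xs ≡ ∏pairs η xs * ∏pairs θ xs
∏pairs-* η θ []       = refl
∏pairs-* η θ (x ∷ xs) = trans (cong₂ _*_ (∏-* xs (η x) (θ x)) (∏pairs-* η θ xs))
  (solve 4 (λ a b c d → a :* b :* (c :* d) := a :* c :* (b :* d)) refl (∏ xs (η x)) (∏ xs (θ x)) (∏pairs η xs) (∏pairs θ xs))

∏pairs-map : (h : A → B) (η : B → B → ℚ) (xs : List A) → ∏pairs η (map h xs) ≡ ∏pairs (λ x y → η (h x) (h y)) xs
∏pairs-map h η []       = refl
∏pairs-map h η (x ∷ xs) = cong₂ _*_ (∏-map h xs (η (h x))) (∏pairs-map h η xs)

∏pairs-↭ : {η : A → A → ℚ} → (∀ x y → η x y ≡ η y x) → {xs ys : List A} → xs ↭ ys → ∏pairs η xs ≡ ∏pairs η ys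
∏pairs-↭ sy refl = refl
∏pairs-↭ {η = η} sy (prep x p) = cong₂ _*_ (∏-↭ (η x) p) (∏pairs-↭ sy p)
∏pairs-↭ {η = η} sy (swap {xs} {ys} x y p) = trans
  (cong₂ (λ a b → η x y * ∏ xs (η x) * (a * b)) (∏-↭ (η y) p) (∏pairs-↭ sy p)) (trans
  (cong₂ (λ s t → s * t * (∏ ys (η y) * ∏pairs η ys)) (sy x y) (∏-↭ (η x) p))
  (solve 4 (λ a b c d → a :* b :* (c :* d) := a :* c :* (b :* d)) refl (η y x) (∏ ys (η x)) (∏ ys (η y)) (∏pairs η ys)))
∏pairs-↭ sy (↭.trans p q) = trans (∏pairs-↭ sy p) (∏pairs-↭ sy q)

order : ℕ → ℕ → ℚ
order a b = if b <ᵇ a then - 1ℚ else 1ℚ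

order-² : ∀ a b → order a b * order a b ≡ 1ℚ
order-² a b with b <ᵇ a
... | true  = refl
... | false = refl

order-< : ∀ {a b} → a < b → order a b ≡ 1ℚ
order-< {a} {b} a<b with b <ᵇ a in e
... | false = refl
... | true  = ⊥-elim (ℕ.<-asym a<b (ℕ.<ᵇ⇒< b a (subst Bool.T (sym e) _)))

order-> : ∀ {a b} → a < b → order b a ≡ - 1ℚ
order-> {a} {b} a<b with a <ᵇ b in e
... | true  = refl
... | false = ⊥-elim (subst Bool.T e (ℕ.<⇒<ᵇ a<b))

order-anti : ∀ {a b} → a ≢ b → order b a ≡ - order a b
order-anti {a} {b} a≢b with ℕ.<-cmp a b
... | tri< a<b _ _ rewrite order-< a<b | order-> a<b = refl
... | tri≈ _ e _ = ⊥-elim (a≢b e)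
... | tri> _ _ b<a rewrite order-< b<a | order-> b<a = refl

-- Unlike the count of inversions, a product over pairs can be rearranged and factored, which suits
-- the effect of a transposition.
sgn-∏pairs : ∀ k f → sgn k f ≡ ∏pairs order (map f (upTo k))
sgn-∏pairs k f = begin
  sgn k f
    ≡⟨ sgn-sign k f ⟩
  sign (inversions k f)
    ≡⟨ sign-concatMap (λ i → map (inv i) (upTo k)) (upTo k) ⟩
  ∏ (upTo k) (λ i → ∏ (map (inv i) (upTo k)) sign)
    ≡⟨ ∏-cong∈ (upTo k) (λ {i} _ → ∏-map (inv i) (upTo k) sign) ⟩
  ∏ (upTo k) (λ i → ∏ (upTo k) (t i))
    ≡⟨ ascending (upTo k) (upTo-Ascending k) ⟩
  ∏pairs (λ i j → order (f i) (f j)) (upTo k)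
    ≡⟨ ∏pairs-map f order (upTo k) ⟨
  ∏pairs order (map f (upTo k)) ∎
  where
  inv : ℕ → ℕ → ℕ
  inv i j = if (i <ᵇ j) ∧ (f j <ᵇ f i) then 1 else 0
  t : ℕ → ℕ → ℚ
  t i j = sign (inv i j)
  sign-+ : ∀ m n → sign (m ℕ.+ n) ≡ sign m * sign n
  sign-+ zero    n = sym (ℚ.*-identityˡ (sign n))
  sign-+ (suc m) n = trans (cong -_ (sign-+ m n)) (ℚ.neg-distribˡ-* (sign m) (sign n))
  sign-++ : ∀ l m → sign (sum (l ++ m)) ≡ ∏ l sign * sign (sum m)
  sign-++ []      m = sym (ℚ.*-identityˡ _)
  sign-++ (a ∷ l) m = trans (sign-+ a _) (trans (cong (sign a *_) (sign-++ l m)) (sym (ℚ.*-assoc (sign a) _ _)))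
  sign-concatMap : ∀ (F : ℕ → List ℕ) xs → sign (sum (concatMap F xs)) ≡ ∏ xs (λ i → ∏ (F i) sign)
  sign-concatMap F []       = refl
  sign-concatMap F (x ∷ xs) = trans (sign-++ (F x) _) (cong (∏ (F x) sign *_) (sign-concatMap F xs))
  t-< : ∀ {i j} → i < j → t i j ≡ order (f i) (f j)
  t-< {i} {j} i<j with i <ᵇ j in e
  ... | false = ⊥-elim (subst Bool.T e (ℕ.<⇒<ᵇ i<j))
  ... | true with f j <ᵇ f i
  ... | true  = refl
  ... | false = refl
  t-≥ : ∀ {i j} → j ℕ.≤ i → t i j ≡ 1ℚ
  t-≥ {i} {j} j≤i with i <ᵇ j in e
  ... | false = refl
  ... | true  = ⊥-elim (ℕ.<⇒≱ (ℕ.<ᵇ⇒< i j (subst Bool.T (sym e) _)) j≤i)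
  ascending : ∀ l → Ascending l → ∏ l (λ i → ∏ l (t i)) ≡ ∏pairs (λ i j → order (f i) (f j)) l
  ascending []      as        = refl
  ascending (x ∷ l) (x< ∷ as) = begin
    t x x * ∏ l (t x) * ∏ l (λ i → t i x * ∏ l (t i))
      ≡⟨ cong₂ (λ a b → a * b * ∏ l (λ i → t i x * ∏ l (t i))) (t-≥ {x} {x} ℕ.≤-refl) (∏-cong∈ l (λ k → t-< (All.lookup x< k))) ⟩
    1ℚ * O * ∏ l (λ i → t i x * ∏ l (t i))
      ≡⟨ cong₂ _*_ (ℚ.*-identityˡ O) (trans (∏-cong∈ l {g = λ i → ∏ l (t i)} (λ {i} k →
           trans (cong (_* ∏ l (t i)) (t-≥ (ℕ.<⇒≤ (All.lookup x< k)))) (ℚ.*-identityˡ (∏ l (t i))))) (ascending l as)) ⟩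
    O * ∏pairs (λ i j → order (f i) (f j)) l ∎
    where O = ∏ l (λ j → order (f x) (f j))

transpose : ℕ → ℕ → ℕ → ℕ
transpose x y = partner ((x , y) ∷ [])

transpose-inj : ∀ {x y a b} → x ≢ y → transpose x y a ≡ transpose x y b → a ≡ b
transpose-inj {x} {y} {a} {b} x≢y e = trans (sym (twice a)) (trans (cong (transpose x y) e) (twice b))
  where
  twice : ∀ a → transpose x y (transpose x y a) ≡ a
  twice a with a ℕ.≟ x | a ℕ.≟ y
  ... | yes refl | _        = trans (cong (transpose x y) (partner-fst x y [])) (partner-snd [] (x≢y ∘ sym))
  ... | no _     | yes refl = trans (cong (transpose x y) (partner-snd [] (x≢y ∘ sym))) (partner-fst x y [])
  ... | no p     | no q     = trans (cong (transpose x y) (partner-≢ [] p q)) (partner-≢ [] p q)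

∏pairs-order-² : ∀ l → ∏pairs order l * ∏pairs order l ≡ 1ℚ
∏pairs-order-² l = trans (sym (∏pairs-* order order l)) (ones l)
  where
  ones : ∀ l → ∏pairs (λ a b → order a b * order a b) l ≡ 1ℚ
  ones []      = refl
  ones (x ∷ l) = trans (cong₂ _*_ (∏-1 l (λ {y} _ → order-² x y)) (ones l)) (ℚ.*-identityˡ 1ℚ)

-- The product of the signs before and after a transposition is a symmetric function of pairs, hence may be
-- computed with x and y in front; all factors but the one of the pair (x , y) cancel.
∏pairs-transpose : ∀ {x y l} → x ≢ y → Unique l → x ∈ l → y ∈ l → ∏pairs order (map (transpose x y) l) ≡ - ∏pairs order l
∏pairs-transpose {x} {y} {l} x≢y u x∈ y∈ = begin
  ∏pairs order (map τ l)
    ≡⟨ ℚ.*-identityʳ (∏pairs order (map τ l)) ⟨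
  ∏pairs order (map τ l) * 1ℚ
    ≡⟨ cong₂ _*_ (∏pairs-map τ order l) (sym (∏pairs-order-² l)) ⟩
  ∏pairs (λ a b → order (τ a) (τ b)) l * (D * D)
    ≡⟨ ℚ.*-assoc (∏pairs (λ a b → order (τ a) (τ b)) l) D D ⟨
  ∏pairs (λ a b → order (τ a) (τ b)) l * D * D
    ≡⟨ cong (_* D) (trans (sym (∏pairs-* (λ a b → order (τ a) (τ b)) order l)) (trans (∏pairs-↭ η-sym (↭-sym front)) η-front)) ⟩
  (- 1ℚ) * D
    ≡⟨ solve 1 (λ d → con (- 1ℚ) :* d := :- d) refl D ⟩
  - D ∎
  where
  τ = transpose x y
  D = ∏pairs order l
  η : ℕ → ℕ → ℚ
  η a b = order (τ a) (τ b) * order a b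
  η-sym : ∀ a b → η a b ≡ η b a
  η-sym a b with a ℕ.≟ b
  ... | yes refl = refl
  ... | no a≢b   = sym (trans (cong₂ _*_ (order-anti (a≢b ∘ transpose-inj x≢y)) (order-anti a≢b))
    (solve 2 (λ p q → (:- p) :* (:- q) := p :* q) refl (order (τ a) (τ b)) (order a b)))
  rest = complement {x ∷ y ∷ []} {l} ((x≢y ∷ []) ∷ ([] ∷ [])) (λ { (here refl) → x∈ ; (there (here refl)) → y∈ })
  r = proj₁ rest
  front : x ∷ y ∷ r ↭ l
  front = proj₂ rest
  z≢ : ∀ {z} → z ∈ r → z ≢ x × z ≢ y
  z≢ i with Unique-↭ (↭-sym front) u
  ... | (_ ∷ x∉) ∷ (y∉ ∷ _) = (λ e → All.lookup x∉ i (sym e)) , (λ e → All.lookup y∉ i (sym e))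
  τx : τ x ≡ y
  τx = partner-fst x y []
  τy : τ y ≡ x
  τy = partner-snd [] (x≢y ∘ sym)
  τz : ∀ {z} → z ∈ r → τ z ≡ z
  τz i = partner-≢ [] (proj₁ (z≢ i)) (proj₂ (z≢ i))
  η-xy : η x y ≡ - 1ℚ
  η-xy = trans (cong₂ (λ a b → order a b * order x y) τx τy) (trans (cong (_* order x y) (order-anti x≢y))
    (trans (sym (ℚ.neg-distribˡ-* (order x y) (order x y))) (cong -_ (order-² x y))))
  η-x : ∀ {z} → z ∈ r → η x z ≡ order y z * order x z
  η-x i = cong₂ (λ a b → order a b * order x _) τx (τz i)
  η-y : ∀ {z} → z ∈ r → η y z ≡ order x z * order y z
  η-y i = cong₂ (λ a b → order a b * order y _) τy (τz i)
  η-rest : ∀ s → (∀ {z} → z ∈ s → z ∈ r) → ∏pairs η s ≡ 1ℚ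
  η-rest []      h = refl
  η-rest (a ∷ s) h = trans (cong₂ _*_ (∏-1 s (λ {b} i → trans
    (cong₂ (λ p q → order p q * order a b) (τz (h (here refl))) (τz (h (there i)))) (order-² a b))) (η-rest s (h ∘ there)))
    (ℚ.*-identityˡ 1ℚ)
  η-front : ∏pairs η (x ∷ y ∷ r) ≡ - 1ℚ
  η-front = begin
    η x y * ∏ r (η x) * (∏ r (η y) * ∏pairs η r)
      ≡⟨ cong₂ (λ a b → a * ∏ r (η x) * (∏ r (η y) * b)) η-xy (η-rest r id) ⟩
    (- 1ℚ) * ∏ r (η x) * (∏ r (η y) * 1ℚ)
      ≡⟨ solve 2 (λ a b → con (- 1ℚ) :* a :* (b :* con 1ℚ) := con (- 1ℚ) :* (a :* b)) refl (∏ r (η x)) (∏ r (η y)) ⟩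
    (- 1ℚ) * (∏ r (η x) * ∏ r (η y))
      ≡⟨ cong ((- 1ℚ) *_) (trans (sym (∏-* r (η x) (η y))) (∏-1 r (λ {z} i → trans (cong₂ _*_ (η-x i) (η-y i))
           (trans (solve 2 (λ a b → a :* b :* (b :* a) := a :* a :* (b :* b)) refl (order y z) (order x z))
             (trans (cong₂ _*_ (order-² y z) (order-² x z)) (ℚ.*-identityˡ 1ℚ)))))) ⟩
    (- 1ℚ) * 1ℚ
      ≡⟨ ℚ.*-identityʳ (- 1ℚ) ⟩
    - 1ℚ ∎

-- Isotypic components of nontrivial shape sum to zero

∑-insert-∷ : ∀ x z l (G : List ℕ → ℚ) →
             ∑ (insertEverywhere x (z ∷ l)) G ≡ G (x ∷ z ∷ l) + ∑ (insertEverywhere x l) (λ o → G (z ∷ o))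
∑-insert-∷ x z l G = trans (∑-∷ _ _ G) (cong (G (x ∷ z ∷ l) +_) (∑-map (z ∷_) (insertEverywhere x l) G))

∑-insert-comm : ∀ x y l (H : List ℕ → ℚ) →
                ∑ (insertEverywhere x l) (λ o → ∑ (insertEverywhere y o) H) ≡
                ∑ (insertEverywhere y l) (λ o → ∑ (insertEverywhere x o) H)
∑-insert-comm x y []      H = begin
  ∑ ((x ∷ []) ∷ []) (λ o → ∑ (insertEverywhere y o) H)   ≡⟨ trans (∑-single _ _) (trans (∑-insert-∷ y x [] H) (cong (H (y ∷ x ∷ []) +_) (∑-single _ _))) ⟩
  H (y ∷ x ∷ []) + H (x ∷ y ∷ [])                        ≡⟨ ℚ.+-comm (H (y ∷ x ∷ [])) (H (x ∷ y ∷ [])) ⟩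
  H (x ∷ y ∷ []) + H (y ∷ x ∷ [])                        ≡⟨ trans (∑-single _ _) (trans (∑-insert-∷ x y [] H) (cong (H (x ∷ y ∷ []) +_) (∑-single _ _))) ⟨
  ∑ ((y ∷ []) ∷ []) (λ o → ∑ (insertEverywhere x o) H)   ∎
∑-insert-comm x y (z ∷ l) H = begin
  ∑ (insertEverywhere x (z ∷ l)) (λ o → ∑ (insertEverywhere y o) H)
    ≡⟨ expand x y ⟩
  (H (y ∷ x ∷ z ∷ l) + (H (x ∷ y ∷ z ∷ l) + S y x)) + (S x y + ∑ (insertEverywhere x l) (λ o → ∑ (insertEverywhere y o) (H ∘ (z ∷_))))
    ≡⟨ cong (λ t → (H (y ∷ x ∷ z ∷ l) + (H (x ∷ y ∷ z ∷ l) + S y x)) + (S x y + t)) (∑-insert-comm x y l (H ∘ (z ∷_))) ⟩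
  (H (y ∷ x ∷ z ∷ l) + (H (x ∷ y ∷ z ∷ l) + S y x)) + (S x y + T)
    ≡⟨ solve 5 (λ a b s t u → (a :+ (b :+ s)) :+ (t :+ u) := (b :+ (a :+ t)) :+ (s :+ u)) refl
         (H (y ∷ x ∷ z ∷ l)) (H (x ∷ y ∷ z ∷ l)) (S y x) (S x y) T ⟩
  (H (x ∷ y ∷ z ∷ l) + (H (y ∷ x ∷ z ∷ l) + S x y)) + (S y x + T)
    ≡⟨ expand y x ⟨
  ∑ (insertEverywhere y (z ∷ l)) (λ o → ∑ (insertEverywhere x o) H) ∎
  where
  S : ℕ → ℕ → ℚ
  S a b = ∑ (insertEverywhere a l) (λ o → H (b ∷ z ∷ o))
  T = ∑ (insertEverywhere y l) (λ o → ∑ (insertEverywhere x o) (H ∘ (z ∷_)))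
  expand : ∀ a b → ∑ (insertEverywhere a (z ∷ l)) (λ o → ∑ (insertEverywhere b o) H) ≡
    (H (b ∷ a ∷ z ∷ l) + (H (a ∷ b ∷ z ∷ l) + S b a)) + (S a b + ∑ (insertEverywhere a l) (λ o → ∑ (insertEverywhere b o) (H ∘ (z ∷_))))
  expand a b = trans (∑-insert-∷ a z l _) (cong₂ _+_
    (trans (∑-insert-∷ b a (z ∷ l) H) (cong (H (b ∷ a ∷ z ∷ l) +_) (∑-insert-∷ b z l (H ∘ (a ∷_)))))
    (trans (∑-cong (insertEverywhere a l) (λ o → ∑-insert-∷ b z o H)) (∑-+ (insertEverywhere a l) _ _)))

-- `orderings` inserts the two leading entries last, and by `∑-insert-comm` these insertions
-- commute.
∑-orderings-swap : ∀ x y c (H : List ℕ → ℚ) → ∑ (orderings (x ∷ y ∷ c)) H ≡ ∑ (orderings (y ∷ x ∷ c)) H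
∑-orderings-swap x y c H = trans (unfold x y) (trans (∑-cong (orderings c) (λ o → ∑-insert-comm y x o H)) (sym (unfold y x)))
  where
  unfold : ∀ a b → ∑ (orderings (a ∷ b ∷ c)) H ≡ ∑ (orderings c) (λ o → ∑ (insertEverywhere b o) (λ o → ∑ (insertEverywhere a o) H))
  unfold a b = trans (∑-concatMap (insertEverywhere a) (orderings (b ∷ c)) H) (∑-concatMap (insertEverywhere b) (orderings c) _)

∑-orderings-map : ∀ (τ : ℕ → ℕ) b (H : List ℕ → ℚ) → ∑ (orderings (map τ b)) H ≡ ∑ (orderings b) (H ∘ map τ)
∑-orderings-map τ []      H = trans (∑-single [] H) (sym (∑-single [] (H ∘ map τ)))
∑-orderings-map τ (x ∷ b) H = trans (∑-concatMap (insertEverywhere (τ x)) (orderings (map τ b)) H) (trans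
  (∑-orderings-map τ b _) (trans (∑-cong (orderings b) (λ o → insert x o H)) (sym (∑-concatMap (insertEverywhere x) (orderings b) _))))
  where
  insert : ∀ x l H → ∑ (insertEverywhere (τ x) (map τ l)) H ≡ ∑ (insertEverywhere x l) (H ∘ map τ)
  insert x []      H = trans (∑-single _ H) (sym (∑-single _ (H ∘ map τ)))
  insert x (z ∷ l) H = trans (∑-insert-∷ (τ x) (τ z) (map τ l) H) (trans
    (cong (H (τ x ∷ τ z ∷ map τ l) +_) (insert x l (H ∘ (τ z ∷_)))) (sym (∑-insert-∷ x z l (H ∘ map τ))))

assoc-natural : ∀ (τ : ℕ → ℕ) b o {w} → length o ≡ length b → w ∈ b → assoc b (map τ o) w ≡ τ (assoc b o w)
assoc-natural τ (x ∷ b) (y ∷ o) {w} len i with w ≡ᵇ x in e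
... | true = refl
assoc-natural τ (x ∷ b) (y ∷ o) {w} len (here refl) | false = ⊥-elim (case trans (sym (≡ᵇ-refl w)) e of λ ())
assoc-natural τ (x ∷ b) (y ∷ o) {w} len (there i)   | false = assoc-natural τ b o (ℕ.suc-injective len) i

sgn-transpose : ∀ k {x y σ} → x ≢ y → x < k → y < k → Permutes (upTo k) σ →
                sgn k (transpose x y ∘ σ) ≡ - sgn k σ
sgn-transpose k {x} {y} {σ} x≢y x< y< pσ = trans (sgn-∏pairs k (transpose x y ∘ σ)) (trans
  (cong (∏pairs order) (List.map-∘ (upTo k))) (trans
  (∏pairs-transpose x≢y (Unique-↭ (↭-sym pσ) (Unique.upTo⁺ k))
    (Perm.∈-resp-↭ (↭-sym pσ) (∈-upTo⁺ x<)) (Perm.∈-resp-↭ (↭-sym pσ) (∈-upTo⁺ y<)))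
  (cong -_ (sym (sgn-∏pairs k σ)))))

sgn-cong : ∀ k {f g : ℕ → ℕ} → (∀ z → z ∈ upTo k → f z ≡ g z) → sgn k f ≡ sgn k g
sgn-cong k {f} {g} h = trans (sgn-∏pairs k f) (trans
  (cong (∏pairs order) (List.map-cong-local (All.tabulate (λ {z} → h z)))) (sym (sgn-∏pairs k g)))

-- Composition with the transposition of `x` and `y` permutes the summands and reverses their signs,
-- so the sum equals its negative.
∑-sgn-block : ∀ k x y c g → Block (upTo k) (x ∷ y ∷ c) → Permutes (upTo k) g →
              ∑ (orderings (x ∷ y ∷ c)) (λ o → sgn k (assoc (x ∷ y ∷ c) o ∘ g)) ≡ 0ℚ
∑-sgn-block k x y c g B@(ub@((x≢y ∷ x∉) ∷ (y∉ ∷ _)) , sub) pg = *-cancel-zero (fromℕ-pos 1) (begin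
  fromℕ 2 * S           ≡⟨ solve 1 (λ s → con (fromℕ 2) :* s := s :+ s) refl S ⟩
  S + S                 ≡⟨ cong (S +_) flipped ⟩
  S + - S               ≡⟨ ℚ.+-inverseʳ S ⟩
  0ℚ ∎)
  where
  b = x ∷ y ∷ c
  τ = transpose x y
  H : List ℕ → ℚ
  H o = sgn k (assoc b o ∘ g)
  S = ∑ (orderings b) H
  τ-fix : ∀ {z} → z ≢ x → z ≢ y → τ z ≡ z
  τ-fix = partner-≢ []
  map-τ : map τ b ≡ y ∷ x ∷ c
  map-τ = cong₂ _∷_ (partner-fst x y []) (cong₂ _∷_ (partner-snd [] (x≢y ∘ sym)) (trans
    (List.map-cong-local (All.tabulate (λ i → τ-fix (λ e → All.lookup x∉ i (sym e)) (λ e → All.lookup y∉ i (sym e))))) (List.map-id c)))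
  assoc-τ : ∀ {o} → o ∈ orderings b → ∀ w → assoc b (map τ o) w ≡ τ (assoc b o w)
  assoc-τ {o} o∈ w with memb w b in e
  ... | true  = assoc-natural τ b o (Perm.↭-length (orderings-↭ b o∈)) (memb-∈ w b e)
  ... | false = trans (assoc-∉ b (map τ o) w∉) (sym (trans (cong τ (assoc-∉ b o w∉)) (τ-fix (w∉ ∘ here) (w∉ ∘ there ∘ here))))
    where w∉ = memb-∉ w b e
  flipped : S ≡ - S
  flipped = begin
    S                              ≡⟨ ∑-orderings-swap x y c H ⟩
    ∑ (orderings (y ∷ x ∷ c)) H    ≡⟨ cong (λ l → ∑ (orderings l) H) map-τ ⟨
    ∑ (orderings (map τ b)) H      ≡⟨ ∑-orderings-map τ b H ⟩
    ∑ (orderings b) (H ∘ map τ)    ≡⟨ ∑-cong∈ (orderings b) (λ {o} o∈ → trans (sgn-cong k (λ z _ → assoc-τ o∈ (g z)))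
      (sgn-transpose k {σ = assoc b o ∘ g} x≢y (∈-upTo⁻ (sub (here refl))) (∈-upTo⁻ (sub (there (here refl))))
        (∘-Permutes {σ = assoc b o} {g} (assoc-Permutes (Unique.upTo⁺ k) B (orderings-↭ b o∈)) pg))) ⟩
    ∑ (orderings b) (λ o → - H o)  ≡⟨ ∑-neg (orderings b) H ⟩
    - S ∎

∈-range⁻ : ∀ s k {z} → z ∈ range s k → s ℕ.≤ z × z < s ℕ.+ k
∈-range⁻ s k i with ∈-map⁻ (s ℕ.+_) i
... | j , j∈ , refl = ℕ.m≤m+n s j , ℕ.+-monoʳ-< s (∈-upTo⁻ j∈)

Between : ℕ → ℕ → List ℕ → Set
Between s t r = Unique r × (∀ {z} → z ∈ r → s ℕ.≤ z × z < t)

Between-Block : ∀ n {r} → Between 0 (2 ℕ.* n) r → Block (points n) r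
Between-Block n (u , h) = u , λ i → ∈-upTo⁺ (proj₂ (h i))

tabRows-Between : ∀ s la → All (Between s (s ℕ.+ 2 ℕ.* sum la)) (tabRows s la)
tabRows-Between s []       = []
tabRows-Between s (l ∷ la) =
  (Unique.map⁺ (ℕ.+-cancelˡ-≡ s _ _) (Unique.upTo⁺ (2 ℕ.* l)) ,
   λ {z} i → let s≤ , <t = ∈-range⁻ s (2 ℕ.* l) i in s≤ , ℕ.<-≤-trans <t (ℕ.+-monoʳ-≤ s (ℕ.*-monoʳ-≤ 2 (ℕ.m≤m+n l (sum la))))) ∷
  All.map (λ (u , h) → u , λ {z} i → let s≤ , <t = h i in
    ℕ.≤-trans (ℕ.m≤m+n s (2 ℕ.* l)) s≤ , subst (z <_) (shift s l (sum la)) <t) (tabRows-Between (s ℕ.+ 2 ℕ.* l) la)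
  where
  shift : ∀ s l t → s ℕ.+ 2 ℕ.* l ℕ.+ 2 ℕ.* t ≡ s ℕ.+ 2 ℕ.* (l ℕ.+ t)
  shift s l t = trans (ℕ.+-assoc s (2 ℕ.* l) (2 ℕ.* t)) (cong (s ℕ.+_) (sym (ℕ.*-distribˡ-+ 2 l t)))

nth-cases : ∀ r j → nth r j ≡ [] ⊎ ∃ λ z → nth r j ≡ z ∷ [] × z ∈ r
nth-cases []      j       = inj₁ refl
nth-cases (x ∷ r) zero    = inj₂ (x , refl , here refl)
nth-cases (x ∷ r) (suc j) with nth-cases r j
... | inj₁ e            = inj₁ e
... | inj₂ (z , e , z∈) = inj₂ (z , e , there z∈)

-- The rows occupy consecutive intervals, so a column takes at most one entry from each and its
-- entries are distinct.
column-Between : ∀ s la j → Between s (s ℕ.+ 2 ℕ.* sum la) (concatMap (λ r → nth r j) (tabRows s la))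
column-Between s []       j = [] , λ ()
column-Between s (l ∷ la) j with tabRows-Between s (l ∷ la) | column-Between (s ℕ.+ 2 ℕ.* l) la j | nth-cases (range s (2 ℕ.* l)) j
... | row ∷ _ | u , h | c = go c
  where
  rest = concatMap (λ r → nth r j) (tabRows (s ℕ.+ 2 ℕ.* l) la)
  h' : ∀ {z} → z ∈ rest → s ℕ.≤ z × z < s ℕ.+ 2 ℕ.* (l ℕ.+ sum la)
  h' {z} i = let s≤ , <t = h i in ℕ.≤-trans (ℕ.m≤m+n s (2 ℕ.* l)) s≤ ,
    subst (z <_) (trans (ℕ.+-assoc s (2 ℕ.* l) _) (cong (s ℕ.+_) (sym (ℕ.*-distribˡ-+ 2 l (sum la))))) <t
  go : nth (range s (2 ℕ.* l)) j ≡ [] ⊎ (∃ λ z → nth (range s (2 ℕ.* l)) j ≡ z ∷ [] × z ∈ range s (2 ℕ.* l)) →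
       Between s (s ℕ.+ 2 ℕ.* (l ℕ.+ sum la)) (nth (range s (2 ℕ.* l)) j ++ rest)
  go (inj₁ e) rewrite e = u , h'
  go (inj₂ (z , e , z∈)) rewrite e =
    All.tabulate (λ i eq → ℕ.<⇒≱ (proj₂ (∈-range⁻ s (2 ℕ.* l) z∈)) (subst (_ ℕ.≤_) (sym eq) (proj₁ (h i)))) ∷ u ,
    λ { (here refl) → proj₂ row z∈ ; (there i) → h' i }

tabCols-Between : ∀ la → All (Between 0 (2 ℕ.* sum la)) (tabCols (tabRows 0 la))
tabCols-Between la = All.map⁺ (All.tabulate {xs = upTo (headLength (tabRows 0 la))} (λ {j} _ → column-Between 0 la j))

module _ {n la} (sum≡ : sum la ≡ n) where

  row-Blocks : All (Block (points n)) (tabRows 0 la)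
  row-Blocks = All.map (λ {r} b → Between-Block n (subst (λ t → Between 0 (2 ℕ.* t) r) sum≡ b)) (tabRows-Between 0 la)

  col-Blocks : All (Block (points n)) (tabCols (tabRows 0 la))
  col-Blocks = All.map (λ {r} b → Between-Block n (subst (λ t → Between 0 (2 ℕ.* t) r) sum≡ b)) (tabCols-Between la)

  rowGroup-Permutes : ∀ {p} → p ∈ rowGroup la → Permutes (points n) p
  rowGroup-Permutes = blockGroup-Permutes (points-Unique n) (tabRows 0 la) row-Blocks

  colGroup-Permutes : ∀ {q} → q ∈ colGroup la → Permutes (points n) q
  colGroup-Permutes = blockGroup-Permutes (points-Unique n) (tabCols (tabRows 0 la)) col-Blocks

Sym-Permutes : ∀ n {σ} → σ ∈ Sym (2 ℕ.* n) → Permutes (points n) σ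
Sym-Permutes n = blockGroup-Permutes (points-Unique n) (points n ∷ []) ((points-Unique n , id) ∷ [])

∑-sgn-blockGroup : ∀ k x y c bs → Block (upTo k) (x ∷ y ∷ c) → All (Block (upTo k)) bs →
                   ∑ (blockGroup ((x ∷ y ∷ c) ∷ bs)) (sgn k) ≡ 0ℚ
∑-sgn-blockGroup k x y c bs B Bs = trans (∑-blockGroup-∷ (x ∷ y ∷ c) bs (sgn k)) (trans
  (∑-exchange (orderings (x ∷ y ∷ c)) (blockGroup bs) (λ o g → sgn k (assoc (x ∷ y ∷ c) o ∘ g)))
  (∑-zero (blockGroup bs) (λ {g} g∈ → ∑-sgn-block k x y c g B (blockGroup-Permutes (Unique.upTo⁺ k) bs Bs g∈))))

-- A partition of a nonzero n other than [n] has a second row, so the first column has at least two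
-- entries and its orderings cancel.
∑-sgn-colGroup : ∀ n la → IsPartition n la → la ≢ [ n ] → n ≢ 0 → ∑ (colGroup la) (sgn (2 ℕ.* n)) ≡ 0ℚ
∑-sgn-colGroup n []                     (_ , _ , s) ne nz = ⊥-elim (nz (sym s))
∑-sgn-colGroup n (l ∷ [])               (_ , _ , s) ne nz = ⊥-elim (ne (cong [_] (trans (sym (ℕ.+-identityʳ l)) s)))
∑-sgn-colGroup n (zero ∷ l ∷ la)        (_ , () ∷ _ , s)
∑-sgn-colGroup n (suc k ∷ zero ∷ la)    (_ , _ ∷ () ∷ _ , s)
∑-sgn-colGroup n (suc k ∷ suc l ∷ la)   (_ , _ , s) ne nz = first-column (tabCols (tabRows 0 (suc k ∷ suc l ∷ la))) refl (col-Blocks {la = suc k ∷ suc l ∷ la} s)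
  where
  first-column : ∀ cols → tabCols (tabRows 0 (suc k ∷ suc l ∷ la)) ≡ cols → All (Block (points n)) cols →
                 ∑ (blockGroup cols) (sgn (2 ℕ.* n)) ≡ 0ℚ
  first-column ((x ∷ y ∷ c) ∷ bs) e (B ∷ Bs) = ∑-sgn-blockGroup (2 ℕ.* n) x y c bs B Bs
  first-column [] ()
  first-column ([] ∷ bs) ()
  first-column ((x ∷ []) ∷ bs) ()

-- Permutations of the points preserve the total of `w`, which therefore factors out of the Young
-- symmetrizer and leaves the sum of the column signs.
isotypic-sum : ∀ n la → IsPartition n la → la ≢ [ n ] → n ≢ 0 → ∀ {v} → InIsotypic n la v → ∑ (Ms n) v ≡ 0ℚ
isotypic-sum n la part ne nz {v} (terms , syms , v≐) = begin
  ∑ (Ms n) v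
    ≡⟨ ∑-cong∈ (Ms n) (λ i → trans (All.lookup v≐ i) (∑-def terms _)) ⟩
  ∑ (Ms n) (λ P → ∑ terms (λ t → young n la (proj₂ t) (act (proj₁ t) P)))
    ≡⟨ ∑-exchange (Ms n) terms (λ P t → young n la (proj₂ t) (act (proj₁ t) P)) ⟩
  ∑ terms (λ t → ∑ (Ms n) (λ P → young n la (proj₂ t) (act (proj₁ t) P)))
    ≡⟨ ∑-zero terms (λ {t} i → trans (∑-act n (Sym-Permutes n (All.lookup syms i)) (young n la (proj₂ t))) (young-sum (proj₂ t))) ⟩
  0ℚ ∎
  where
  s≡ = proj₂ (proj₂ part)
  young-sum : ∀ w → ∑ (Ms n) (young n la w) ≡ 0ℚ
  young-sum w = begin
    ∑ (Ms n) (young n la w)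
      ≡⟨ ∑-cong (Ms n) (λ P → trans (∑-def (colGroup la) _) (∑-cong (colGroup la) (λ q → cong (sgn (2 ℕ.* n) q *_) (∑-def (rowGroup la) _)))) ⟩
    ∑ (Ms n) (λ P → ∑ (colGroup la) (λ q → sgn (2 ℕ.* n) q * ∑ (rowGroup la) (λ p → w (act p (act q P)))))
      ≡⟨ ∑-exchange (Ms n) (colGroup la) _ ⟩
    ∑ (colGroup la) (λ q → ∑ (Ms n) (λ P → sgn (2 ℕ.* n) q * ∑ (rowGroup la) (λ p → w (act p (act q P)))))
      ≡⟨ ∑-cong∈ (colGroup la) (λ {q} q∈ → trans (∑-*ˡ (sgn (2 ℕ.* n) q) (Ms n) _) (cong (sgn (2 ℕ.* n) q *_) (trans
           (∑-exchange (Ms n) (rowGroup la) (λ P p → w (act p (act q P)))) (∑-cong∈ (rowGroup la) (λ {p} p∈ →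
             trans (∑-act n (colGroup-Permutes {n} {la} s≡ q∈) (λ P → w (act p P))) (∑-act n (rowGroup-Permutes {n} {la} s≡ p∈) w)))))) ⟩
    ∑ (colGroup la) (λ q → sgn (2 ℕ.* n) q * ∑ (rowGroup la) (λ _ → ∑ (Ms n) w))
      ≡⟨ ∑-*ʳ _ (colGroup la) (sgn (2 ℕ.* n)) ⟩
    ∑ (colGroup la) (sgn (2 ℕ.* n)) * ∑ (rowGroup la) (λ _ → ∑ (Ms n) w)
      ≡⟨ trans (cong (_* ∑ (rowGroup la) (λ _ → ∑ (Ms n) w)) (∑-sgn-colGroup n la part ne nz)) (ℚ.*-zeroˡ (∑ (rowGroup la) (λ _ → ∑ (Ms n) w))) ⟩
    0ℚ ∎

-- The polynomials phi1 and gap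

toℚᵘ-toℚ : ∀ z → ℚ.toℚᵘ (toℚ z) ℚᵘ.≃ ℚᵘ.mkℚᵘ z 0
toℚᵘ-toℚ z = ℚ.toℚᵘ-fromℚᵘ (ℚᵘ.mkℚᵘ z 0)

toℚ-+ : ∀ a b → toℚ (a ℤ.+ b) ≡ toℚ a + toℚ b
toℚ-+ a b = ℚ.toℚᵘ-injective (ℚᵘ.≃-trans (toℚᵘ-toℚ (a ℤ.+ b)) (ℚᵘ.≃-trans
  (ℚᵘ.*≡* (cong (ℤ._* ℤ.+ 1) (sym (cong₂ ℤ._+_ (ℤ.*-identityʳ a) (ℤ.*-identityʳ b)))))
  (ℚᵘ.≃-trans (ℚᵘ.≃-sym (ℚᵘ.+-cong (toℚᵘ-toℚ a) (toℚᵘ-toℚ b))) (ℚᵘ.≃-sym (ℚ.toℚᵘ-homo-+ (toℚ a) (toℚ b))))))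

toℚ-* : ∀ a b → toℚ (a ℤ.* b) ≡ toℚ a * toℚ b
toℚ-* a b = ℚ.toℚᵘ-injective (ℚᵘ.≃-trans (toℚᵘ-toℚ (a ℤ.* b)) (ℚᵘ.≃-trans (ℚᵘ.*≡* refl)
  (ℚᵘ.≃-trans (ℚᵘ.≃-sym (ℚᵘ.*-cong (toℚᵘ-toℚ a) (toℚᵘ-toℚ b))) (ℚᵘ.≃-sym (ℚ.toℚᵘ-homo-* (toℚ a) (toℚ b))))))

toℚ-neg : ∀ a → toℚ (ℤ.- a) ≡ - toℚ a
toℚ-neg a = trans (cong toℚ (sym (ℤ.-1*i≡-i a))) (trans (toℚ-* (ℤ.- ℤ.+ 1) a)
  (solve 1 (λ x → con (toℚ (ℤ.- ℤ.+ 1)) :* x := :- x) refl (toℚ a)))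

toℚ-fromℕ : ∀ n → toℚ (ℤ.+ n) ≡ fromℕ n
toℚ-fromℕ zero    = refl
toℚ-fromℕ (suc n) = trans (toℚ-+ (ℤ.+ 1) (ℤ.+ n)) (cong (1ℚ +_) (toℚ-fromℕ n))

toℚ-- : ∀ a b → toℚ (a ℤ.- b) ≡ toℚ a - toℚ b
toℚ-- a b = trans (toℚ-+ a (ℤ.- b)) (cong (toℚ a +_) (toℚ-neg b))

infixr 8 _^_
_^_ : ℚ → ℕ → ℚ
x ^ zero  = 1ℚ
x ^ suc k = x * x ^ k

toℚ-^ : ∀ n k → toℚ ((ℤ.+ n) ℤ.^ k) ≡ fromℕ n ^ k
toℚ-^ n zero    = refl
toℚ-^ n (suc k) = trans (toℚ-* (ℤ.+ n) ((ℤ.+ n) ℤ.^ k)) (cong₂ _*_ (toℚ-fromℕ n) (toℚ-^ n k))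

monomial : ∀ c n k → toℚ ((ℤ.+ c) ℤ.* (ℤ.+ n) ℤ.^ k) ≡ fromℕ c * fromℕ n ^ k
monomial c n k = trans (toℚ-* (ℤ.+ c) ((ℤ.+ n) ℤ.^ k)) (cong₂ _*_ (toℚ-fromℕ c) (toℚ-^ n k))

linear : ∀ c n → toℚ ((ℤ.+ c) ℤ.* ℤ.+ n) ≡ fromℕ c * fromℕ n
linear c n = trans (toℚ-* (ℤ.+ c) (ℤ.+ n)) (cong₂ _*_ (toℚ-fromℕ c) (toℚ-fromℕ n))

phi1-polynomial : ∀ n → phi1 n ≡ fromℕ 2 * fromℕ n ^ 4 - fromℕ 20 * fromℕ n ^ 3 + fromℕ 66 * fromℕ n ^ 2 - fromℕ 80 * fromℕ n + fromℕ 24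
phi1-polynomial n =
  trans (toℚ-+ (a ℤ.- b ℤ.+ c ℤ.- d) (ℤ.+ 24)) (cong (_+ fromℕ 24) (
  trans (toℚ-- (a ℤ.- b ℤ.+ c) d) (cong₂ _-_ (
  trans (toℚ-+ (a ℤ.- b) c) (cong₂ _+_ (
  trans (toℚ-- a b) (cong₂ _-_ (monomial 2 n 4) (monomial 20 n 3)))
  (monomial 66 n 2))) (linear 80 n))))
  where
  m = ℤ.+ n
  a = (ℤ.+ 2) ℤ.* m ℤ.^ 4
  b = (ℤ.+ 20) ℤ.* m ℤ.^ 3
  c = (ℤ.+ 66) ℤ.* m ℤ.^ 2
  d = (ℤ.+ 80) ℤ.* m

gap-polynomial : ∀ n → gap n ≡ fromℕ 8 * fromℕ n ^ 3 - fromℕ 44 * fromℕ n ^ 2 + fromℕ 68 * fromℕ n - fromℕ 24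
gap-polynomial n =
  trans (toℚ-- (a ℤ.- b ℤ.+ c) (ℤ.+ 24)) (cong (_- fromℕ 24) (
  trans (toℚ-+ (a ℤ.- b) c) (cong₂ _+_ (
  trans (toℚ-- a b) (cong₂ _-_ (monomial 8 n 3) (monomial 44 n 2)))
  (linear 68 n))))
  where
  m = ℤ.+ n
  a = (ℤ.+ 8) ℤ.* m ℤ.^ 3
  b = (ℤ.+ 44) ℤ.* m ℤ.^ 2
  c = (ℤ.+ 68) ℤ.* m

private
  lit : ℕ → Polynomial 1
  lit k = con (fromℕ k)
  sucᵖ : Polynomial 1 → Polynomial 1
  sucᵖ x = con 1ℚ :+ x
  powᵖ : Polynomial 1 → ℕ → Polynomial 1
  powᵖ x zero    = con 1ℚ
  powᵖ x (suc k) = x :* powᵖ x k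
  phi1ᵖ gapᵖ d₁ᵖ : Polynomial 1 → Polynomial 1
  phi1ᵖ x = lit 2 :* powᵖ x 4 :- lit 20 :* powᵖ x 3 :+ lit 66 :* powᵖ x 2 :- lit 80 :* x :+ lit 24
  gapᵖ x  = lit 8 :* powᵖ x 3 :- lit 44 :* powᵖ x 2 :+ lit 68 :* x :- lit 24
  d₁ᵖ j   = sucᵖ (sucᵖ (j :+ j))

eigen-phi1 : ∀ j → eigen j ≡ fromℕ 8 * phi1 (4 ℕ.+ j)
eigen-phi1 j = trans expand (cong (fromℕ 8 *_) (sym (phi1-polynomial (4 ℕ.+ j))))
  where
  expand : let x = fromℕ (4 ℕ.+ j) in
    eigen j ≡ fromℕ 8 * (fromℕ 2 * x ^ 4 - fromℕ 20 * x ^ 3 + fromℕ 66 * x ^ 2 - fromℕ 80 * x + fromℕ 24)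
  expand rewrite fromℕ-double j = solve 1 (λ j →
    sucᵖ (sucᵖ (d₁ᵖ j)) :* (d₁ᵖ j :* (lit 4 :* (j :* sucᵖ (sucᵖ (sucᵖ j)) :- lit 2))) :=
    lit 8 :* phi1ᵖ (sucᵖ (sucᵖ (sucᵖ (sucᵖ j))))) refl (fromℕ j)

-- `degree j` is 16 n (n-1) (n-2) (n-3) with n = 4 + j, so the valency is 2 n (n-1) (n-2) (n-3).
degree-gap : ∀ j → degree j ≡ fromℕ 8 * (phi1 (4 ℕ.+ j) + gap (4 ℕ.+ j))
degree-gap j = trans expand (cong (fromℕ 8 *_) (sym (cong₂ _+_ (phi1-polynomial (4 ℕ.+ j)) (gap-polynomial (4 ℕ.+ j)))))
  where
  expand : let x = fromℕ (4 ℕ.+ j) in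
    degree j ≡ fromℕ 8 * ((fromℕ 2 * x ^ 4 - fromℕ 20 * x ^ 3 + fromℕ 66 * x ^ 2 - fromℕ 80 * x + fromℕ 24)
                          + (fromℕ 8 * x ^ 3 - fromℕ 44 * x ^ 2 + fromℕ 68 * x - fromℕ 24))
  expand rewrite fromℕ-double j = solve 1 (λ j → let d₂ = sucᵖ (sucᵖ (d₁ᵖ j)) ; d₃ = sucᵖ (sucᵖ d₂) in
    sucᵖ (sucᵖ d₃) :* (d₃ :* (d₂ :* d₁ᵖ j)) :=
    lit 8 :* (phi1ᵖ (sucᵖ (sucᵖ (sucᵖ (sucᵖ j)))) :+ gapᵖ (sucᵖ (sucᵖ (sucᵖ (sucᵖ j)))))) refl (fromℕ j)

-- The upper bound on the eigenvalues of nontrivial shape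

applyA-cong : ∀ n μ {v w} → v ≐[ n ] w → ∀ P → applyA n μ v P ≡ applyA n μ w P
applyA-cong n μ v≐w P = trans (∑-def (Ms n) _) (trans
  (∑-cong∈ (Ms n) (λ {Q} i → cong (Aμ n μ P Q *_) (All.lookup v≐w i))) (sym (∑-def (Ms n) _)))

bound-∑nbr : ∀ {n i xs V} → n ≡ 6 ℕ.+ i → length xs ≡ double n → HInv V → ∑flag n xs V ≡ 0ℚ →
             ∑flag n xs (λ m → V m * ∑nbr V m) ≤ℚ eigen (2 ℕ.+ i) * inner n xs V V
bound-∑nbr {i = i} {xs} {V} refl len inv s0 =
  subst (_≤ℚ eigen (2 ℕ.+ i) * inner (6 ℕ.+ i) xs V V) (sym (∑flag-∑nbr (2 ℕ.+ i) xs {V} {V} inv)) (bound-eigen i len inv s0)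

∑-square-pos : {xs : List A} {f : A → ℚ} → Any (λ x → f x ≢ 0ℚ) xs → 0ℚ ℚ.< ∑ xs (λ x → f x * f x)
∑-square-pos {xs = x ∷ xs} {f} a = subst (0ℚ ℚ.<_) (sym (∑-∷ x xs (λ x → f x * f x))) (go a)
  where
  go : Any (λ x → f x ≢ 0ℚ) (x ∷ xs) → 0ℚ ℚ.< f x * f x + ∑ xs (λ x → f x * f x)
  go (here h)  = ℚ.+-mono-<-≤ square-pos (∑-nonneg xs (λ x → square-nonneg (f x)))
    where
    square-pos : 0ℚ ℚ.< f x * f x
    square-pos with ℚ.<-cmp 0ℚ (f x)
    ... | tri< p _ _ = *-pos p p
    ... | tri≈ _ e _ = ⊥-elim (h (sym e))
    ... | tri> _ _ p = subst (0ℚ ℚ.<_) (solve 1 (λ a → (:- a) :* (:- a) := a :* a) refl (f x))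
                         (*-pos (ℚ.neg-antimono-< p) (ℚ.neg-antimono-< p))
  go (there k) = ℚ.+-mono-≤-< (square-nonneg (f x)) (∑-square-pos k)

-- A Rayleigh quotient: the form at an eigenvector is `a` times its squared norm `S`, which is
-- positive and can be cancelled against the spectral bound.
eigenvalue-≤ : ∀ {n i} → n ≡ 6 ℕ.+ i → ∀ la → IsPartition n la → la ≢ [ n ] → ∀ {a} → IsEigenvalue n la (hook4 n) a → a ≤ℚ phi1 n
eigenvalue-≤ {n} {i} n≡ la part ne {a} (v , iso , nz , Av) = *-cancel-≤ (fromℕ-pos 7) (*-cancel-≤ (*-pos (hyper-pos n) S-pos) (subst₂ _≤ℚ_
  (begin
    ∑flag n (points n) (λ m → V m * ∑nbr V m)
      ≡⟨ ∑-Ms n (λ p → cong₂ _*_ (V-inv p) (∑nbr-HInv V-inv p)) ⟨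
    hyper n * ∑ (Ms n) (λ P → V P * ∑nbr V P)
      ≡⟨ cong (hyper n *_) (∑-cong∈ (Ms n) (λ {P} P∈ → trans (cong₂ _*_ (V-Ms P∈) (trans (∑nbr-applyA {n} fuel≡ V-inv P∈)
           (cong (fromℕ 8 *_) (trans (applyA-cong n (hook4 n) (All.tabulate V-Ms) P) (All.lookup Av P∈)))))
           (solve 3 (λ x e a → x :* (e :* (a :* x)) := e :* a :* (x :* x)) refl (v P) (fromℕ 8) a))) ⟩
    hyper n * ∑ (Ms n) (λ P → fromℕ 8 * a * (v P * v P))
      ≡⟨ cong (hyper n *_) (∑-*ˡ (fromℕ 8 * a) (Ms n) (λ P → v P * v P)) ⟩
    hyper n * (fromℕ 8 * a * S)
      ≡⟨ solve 3 (λ h b s → h :* (b :* s) := h :* s :* b) refl (hyper n) (fromℕ 8 * a) S ⟩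
    hyper n * S * (fromℕ 8 * a) ∎)
  (begin
    eigen (2 ℕ.+ i) * inner n (points n) V V
      ≡⟨ cong₂ _*_ (trans (eigen-phi1 (2 ℕ.+ i)) (cong (λ k → fromℕ 8 * phi1 k) (sym n≡)))
           (trans (sym (∑-Ms n (λ p → cong₂ _*_ (V-inv p) (V-inv p)))) (cong (hyper n *_) (∑-cong∈ (Ms n) (λ P∈ → cong₂ _*_ (V-Ms P∈) (V-Ms P∈))))) ⟩
    fromℕ 8 * phi1 n * (hyper n * S)
      ≡⟨ ℚ.*-comm (fromℕ 8 * phi1 n) (hyper n * S) ⟩
    hyper n * S * (fromℕ 8 * phi1 n) ∎)
  (bound-∑nbr n≡ (points-length n) V-inv sum0)))
  where
  V : Matching → ℚ
  V = extend n v
  V-inv : HInv V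
  V-inv = extend-HInv n v
  V-Ms : ∀ {P} → P ∈ Ms n → V P ≡ v P
  V-Ms = extend-Ms n v
  S = ∑ (Ms n) (λ P → v P * v P)
  S-pos : 0ℚ ℚ.< S
  S-pos = ∑-square-pos nz
  fuel≡ : 2 ℕ.* n ≡ 5 ℕ.+ (7 ℕ.+ double i)
  fuel≡ = trans (cong (2 ℕ.*_) n≡) (double-2* (6 ℕ.+ i))
  sum0 : ∑flag n (points n) V ≡ 0ℚ
  sum0 = trans (sym (∑-Ms n V-inv)) (trans (cong (hyper n *_) (trans (∑-cong∈ (Ms n) V-Ms)
    (isotypic-sum n la part ne (λ e → case trans (sym n≡) e of λ ()) iso))) (ℚ.*-zeroʳ (hyper n)))

-- The valency as the eigenvalue of shape [n]

∈-blockGroup : ∀ bs → ∃ λ σ → σ ∈ blockGroup bs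
∈-blockGroup []       = id , here refl
∈-blockGroup (b ∷ bs) = let g , g∈ = ∈-blockGroup bs in
  assoc b b ∘ g , ∈-concatMap⁺ (λ o → map (λ g → assoc b o ∘ g) (blockGroup bs)) (lose (self-ordering b) (∈-map⁺ (λ g → assoc b b ∘ g) g∈))

size : {A : Set} → List A → ℚ
size xs = ∑ xs (λ _ → 1ℚ)

size-pos : {x : A} {xs : List A} → x ∈ xs → 0ℚ ℚ.< size xs
size-pos {xs = y ∷ ys} _ = subst (0ℚ ℚ.<_) (sym (∑-∷ y ys (λ _ → 1ℚ)))
  (ℚ.+-mono-<-≤ 0<1 (∑-nonneg ys (λ _ → ℚ.<⇒≤ 0<1)))

-- The only element is a composite of `assoc`s, equal to the identity pointwise but not by
-- definition.
trivial-blocks : ∀ bs → All (λ b → length b ℕ.≤ 1) bs → ∃ λ h → blockGroup bs ≡ h ∷ [] × (∀ z → h z ≡ z)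
trivial-blocks []       [] = id , refl , λ _ → refl
trivial-blocks ([] ∷ bs) (_ ∷ ls) =
  let h , e , f = trivial-blocks bs ls in assoc [] [] ∘ h , cong (λ l → map (λ g → assoc [] [] ∘ g) l ++ []) e , f
trivial-blocks ((x ∷ []) ∷ bs) (_ ∷ ls) =
  let h , e , f = trivial-blocks bs ls in
  assoc (x ∷ []) (x ∷ []) ∘ h , cong (λ l → map (λ g → assoc (x ∷ []) (x ∷ []) ∘ g) l ++ []) e ,
  λ z → trans (assoc-self (x ∷ []) (h z)) (f z)
trivial-blocks ((x ∷ y ∷ b) ∷ bs) (ℕ.s≤s () ∷ ls)

nth-length : ∀ r j → length (nth r j) ℕ.≤ 1
nth-length r j with nth-cases r j
... | inj₁ e           rewrite e = ℕ.z≤n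
... | inj₂ (z , e , _) rewrite e = ℕ.≤-refl

sgn-² : ∀ k σ → sgn k σ * sgn k σ ≡ 1ℚ
sgn-² k σ = trans (cong (λ s → s * s) (sgn-∏pairs k σ)) (∏pairs-order-² (map σ (upTo k)))

*-≢0 : ∀ {s s' t} → s * s' ≡ 1ℚ → 0ℚ ℚ.< t → s * t ≢ 0ℚ
*-≢0 {s} {s'} {t} s≡ p e = ℚ.<⇒≢ p (sym (begin
  t               ≡⟨ ℚ.*-identityˡ t ⟨
  1ℚ * t          ≡⟨ cong (_* t) s≡ ⟨
  s * s' * t      ≡⟨ solve 3 (λ s s' t → s :* s' :* t := s' :* (s :* t)) refl s s' t ⟩
  s' * (s * t)    ≡⟨ cong (s' *_) e ⟩
  s' * 0ℚ         ≡⟨ ℚ.*-zeroʳ s' ⟩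
  0ℚ ∎))

identity-∈-Sym : ∀ n → assoc (points n) (points n) ∘ id ∈ Sym (2 ℕ.* n)
identity-∈-Sym n = proj₂ (∈-blockGroup (points n ∷ []))

flat-pairs : ∀ k (l : List ℕ) → length l ≡ double k → flat (pairs l) ≡ l
flat-pairs zero    []          e = refl
flat-pairs (suc k) (a ∷ b ∷ l) e = cong (λ l → a ∷ b ∷ l) (flat-pairs k l (ℕ.suc-injective (ℕ.suc-injective e)))

∑nbr-const : ∀ j c m → length m ≡ 4 ℕ.+ j → ∑nbr (λ _ → c) m ≡ degree j * c
∑nbr-const j c m len = begin
  ∑nbr (λ _ → c) m
    ≡⟨ ∑opick-cong m (λ e₁ r₁ p₁ → let l₁ = length-opick p₁ len in trans (∑opick-cong r₁ (λ e₂ r₂ p₂ → let l₂ = length-opick p₂ l₁ in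
         trans (∑opick-cong r₂ (λ e₃ r₃ p₃ → count r₃ c (length-opick p₃ l₂))) (count r₂ _ l₂))) (count r₁ _ l₁)) ⟩
  ∑opick m (λ _ _ → k₃ * (k₂ * (k₁ * c)))
    ≡⟨ count m _ len ⟩
  k₄ * (k₃ * (k₂ * (k₁ * c)))
    ≡⟨ solve 5 (λ a b d e c → a :* (b :* (d :* (e :* c))) := a :* (b :* (d :* e)) :* c) refl k₄ k₃ k₂ k₁ c ⟩
  degree j * c ∎
  where
  k₁ = fromℕ (double (1 ℕ.+ j))
  k₂ = fromℕ (double (2 ℕ.+ j))
  k₃ = fromℕ (double (3 ℕ.+ j))
  k₄ = fromℕ (double (4 ℕ.+ j))
  count : ∀ {k} (r : Matching) c → length r ≡ k → ∑opick r (λ _ _ → c) ≡ fromℕ (double k) * c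
  count r c refl = ∑opick-const r c

-- The Young symmetrizer of the one-row tableau sends the constant 1 to a nonzero constant `C`, up
-- to sign the order of the row group; constants have the valency as eigenvalue.
valency-eigenvalue : ∀ {n j g P} → n ≡ 4 ℕ.+ j → 2 ℕ.* n ≡ 5 ℕ.+ g → P ∈ Ms n → IsEigenvalue n [ n ] (hook4 n) (phi1 n + gap n)
valency-eigenvalue {n} {j} {g} {P₀} n≡ fuel≡ P₀∈ =
  v , ((σ₀ , w) ∷ [] , identity-∈-Sym n ∷ [] , All.tabulate (λ _ → refl)) , lose P₀∈ v≢0 , All.tabulate (λ {P} P∈ →
    *-cancel-≡ (fromℕ-pos 7) (begin
      fromℕ 8 * applyA n (hook4 n) v P
        ≡⟨ cong (fromℕ 8 *_) (applyA-cong n (hook4 n) (All.tabulate (λ {Q} _ → v-const Q)) P) ⟩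
      fromℕ 8 * applyA n (hook4 n) (λ _ → C) P
        ≡⟨ ∑nbr-applyA {n} {F = λ _ → C} fuel≡ (λ _ → refl) P∈ ⟨
      ∑nbr (λ _ → C) P
        ≡⟨ ∑nbr-const j C P (trans (full-length n (Ms-full n P∈)) n≡) ⟩
      degree j * C
        ≡⟨ cong₂ _*_ (trans (degree-gap j) (cong (λ k → fromℕ 8 * (phi1 k + gap k)) (sym n≡))) (sym (v-const P)) ⟩
      fromℕ 8 * (phi1 n + gap n) * v P
        ≡⟨ ℚ.*-assoc (fromℕ 8) (phi1 n + gap n) (v P) ⟩
      fromℕ 8 * ((phi1 n + gap n) * v P) ∎))
  where
  σ₀ = assoc (points n) (points n) ∘ id
  w : Vector
  w _ = 1ℚ
  v : Vector
  v P = sumOver ((σ₀ , w) ∷ []) (λ t → pull (proj₁ t) (young n [ n ] (proj₂ t)) P)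
  cols = trivial-blocks (tabCols (tabRows 0 [ n ])) (All.map⁺ (All.tabulate {xs = upTo (headLength (tabRows 0 [ n ]))} (λ {j} _ →
    subst (λ c → length c ℕ.≤ 1) (sym (List.++-identityʳ (nth (range 0 (2 ℕ.* n)) j))) (nth-length (range 0 (2 ℕ.* n)) j))))
  s = sgn (2 ℕ.* n) (proj₁ cols)
  C = s * size (rowGroup [ n ])
  v-const : ∀ P → v P ≡ C
  v-const P = begin
    young n [ n ] w (act σ₀ P) + 0ℚ
      ≡⟨ ℚ.+-identityʳ _ ⟩
    young n [ n ] w (act σ₀ P)
      ≡⟨ trans (∑-def (colGroup [ n ]) _) (cong (λ l → ∑ l (λ q → sgn (2 ℕ.* n) q * sumOver (rowGroup [ n ]) (λ _ → 1ℚ))) (proj₁ (proj₂ cols))) ⟩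
    ∑ (proj₁ cols ∷ []) (λ q → sgn (2 ℕ.* n) q * sumOver (rowGroup [ n ]) (λ _ → 1ℚ))
      ≡⟨ ∑-single (proj₁ cols) _ ⟩
    s * sumOver (rowGroup [ n ]) (λ _ → 1ℚ)
      ≡⟨ cong (s *_) (∑-def (rowGroup [ n ]) _) ⟩
    C ∎
  v≢0 : v P₀ ≢ 0ℚ
  v≢0 e = *-≢0 {s} {s} {size (rowGroup [ n ])} (sgn-² (2 ℕ.* n) (proj₁ cols)) (size-pos (proj₂ (∈-blockGroup (tabRows 0 [ n ])))) (trans (sym (v-const P₀)) e)

-- An eigenvector of shape [n-1,1]

weight-act : ∀ {Y} → Symm Y → ∀ σ m → weight Y (act σ m) ≡ weight (λ e → Y (σ (proj₁ e) , σ (proj₂ e))) m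
weight-act {Y} sy σ m = trans (sym (weight-HInv sy (canon-≈ (relabel σ m)))) (∑-map (λ e → σ (proj₁ e) , σ (proj₂ e)) m Y)

weight-cong : ∀ {Y Z : ℕ × ℕ → ℚ} → (∀ e → Y e ≡ Z e) → ∀ m → weight Y m ≡ weight Z m
weight-cong h m = ∑-cong m h

memb-cong : ∀ {w z} l → (w ∈ l → z ∈ l) → (z ∈ l → w ∈ l) → memb w l ≡ memb z l
memb-cong {w} {z} l f g with memb w l in e
... | true  = sym (∈-memb (f (memb-∈ w l e)))
... | false = sym (∉-memb (memb-∉ w l e ∘ g))

indicator-idem : ∀ b → indicator b * (fromℕ 2 - indicator b) ≡ indicator b
indicator-idem true  = refl
indicator-idem false = refl

-- The tableau of shape 2[n-1,1], with n - 1 = 2 + h.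
module Hook (h : ℕ) where

  m n u u' : ℕ
  m  = suc (suc h)
  n  = suc m
  -- The summands 0 and 1 match the entries of the second row as `range` computes them.
  u  = 2 ℕ.* m ℕ.+ 0
  u' = 2 ℕ.* m ℕ.+ 1

  la : List ℕ
  la = m ∷ 1 ∷ []

  sum≡ : sum la ≡ n
  sum≡ = ℕ.+-comm m 1

  row₀ row₁ col₀ col₁ : List ℕ
  row₀ = range 0 (2 ℕ.* m)
  row₁ = u ∷ u' ∷ []
  col₀ = 0 ∷ u ∷ []
  col₁ = 1 ∷ u' ∷ []

  -- The second row has two boxes, so only the first two columns have more than one entry.
  restCols : List (List ℕ)
  restCols = map (λ j → concatMap (λ r → nth r j) (tabRows 0 la)) (applyUpTo (λ x → suc (suc x)) (length row₀ ℕ.∸ 2))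

  restCols-trivial : All (λ b → length b ℕ.≤ 1) restCols
  restCols-trivial = All.map⁺ (All.applyUpTo⁺₂ _ _ (λ i → subst (λ c → length c ℕ.≤ 1)
    (sym (List.++-identityʳ (nth row₀ (suc (suc i))))) (nth-length row₀ (suc (suc i)))))

  rest = trivial-blocks restCols restCols-trivial

  e₀ : ℕ → ℕ
  e₀ = proj₁ rest

  e₀-id : ∀ z → e₀ z ≡ z
  e₀-id = proj₂ (proj₂ rest)

  s₀ s₁ : ℕ → ℕ
  s₀ = transpose 0 u
  s₁ = transpose 1 u'

  s₀-fix : ∀ {z} → z ≢ 0 → z ≢ u → s₀ z ≡ z
  s₀-fix = partner-≢ {0} {u} []

  s₁-fix : ∀ {z} → z ≢ 1 → z ≢ u' → s₁ z ≡ z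
  s₁-fix = partner-≢ {1} {u'} []

  0<u : 0 < u
  0<u = ℕ.s≤s ℕ.z≤n

  1<u : 1 < u
  1<u = ℕ.s≤s (ℕ.s≤s ℕ.z≤n)

  u<u' : u < u'
  u<u' = ℕ.+-monoʳ-< (2 ℕ.* m) (ℕ.s≤s ℕ.z≤n)

  u'<2n : u' < 2 ℕ.* n
  u'<2n = ℕ.≤-reflexive (trans (cong suc (ℕ.+-comm (2 ℕ.* m) 1)) (sym (ℕ.*-distribˡ-+ 2 1 m)))

  0≢u : 0 ≢ u
  0≢u = ℕ.<⇒≢ 0<u
  1≢u : 1 ≢ u
  1≢u = ℕ.<⇒≢ 1<u
  u≢u' : u ≢ u'
  u≢u' = ℕ.<⇒≢ u<u'
  0≢u' : 0 ≢ u'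
  0≢u' = ℕ.<⇒≢ (ℕ.<-trans 0<u u<u')
  1≢u' : 1 ≢ u'
  1≢u' = ℕ.<⇒≢ (ℕ.<-trans 1<u u<u')

  xs : List ℕ
  xs = points n

  0∈ : 0 ∈ xs
  0∈ = ∈-upTo⁺ (ℕ.<-trans (ℕ.<-trans 0<u u<u') u'<2n)
  1∈ : 1 ∈ xs
  1∈ = ∈-upTo⁺ (ℕ.<-trans (ℕ.<-trans 1<u u<u') u'<2n)
  u∈ : u ∈ xs
  u∈ = ∈-upTo⁺ (ℕ.<-trans u<u' u'<2n)
  u'∈ : u' ∈ xs
  u'∈ = ∈-upTo⁺ u'<2n

  id-Permutes : ∀ f → (∀ z → f z ≡ z) → Permutes xs f
  id-Permutes f h = ↭.↭-reflexive (trans (List.map-cong h xs) (List.map-id xs))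

  pair-Permutes : ∀ {x y} → x ≢ y → x ∈ xs → y ∈ xs → Permutes xs (transpose x y)
  pair-Permutes {x} {y} x≢y x∈ y∈ = assoc-Permutes {b = x ∷ y ∷ []} {y ∷ x ∷ []} (points-Unique n)
    ((x≢y ∷ []) ∷ ([] ∷ []) , λ { (here refl) → x∈ ; (there (here refl)) → y∈ }) (swap y x refl)

  s₀-Permutes : Permutes xs s₀
  s₀-Permutes = pair-Permutes 0≢u 0∈ u∈

  s₁-Permutes : Permutes xs s₁
  s₁-Permutes = pair-Permutes 1≢u' 1∈ u'∈

  ρ : ℕ → ℚ
  ρ z = indicator (memb z row₁)

  ρ-∉ : ∀ {z} → z ≢ u → z ≢ u' → ρ z ≡ 0ℚ
  ρ-∉ {z} p q = cong indicator (∉-memb {z} {row₁} λ { (here e) → p e ; (there (here e)) → q e })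

  ρ-u : ρ u ≡ 1ℚ
  ρ-u = cong indicator (∈-memb {u} {row₁} (here refl))
  ρ-u' : ρ u' ≡ 1ℚ
  ρ-u' = cong indicator (∈-memb {u'} {row₁} (there (here refl)))
  ρ-0 : ρ 0 ≡ 0ℚ
  ρ-0 = ρ-∉ 0≢u 0≢u'
  ρ-1 : ρ 1 ≡ 0ℚ
  ρ-1 = ρ-∉ 1≢u 1≢u'

  row₁∉row₀ : ∀ {z} → z ∈ row₁ → z ∉ row₀
  row₁∉row₀ i k = ℕ.<⇒≱ (proj₂ (∈-range⁻ 0 (2 ℕ.* m) k)) (low i)
    where
    low : ∀ {z} → z ∈ row₁ → 2 ℕ.* m ℕ.≤ z
    low (here refl)         = ℕ.m≤m+n (2 ℕ.* m) 0
    low (there (here refl)) = ℕ.m≤m+n (2 ℕ.* m) 1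

  -- The row group preserves the second row as a set, so it acts trivially on functions built from
  -- `ρ`.
  ρ-row : ∀ {p} → p ∈ rowGroup la → ∀ z → ρ (p z) ≡ ρ z
  ρ-row i z with ∈-blockGroup-∷ row₀ (row₁ ∷ []) i
  ... | o , g , refl , o∈ , g∈ with ∈-blockGroup-∷ row₁ [] g∈
  ... | o' , _ , refl , o'∈ , here refl = cong indicator (memb-cong row₁ (back z) (forth z))
    where
    lo = Perm.↭-length (orderings-↭ row₀ o∈)
    lo' = Perm.↭-length (orderings-↭ row₁ o'∈)
    forth : ∀ z → z ∈ row₁ → assoc row₀ o (assoc row₁ o' z) ∈ row₁
    forth z k = subst (_∈ row₁) (sym (assoc-∉ row₀ o (row₁∉row₀ w∈))) w∈
      where
      w∈ : assoc row₁ o' z ∈ row₁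
      w∈ = Perm.∈-resp-↭ (orderings-↭ row₁ o'∈) (assoc-∈ row₁ o' lo' k)
    back : ∀ z → assoc row₀ o (assoc row₁ o' z) ∈ row₁ → z ∈ row₁
    back z k with memb z row₁ in e
    ... | true  = memb-∈ z row₁ e
    ... | false with subst (λ w → assoc row₀ o w ∈ row₁) (assoc-∉ row₁ o' (memb-∉ z row₁ e)) k
    ... | k' with memb z row₀ in e₀
    ... | true  = ⊥-elim (row₁∉row₀ k' (Perm.∈-resp-↭ (orderings-↭ row₀ o∈) (assoc-∈ row₀ o lo (memb-∈ z row₀ e₀))))
    ... | false = subst (_∈ row₁) (assoc-∉ row₀ o (memb-∉ z row₀ e₀)) k'

  ρ₂ : ℕ × ℕ → ℚ
  ρ₂ e = ρ (proj₁ e) * ρ (proj₂ e)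

  ρ₂∘ : (ℕ → ℕ) → ℕ × ℕ → ℚ
  ρ₂∘ σ e = ρ₂ (σ (proj₁ e) , σ (proj₂ e))

  ρ₂∘-sym : ∀ σ → Symm (ρ₂∘ σ)
  ρ₂∘-sym σ a b = ℚ.*-comm (ρ (σ a)) (ρ (σ b))

  ∑-ρ : ∑ xs ρ ≡ fromℕ 2
  ∑-ρ = ∑-memb row₁ xs (points-Unique n) ((u≢u' ∷ []) ∷ ([] ∷ [])) λ { (here refl) → u∈ ; (there (here refl)) → u'∈ }

  -- Two points are marked by `ρ ∘ σ`. If `x` is one of them, the other is the only marked point
  -- among the rest.
  ∑-ρ₂∘ : ∀ {σ} → Permutes xs σ → ∀ x r → x ∷ r ↭ xs → ∑ r (λ y → ρ₂∘ σ (x , y)) ≡ ρ (σ x)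
  ∑-ρ₂∘ {σ} pσ x r p = begin
    ∑ r (λ y → ρ (σ x) * ρ (σ y))
      ≡⟨ ∑-*ˡ (ρ (σ x)) r (ρ ∘ σ) ⟩
    ρ (σ x) * ∑ r (ρ ∘ σ)
      ≡⟨ cong (ρ (σ x) *_) (trans (solve 2 (λ a s → s := (a :+ s) :- a) refl (ρ (σ x)) (∑ r (ρ ∘ σ))) (cong (_- ρ (σ x)) (begin
           ρ (σ x) + ∑ r (ρ ∘ σ)  ≡⟨ ∑-∷ x r (ρ ∘ σ) ⟨
           ∑ (x ∷ r) (ρ ∘ σ)      ≡⟨ ∑-↭ (ρ ∘ σ) p ⟩
           ∑ xs (ρ ∘ σ)           ≡⟨ ∑-map σ xs ρ ⟨
           ∑ (map σ xs) ρ         ≡⟨ ∑-↭ ρ pσ ⟩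
           ∑ xs ρ                 ≡⟨ ∑-ρ ⟩
           fromℕ 2 ∎))) ⟩
    ρ (σ x) * (fromℕ 2 - ρ (σ x))
      ≡⟨ indicator-idem (memb (σ x) row₁) ⟩
    ρ (σ x) ∎

  -- The polytabloid of shape [2n-2,2]: the indicator of the edge {u,u'}, alternated over the column
  -- group generated by `s₀` and `s₁`.
  Y : ℕ × ℕ → ℚ
  Y e = ρ₂∘ id e - ρ₂∘ s₁ e - ρ₂∘ s₀ e + ρ₂∘ (s₀ ∘ s₁) e

  Y-sym : Symm Y
  Y-sym a b = cong₂ _+_ (cong₂ _-_ (cong₂ _-_ (ρ₂∘-sym id a b) (ρ₂∘-sym s₁ a b)) (ρ₂∘-sym s₀ a b)) (ρ₂∘-sym (s₀ ∘ s₁) a b)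

  weight-Y : ∀ r → ∑ r Y ≡ ∑ r (ρ₂∘ id) - ∑ r (ρ₂∘ s₁) - ∑ r (ρ₂∘ s₀) + ∑ r (ρ₂∘ (s₀ ∘ s₁))
  weight-Y r = trans (∑-+ r (λ e → ρ₂∘ id e - ρ₂∘ s₁ e - ρ₂∘ s₀ e) (ρ₂∘ (s₀ ∘ s₁))) (cong (_+ ∑ r (ρ₂∘ (s₀ ∘ s₁)))
    (trans (minus r (λ e → ρ₂∘ id e - ρ₂∘ s₁ e) (ρ₂∘ s₀)) (cong (_- ∑ r (ρ₂∘ s₀)) (minus r (ρ₂∘ id) (ρ₂∘ s₁)))))
    where
    minus : ∀ {A : Set} (r : List A) (f g : A → ℚ) → ∑ r (λ e → f e - g e) ≡ ∑ r f - ∑ r g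
    minus r f g = trans (∑-+ r f (λ e → - g e)) (cong (∑ r f +_) (∑-neg r g))

  -- Summing over one endpoint turns each term into `ρ` at the image of `x`. One of the two
  -- transpositions fixes `x`, and the alternating sum cancels in pairs.
  Y-rows : RowsVanish xs Y
  Y-rows x r p = begin
    ∑ r (λ y → Y (x , y))
      ≡⟨ trans (sym (∑-map (x ,_) r Y)) (weight-Y (map (x ,_) r)) ⟩
    ∑ (map (x ,_) r) (ρ₂∘ id) - ∑ (map (x ,_) r) (ρ₂∘ s₁) - ∑ (map (x ,_) r) (ρ₂∘ s₀) + ∑ (map (x ,_) r) (ρ₂∘ (s₀ ∘ s₁))
      ≡⟨ cong₂ _+_ (cong₂ _-_ (cong₂ _-_ (row (id-Permutes id (λ _ → refl))) (row s₁-Permutes)) (row s₀-Permutes))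
           (row (∘-Permutes {xs} {s₀} {s₁} s₀-Permutes s₁-Permutes)) ⟩
    ρ x - ρ (s₁ x) - ρ (s₀ x) + ρ (s₀ (s₁ x))
      ≡⟨ cancel ⟩
    0ℚ ∎
    where
    row : ∀ {σ} → Permutes xs σ → ∑ (map (x ,_) r) (ρ₂∘ σ) ≡ ρ (σ x)
    row {σ} pσ = trans (∑-map (x ,_) r (ρ₂∘ σ)) (∑-ρ₂∘ pσ x r p)
    s₁-fixed : s₁ x ≡ x → ρ x - ρ (s₁ x) - ρ (s₀ x) + ρ (s₀ (s₁ x)) ≡ 0ℚ
    s₁-fixed e = trans (cong (λ t → ρ x - ρ t - ρ (s₀ x) + ρ (s₀ t)) e)
      (solve 2 (λ a b → a :- a :- b :+ b := con 0ℚ) refl (ρ x) (ρ (s₀ x)))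
    s₀-fixed : s₀ x ≡ x → s₀ (s₁ x) ≡ s₁ x → ρ x - ρ (s₁ x) - ρ (s₀ x) + ρ (s₀ (s₁ x)) ≡ 0ℚ
    s₀-fixed e f = trans (cong₂ (λ t w → ρ x - ρ (s₁ x) - ρ t + ρ w) e f)
      (solve 2 (λ a b → a :- b :- a :+ b := con 0ℚ) refl (ρ x) (ρ (s₁ x)))
    cancel : ρ x - ρ (s₁ x) - ρ (s₀ x) + ρ (s₀ (s₁ x)) ≡ 0ℚ
    cancel with x ℕ.≟ 1 | x ℕ.≟ u'
    ... | yes refl | _ = s₀-fixed (s₀-fix (λ ()) 1≢u)
      (trans (cong s₀ (partner-fst 1 u' [])) (trans (s₀-fix (0≢u' ∘ sym) (u≢u' ∘ sym)) (sym (partner-fst 1 u' []))))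
    ... | no _ | yes refl = s₀-fixed (s₀-fix (0≢u' ∘ sym) (u≢u' ∘ sym))
      (trans (cong s₀ (partner-snd {1} {u'} [] (1≢u' ∘ sym))) (trans (s₀-fix (λ ()) 1≢u) (sym (partner-snd {1} {u'} [] (1≢u' ∘ sym)))))
    ... | no x≢1 | no x≢u' = s₁-fixed (s₁-fix x≢1 x≢u')

  -- On perfect matchings of the points, the indicator of those that contain the edge {u,u'}.
  w : Vector
  w = weight ρ₂

  σ₀ : ℕ → ℕ
  σ₀ = assoc (points n) (points n) ∘ id

  v : Vector
  v P = sumOver ((σ₀ , w) ∷ []) (λ t → pull (proj₁ t) (young n la (proj₂ t)) P)

  D : ℚ
  D = sgn (2 ℕ.* n) e₀

  C : ℚ
  C = D * size (rowGroup la)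

  ∑-colGroup : ∀ (F : (ℕ → ℕ) → ℚ) → ∑ (colGroup la) F ≡
               (F (assoc col₀ col₀ ∘ (assoc col₁ col₁ ∘ e₀)) + F (assoc col₀ col₀ ∘ (s₁ ∘ e₀)))
               + (F (s₀ ∘ (assoc col₁ col₁ ∘ e₀)) + F (s₀ ∘ (s₁ ∘ e₀)))
  ∑-colGroup F = trans (∑-blockGroup-∷ col₀ (col₁ ∷ restCols) F) (trans (∑-∷ _ _ _) (cong₂ _+_ (inner₂ (assoc col₀ col₀))
      (trans (∑-single _ _) (inner₂ s₀))))
    where
    inner₂ : ∀ f → ∑ (blockGroup (col₁ ∷ restCols)) (λ g → F (f ∘ g)) ≡ F (f ∘ (assoc col₁ col₁ ∘ e₀)) + F (f ∘ (s₁ ∘ e₀))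
    inner₂ f = trans (∑-blockGroup-∷ col₁ restCols (λ g → F (f ∘ g))) (trans
      (∑-cong (orderings col₁) (λ o → trans (cong (λ l → ∑ l (λ g → F (f ∘ (assoc col₁ o ∘ g)))) (proj₁ (proj₂ rest))) (∑-single e₀ _)))
      (trans (∑-∷ _ _ _) (cong (F (f ∘ (assoc col₁ col₁ ∘ e₀)) +_) (∑-single _ _))))

  e₀-Permutes : Permutes xs e₀
  e₀-Permutes = id-Permutes e₀ e₀-id

  -- The row group leaves `w` unchanged and contributes its order, and the column group alternates
  -- `w` into `weight Y`; `D` is the sign of the pointwise identity `e₀`.
  v-weight : ∀ P → v P ≡ C * weight Y P
  v-weight P = begin
    young n la w (act σ₀ P) + 0ℚ
      ≡⟨ trans (ℚ.+-identityʳ _) (trans (∑-def (colGroup la) _) (∑-cong (colGroup la) (λ q →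
           cong (sgn (2 ℕ.* n) q *_) (trans (∑-def (rowGroup la) _) (rows q))))) ⟩
    ∑ (colGroup la) (λ q → sgn (2 ℕ.* n) q * (size (rowGroup la) * W q))
      ≡⟨ trans (∑-colGroup (λ q → sgn (2 ℕ.* n) q * (R * W q))) (cong₂ _+_
           (cong₂ _+_ (term q₀₀ id (λ z → trans (q₀₀-e₀ z) (e₀-id z)) D (sgn-cong (2 ℕ.* n) {q₀₀} {e₀} (λ z _ → q₀₀-e₀ z)))
                      (term q₀₁ s₁ (λ z → trans (q₀₁-s₁ z) (cong s₁ (e₀-id z))) (- D)
                        (trans (sgn-cong (2 ℕ.* n) {q₀₁} {s₁ ∘ e₀} (λ z _ → q₀₁-s₁ z)) sgn-s₁)))
           (cong₂ _+_ (term q₁₀ s₀ (λ z → trans (q₁₀-s₀ z) (cong s₀ (e₀-id z))) (- D)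
                        (trans (sgn-cong (2 ℕ.* n) {q₁₀} {s₀ ∘ e₀} (λ z _ → q₁₀-s₀ z))
                          (sgn-transpose (2 ℕ.* n) {σ = e₀} 0≢u (∈-upTo⁻ 0∈) (∈-upTo⁻ u∈) e₀-Permutes)))
                      (term q₁₁ (s₀ ∘ s₁) (λ z → cong (λ z → s₀ (s₁ z)) (e₀-id z)) (- - D)
                        (trans (sgn-transpose (2 ℕ.* n) {σ = s₁ ∘ e₀} 0≢u (∈-upTo⁻ 0∈) (∈-upTo⁻ u∈)
                          (∘-Permutes {xs} {s₁} {e₀} s₁-Permutes e₀-Permutes)) (cong -_ sgn-s₁))))) ⟩
    (D * (R * W id) + (- D) * (R * W s₁)) + ((- D) * (R * W s₀) + (- - D) * (R * W (s₀ ∘ s₁)))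
      ≡⟨ solve 6 (λ d r a b c e → (d :* (r :* a) :+ (:- d) :* (r :* b)) :+ ((:- d) :* (r :* c) :+ (:- (:- d)) :* (r :* e))
           := d :* r :* (a :- b :- c :+ e)) refl D R (W id) (W s₁) (W s₀) (W (s₀ ∘ s₁)) ⟩
    C * (W id - W s₁ - W s₀ + W (s₀ ∘ s₁))
      ≡⟨ cong (C *_) (weight-Y P) ⟨
    C * weight Y P ∎
    where
    R = size (rowGroup la)
    W : (ℕ → ℕ) → ℚ
    W σ = weight (ρ₂∘ σ) P
    sgn-s₁ : sgn (2 ℕ.* n) (s₁ ∘ e₀) ≡ - D
    sgn-s₁ = sgn-transpose (2 ℕ.* n) {σ = e₀} 1≢u' (∈-upTo⁻ 1∈) (∈-upTo⁻ u'∈) e₀-Permutes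
    q₀₀ q₀₁ q₁₀ q₁₁ : ℕ → ℕ
    q₀₀ = assoc col₀ col₀ ∘ (assoc col₁ col₁ ∘ e₀)
    q₀₁ = assoc col₀ col₀ ∘ (s₁ ∘ e₀)
    q₁₀ = s₀ ∘ (assoc col₁ col₁ ∘ e₀)
    q₁₁ = s₀ ∘ (s₁ ∘ e₀)
    q₀₀-e₀ : ∀ z → q₀₀ z ≡ e₀ z
    q₀₀-e₀ z = trans (assoc-self col₀ (assoc col₁ col₁ (e₀ z))) (assoc-self col₁ (e₀ z))
    q₀₁-s₁ : ∀ z → q₀₁ z ≡ s₁ (e₀ z)
    q₀₁-s₁ z = assoc-self col₀ (s₁ (e₀ z))
    q₁₀-s₀ : ∀ z → q₁₀ z ≡ s₀ (e₀ z)
    q₁₀-s₀ z = cong s₀ (assoc-self col₁ (e₀ z))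
    term : ∀ σ τ → (∀ z → σ z ≡ τ z) → ∀ d → sgn (2 ℕ.* n) σ ≡ d →
           sgn (2 ℕ.* n) σ * (R * W σ) ≡ d * (R * W τ)
    term σ τ h d e = cong₂ (λ s t → s * (R * t)) e
      (weight-cong {ρ₂∘ σ} {ρ₂∘ τ} (λ (a , b) → cong₂ (λ x y → ρ x * ρ y) (h a) (h b)) P)
    rows : ∀ q → ∑ (rowGroup la) (λ p → w (act p (act q (act σ₀ P)))) ≡ R * W q
    rows q = trans (∑-cong∈ (rowGroup la) {g = λ _ → 1ℚ * W q} (λ {p} p∈ → begin
      weight ρ₂ (act p (act q (act σ₀ P)))
        ≡⟨ weight-act (ρ₂∘-sym id) p (act q (act σ₀ P)) ⟩
      weight (ρ₂∘ p) (act q (act σ₀ P))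
        ≡⟨ weight-cong {ρ₂∘ p} {ρ₂} (λ (a , b) → cong₂ _*_ (ρ-row p∈ a) (ρ-row p∈ b)) (act q (act σ₀ P)) ⟩
      weight ρ₂ (act q (act σ₀ P))
        ≡⟨ weight-act (ρ₂∘-sym id) q (act σ₀ P) ⟩
      weight (ρ₂∘ q) (act σ₀ P)
        ≡⟨ weight-act (ρ₂∘-sym q) σ₀ P ⟩
      weight (ρ₂∘ (q ∘ σ₀)) P
        ≡⟨ weight-cong {ρ₂∘ (q ∘ σ₀)} {ρ₂∘ q} (λ (a , b) → cong₂ (λ x y → ρ (q x) * ρ (q y)) (assoc-self (points n) a) (assoc-self (points n) b)) P ⟩
      W q
        ≡⟨ ℚ.*-identityˡ (W q) ⟨
      1ℚ * W q ∎)) (∑-*ʳ (W q) (rowGroup la) (λ _ → 1ℚ))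

  private
    others = complement {0 ∷ 1 ∷ u ∷ u' ∷ []} {xs}
      (((λ ()) ∷ 0≢u ∷ 0≢u' ∷ []) ∷ (1≢u ∷ 1≢u' ∷ []) ∷ (u≢u' ∷ []) ∷ [] ∷ [])
      λ { (here refl) → 0∈ ; (there (here refl)) → 1∈ ; (there (there (here refl))) → u∈ ; (there (there (there (here refl)))) → u'∈ }

  -- {0,1} and {u,u'} are the edges that `s₀ ∘ s₁` and the identity carry to the second row, both
  -- with sign +. All other edges avoid these four points and have weight zero.
  witness : Matching
  witness = (0 , 1) ∷ (u , u') ∷ pairs (proj₁ others)

  others-length : length (proj₁ others) ≡ double (suc h)
  others-length = ℕ.+-cancelˡ-≡ 4 _ _ (trans (Perm.↭-length (proj₂ others)) (points-length n))

  flat-others : flat (pairs (proj₁ others)) ≡ proj₁ others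
  flat-others = flat-pairs (suc h) (proj₁ others) others-length

  witness-full : flat witness ↭ xs
  witness-full = subst (λ l → 0 ∷ 1 ∷ u ∷ u' ∷ l ↭ xs) (sym flat-others) (proj₂ others)

  weight-witness : weight Y witness ≡ fromℕ 2
  weight-witness = trans (∑-∷ _ _ Y) (trans (cong₂ _+_ Y-01 (trans (∑-∷ _ _ Y) (cong₂ _+_ Y-uu' (∑-zero (pairs (proj₁ others)) away)))) refl)
    where
    Y-value : ∀ a b {x₁ y₁ x₂ y₂ x₃ y₃ x₄ y₄} → ρ a ≡ x₁ → ρ b ≡ y₁ → ρ (s₁ a) ≡ x₂ → ρ (s₁ b) ≡ y₂ → ρ (s₀ a) ≡ x₃ → ρ (s₀ b) ≡ y₃ →
              ρ (s₀ (s₁ a)) ≡ x₄ → ρ (s₀ (s₁ b)) ≡ y₄ → Y (a , b) ≡ x₁ * y₁ - x₂ * y₂ - x₃ * y₃ + x₄ * y₄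
    Y-value a b e₁ f₁ e₂ f₂ e₃ f₃ e₄ f₄ =
      cong₂ _+_ (cong₂ _-_ (cong₂ _-_ (cong₂ _*_ e₁ f₁) (cong₂ _*_ e₂ f₂)) (cong₂ _*_ e₃ f₃)) (cong₂ _*_ e₄ f₄)
    s₀0 : s₀ 0 ≡ u
    s₀0 = partner-fst 0 u []
    s₀u : s₀ u ≡ 0
    s₀u = partner-snd {0} {u} [] (0≢u ∘ sym)
    s₁1 : s₁ 1 ≡ u'
    s₁1 = partner-fst 1 u' []
    s₁u' : s₁ u' ≡ 1
    s₁u' = partner-snd {1} {u'} [] (1≢u' ∘ sym)
    s₁0 : s₁ 0 ≡ 0
    s₁0 = s₁-fix (λ ()) 0≢u'
    s₁u : s₁ u ≡ u
    s₁u = s₁-fix (1≢u ∘ sym) u≢u'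
    s₀1 : s₀ 1 ≡ 1
    s₀1 = s₀-fix (λ ()) 1≢u
    s₀u' : s₀ u' ≡ u'
    s₀u' = s₀-fix (0≢u' ∘ sym) (u≢u' ∘ sym)
    Y-01 : Y (0 , 1) ≡ 1ℚ
    Y-01 = Y-value 0 1 ρ-0 ρ-1 (trans (cong ρ s₁0) ρ-0) (trans (cong ρ s₁1) ρ-u') (trans (cong ρ s₀0) ρ-u) (trans (cong ρ s₀1) ρ-1)
      (trans (cong ρ (trans (cong s₀ s₁0) s₀0)) ρ-u) (trans (cong ρ (trans (cong s₀ s₁1) s₀u')) ρ-u')
    Y-uu' : Y (u , u') ≡ 1ℚ
    Y-uu' = Y-value u u' ρ-u ρ-u' (trans (cong ρ s₁u) ρ-u) (trans (cong ρ s₁u') ρ-1) (trans (cong ρ s₀u) ρ-0) (trans (cong ρ s₀u') ρ-u')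
      (trans (cong ρ (trans (cong s₀ s₁u) s₀u)) ρ-0) (trans (cong ρ (trans (cong s₀ s₁u') s₀1)) ρ-1)
    first∈ : ∀ {e : ℕ × ℕ} {r} → e ∈ r → proj₁ e ∈ flat r
    first∈ {r = _ ∷ r} (here refl) = here refl
    first∈ {r = _ ∷ r} (there i)   = there (there (first∈ i))
    away : ∀ {e} → e ∈ pairs (proj₁ others) → Y e ≡ 0ℚ
    away {a , b} i = trans
      (Y-value a b ρa refl (trans (cong ρ s₁a) ρa) refl (trans (cong ρ s₀a) ρa) refl (trans (cong ρ (trans (cong s₀ s₁a) s₀a)) ρa) refl)
      (solve 4 (λ p q r t → con 0ℚ :* p :- con 0ℚ :* q :- con 0ℚ :* r :+ con 0ℚ :* t := con 0ℚ) refl (ρ b) (ρ (s₁ b)) (ρ (s₀ b)) (ρ (s₀ (s₁ b))))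
      where
      a∉ : a ∉ 0 ∷ 1 ∷ u ∷ u' ∷ []
      a∉ = unique-disjoint (0 ∷ 1 ∷ u ∷ u' ∷ []) (Unique-↭ (↭-sym (proj₂ others)) (points-Unique n)) (subst (a ∈_) flat-others (first∈ i))
      ρa : ρ a ≡ 0ℚ
      ρa = ρ-∉ (λ e → a∉ (there (there (here e)))) (λ e → a∉ (there (there (there (here e)))))
      s₁a : s₁ a ≡ a
      s₁a = s₁-fix (λ e → a∉ (there (here e))) (λ e → a∉ (there (there (there (here e)))))
      s₀a : s₀ a ≡ a
      s₀a = s₀-fix (λ e → a∉ (here e)) (λ e → a∉ (there (there (here e))))

  v-witness : v (canon witness) ≢ 0ℚ
  v-witness e = *-≢0 {D} {D} (sgn-² (2 ℕ.* n) e₀)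
    (*-pos (size-pos (proj₂ (∈-blockGroup (tabRows 0 la)))) (fromℕ-pos 1)) (begin
      D * (size (rowGroup la) * fromℕ 2)   ≡⟨ ℚ.*-assoc D (size (rowGroup la)) (fromℕ 2) ⟨
      C * fromℕ 2                          ≡⟨ cong (C *_) (trans (sym (weight-HInv Y-sym (canon-≈ witness))) weight-witness) ⟨
      C * weight Y (canon witness)         ≡⟨ v-weight (canon witness) ⟨
      v (canon witness)                    ≡⟨ e ⟩
      0ℚ ∎)

  phi1-eigenvalue : ∀ {j g} → n ≡ 4 ℕ.+ j → 2 ℕ.* n ≡ 5 ℕ.+ g → IsEigenvalue n la (hook4 n) (phi1 n)
  phi1-eigenvalue {j} {g} n≡ fuel≡ =
    v , ((σ₀ , w) ∷ [] , identity-∈-Sym n ∷ [] , All.tabulate (λ _ → refl)) , lose (canon-∈ n witness-full) v-witness ,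
    All.tabulate (λ {P} P∈ → *-cancel-≡ (fromℕ-pos 7) (begin
      fromℕ 8 * applyA n (hook4 n) v P
        ≡⟨ cong (fromℕ 8 *_) (applyA-cong n (hook4 n) (All.tabulate (λ {Q} _ → v-weight Q)) P) ⟩
      fromℕ 8 * applyA n (hook4 n) (λ Q → C * weight Y Q) P
        ≡⟨ ∑nbr-applyA {n} fuel≡ (λ p → cong (C *_) (weight-HInv Y-sym p)) P∈ ⟨
      ∑nbr (λ Q → C * weight Y Q) P
        ≡⟨ ∑nbr-*ˡ P ⟩
      C * ∑nbr (weight Y) P
        ≡⟨ cong (C *_) (∑nbr-weight xs Y-sym Y-rows j P (trans (full-length n (Ms-full n P∈)) n≡) (Ms-full n P∈)) ⟩
      C * (eigen j * weight Y P)
        ≡⟨ cong (λ t → C * (t * weight Y P)) (trans (eigen-phi1 j) (cong (λ k → fromℕ 8 * phi1 k) (sym n≡))) ⟩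
      C * (fromℕ 8 * phi1 n * weight Y P)
        ≡⟨ solve 4 (λ c e p w → c :* (e :* p :* w) := e :* (p :* (c :* w))) refl C (fromℕ 8) (phi1 n) (weight Y P) ⟩
      fromℕ 8 * (phi1 n * (C * weight Y P))
        ≡⟨ cong (λ t → fromℕ 8 * (phi1 n * t)) (v-weight P) ⟨
      fromℕ 8 * (phi1 n * v P) ∎))
    where
    ∑nbr-*ˡ : ∀ P → ∑nbr (λ Q → C * weight Y Q) P ≡ C * ∑nbr (weight Y) P
    ∑nbr-*ˡ P = trans (∑opick-cong P (λ e₁ r₁ _ → trans (∑opick-cong r₁ (λ e₂ r₂ _ → trans (∑opick-cong r₂ (λ e₃ r₃ _ →
      ∑opick-*ˡ r₃ C _)) (∑opick-*ˡ r₂ C _))) (∑opick-*ˡ r₁ C _))) (∑opick-*ˡ P C _)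

theorem4p6 : (n : ℕ) → 6 ≤ n →
  ((la : List ℕ) → IsPartition n la → la ≢ [ n ] →
     (a : ℚ) → IsEigenvalue n la (hook4 n) a → a ≤ℚ phi1 n)
  × IsEigenvalue n (n ∸ 1 ∷ 1 ∷ []) (hook4 n) (phi1 n)
  × IsEigenvalue n [ n ] (hook4 n) (phi1 n + gap n)
theorem4p6 (suc (suc (suc (suc (suc (suc i)))))) (ℕ.s≤s (ℕ.s≤s (ℕ.s≤s (ℕ.s≤s (ℕ.s≤s (ℕ.s≤s _)))))) =
  -- With n = 6 + i, the index of `eigen` is n - 4 = 2 + i and the parameter of `Hook` is n - 3 = 3
  -- + i.
  (λ la part ne a → eigenvalue-≤ {6 ℕ.+ i} {i} refl la part ne) ,
  Hook.phi1-eigenvalue (3 ℕ.+ i) {2 ℕ.+ i} refl fuel≡ ,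
  valency-eigenvalue {6 ℕ.+ i} {2 ℕ.+ i} refl fuel≡ (canon-∈ (6 ℕ.+ i) (Hook.witness-full (3 ℕ.+ i)))
  where
  fuel≡ : 2 ℕ.* (6 ℕ.+ i) ≡ 5 ℕ.+ (7 ℕ.+ double i)
  fuel≡ = double-2* (6 ℕ.+ i)
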